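{- Let $G=(V,E)$ be a weighted graph with measure $\mu$ satisfying the standing assumptions given in the context, and let $K\in\mathbb{R}$. Then the condition $CDE'(\infty,-K)$ holds if and only if for every positive bounded function $0<f\in\ell^\infty(V,\mu)$ and every $t\ge 0$, $$\Gamma(\sqrt{P_{t}f}) \leq e^{2Kt}P_{t}(\Gamma(\sqrt{f}))\quad\text{pointwise on }V.$$
   Context: Standing assumptions. $G=(V,E)$ is a connected (finite or infinite) graph with symmetric weight $\omega:V\times V\to[0,\infty)$, $\omega_{xy}=\omega_{yx}$, where $x\sim y$ (i.e. $xy$ is an edge) iff $\omega_{xy}>0$; $\omega_{\min}=\inf_{x\sim y}\omega_{xy}>0$; $G$ is locally finite, $m(x):=\sum_{y\sim x}\omega_{xy}<\infty$ for all $x$. $\mu:V\to(0,\infty)$ is a measure with $D_\mu:=\sup_{x\in V} m(x)/\mu(x)<\infty$. $\ell^\infty(V,\mu)$ is the space of bounded real functions on $V$ with the sup norm. Laplacian: $\Delta f(x)=\frac1{\mu(x)}\sum_{y\sim x}\omega_{xy}(f(y)-f(x))$. Gradient form: $2\Gamma(f,g)=\Delta(fg)-f\Delta g-g\Delta f$, i.e. $2\Gamma(f,g)(x)=\frac1{\mu(x)}\sum_{y\sim x}\omega_{xy}(f(y)-f(x))(g(y)-g(x))$, $\Gamma(f)=\Gamma(f,f)$. For positive $f:V\to(0,\infty)$, $\widetilde{\Gamma}_2(f)=\frac12\Delta\Gamma(f)-\Gamma\!\left(f,\frac{\Delta (f^2)}{2f}\right)$. $CDE'(n,K)$: for every positive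 function $f:V\to(0,\infty)$ and every $x\in V$, $\widetilde{\Gamma}_2(f)(x)\ge\frac1n f(x)^2\big((\Delta\log f)(x)\big)^2+K\Gamma(f)(x)$. For $n=\infty$ one sets $\frac1n=0$, so $CDE'(\infty,-K)$ says $\widetilde{\Gamma}_2(f)\ge -K\Gamma(f)$ pointwise for every positive $f$. Heat semigroup: for a finite $U\subset V$ let $\overset{\circ}{U}=\{x\in U: y\in U\text{ for all }y\sim x\}$, let $\Delta_U$ be the Dirichlet Laplacian on $\ell^2(\overset{\circ}{U},\mu)$ (extend by $0$ outside $\overset{\circ}{U}$, apply $\Delta$, restrict to $\overset{\circ}{U}$), and let $p_U(t,x,y)=\sum_i e^{ -\lambda_i t}\phi_i(x)\phi_i(y)$ for $x,y\in\overset{\circ}{U}$, where $(\phi_i)$ is an $\ell^2(\overset{\circ}{U},\mu)$-orthonormal basis of eigenfunctions of $-\Delta_U$ with eigenvalues $\lambda_i$; extend $p_U$ by $0$ to $V\times V$. For an exhaustion of $V$ by finite sets $U_k$ with $U_k\subset\overset{\circ}{U}_{k+1}$, $\bigcup_k U_k=V$, the heat kernel is $p_t(x,y)=\lim_{k\to\infty}p_{U_k}(t,x,y)$ (independent of the exhaustion). For $f\in\ell^\infty(V,\mu)$ and $t>0$, $P_tf(x)=\sum_{y\in V}\mu(y)p_t(x,y)f(y)$, and $P_0f=f$. -}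

module Defs where

open import Algebra.Bundles using (CommutativeRing; Semiring)
open import Axiom.ExcludedMiddle using (ExcludedMiddle)
open import Data.Fin using (Fin)
open import Data.List using (List; foldr; map; filter; upTo)
open import Data.List.Membership.Propositional using (_∈_)
open import Data.List.Relation.Binary.Subset.Propositional using (_⊆_)
open import Data.List.Relation.Unary.Unique.Propositional using (Unique)
open import Data.Nat using (ℕ; _!)
import Data.Nat as ℕ
open import Data.Product using (Σ-syntax; ∃; ∃-syntax; _×_; proj₁)
open import Function using (_∘_; _⇔_)
open import Level using (0ℓ; suc)
open import Relation.Binary.Construct.Closure.ReflexiveTransitive using (Star)
import Relation.Binary.Construct.NonStrictToStrict as ToStrict
open import Relation.Binary.Structures using (IsTotalOrder)
open import Relation.Binary.PropositionalEquality using (_≡_)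
open import Relation.Nullary using (¬_; Dec; yes; no; does)
open import Data.Bool using (if_then_else_)

-- A Dedekind-complete ordered field.  The axioms are categorical: the models
-- are exactly the isomorphic copies of ℝ, up to the setoid equality _≈_.
record Reals : Set (suc 0ℓ) where
  infix 4 _≤_ _<_
  field
    commutativeRing : CommutativeRing 0ℓ 0ℓ

  open CommutativeRing commutativeRing public

  field
    _≤_          : Carrier → Carrier → Set
    isTotalOrder : IsTotalOrder _≈_ _≤_

  IsUpperBound : (Carrier → Set) → Carrier → Set
  IsUpperBound S b = ∀ x → S x → x ≤ b

  field
    0≉1        : ¬ 0# ≈ 1#
    invertible : ∀ x → ¬ x ≈ 0# → ∃[ y ] x * y ≈ 1#
    +-monoʳ-≤  : ∀ z {x y} → x ≤ y → z + x ≤ z + y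
    *-nonNeg   : ∀ {x y} → 0# ≤ x → 0# ≤ y → 0# ≤ x * y
    supremum   : (S : Carrier → Set) → ∃ S → ∃ (IsUpperBound S) →
                 ∃[ s ] IsUpperBound S s × (∀ b → IsUpperBound S b → s ≤ b)

  _<_ : Carrier → Carrier → Set
  _<_ = ToStrict._<_ _≈_ _≤_

module Analysis (lem : ExcludedMiddle 0ℓ) (ℛ : Reals) where

  open Reals ℛ public
  open import Algebra.Definitions.RawMonoid +-rawMonoid public
    using (sum) renaming (_×_ to _·_)
  open import Algebra.Definitions.RawSemiring
    (Semiring.rawSemiring semiring) public using (_^_)

  infixl 7 _/_
  infix 4 _⟶_

  -- Definite description: some element satisfying P, or the junk value 0 when
  -- there is none.  It is applied below only to predicates that determine
  -- their argument up to _≈_.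
  the : (Carrier → Set) → Carrier
  the P with lem {∃ P}
  ... | yes p = proj₁ p
  ... | no  _ = 0#

  2# : Carrier
  2# = 1# + 1#

  _/_ : Carrier → Carrier → Carrier
  x / y = the λ z → z * y ≈ x × ¬ y ≈ 0#

  √_ : Carrier → Carrier
  √ x = the λ y → 0# ≤ y × y * y ≈ x

  Within : Carrier → Carrier → Carrier → Set
  Within ε x y = x - y < ε × y - x < ε

  _⟶_ : (ℕ → Carrier) → Carrier → Set
  a ⟶ l = ∀ ε → 0# < ε → ∃[ N ] (∀ n → N ℕ.≤ n → Within ε (a n) l)

  lim : (ℕ → Carrier) → Carrier
  lim a = the (a ⟶_)

  ∑[_] : {A : Set} → List A → (A → Carrier) → Carrier
  ∑[ xs ] g = foldr _+_ 0# (map g xs)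

  exp : Carrier → Carrier
  exp x = lim λ n → ∑[ upTo n ] λ k → x ^ k / ((k !) · 1#)

  log : Carrier → Carrier
  log x = the λ y → exp y ≈ x

  record FinSet (A : Set) : Set where
    field
      elements : List A
      unique   : Unique elements

  open FinSet public

  -- Unconditional summation, i.e. along the directed set of finite subsets.
  HasSum : {A : Set} → (A → Carrier) → Carrier → Set
  HasSum {A} g s = ∀ ε → 0# < ε →
    Σ[ S ∈ FinSet A ] ((T : FinSet A) → elements S ⊆ elements T →
                       Within ε (∑[ elements T ] g) s)

  ∑ : {A : Set} → (A → Carrier) → Carrier
  ∑ g = the (HasSum g)

  data Dimension : Set where
    fin : (n : Carrier) → 0# < n → Dimension
    ∞   : Dimension

  1/_ : Dimension → Carrier
  1/ fin n _ = 1# / n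
  1/ ∞       = 0#

  -- Loops (ω x x > 0) are allowed; they enter only through m.  Local finiteness
  -- is an enumeration of each neighbourhood, and ω-min and D-bound say that the
  -- infimum of ω over the edges is positive and the supremum of m/μ is finite.
  record WeightedGraph : Set (suc 0ℓ) where
    infix 4 _∼_
    field
      V : Set
      ω : V → V → Carrier

    _∼_ : V → V → Set
    x ∼ y = 0# < ω x y

    field
      ω-nonNeg    : ∀ x y → 0# ≤ ω x y
      ω-sym       : ∀ x y → ω x y ≈ ω y x
      ω-min       : ∃[ c ] 0# < c × (∀ x y → x ∼ y → c ≤ ω x y)
      connected   : ∀ x y → Star _∼_ x y
      nbrs        : V → FinSet V
      ∈-nbrs      : ∀ x y → y ∈ elements (nbrs x) ⇔ x ∼ y
      μ           : V → Carrier
      μ-pos       : ∀ x → 0# < μ x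

    m : V → Carrier
    m x = ∑[ elements (nbrs x) ] (ω x)

    field
      D-bound : ∃[ D ] (∀ x → m x / μ x ≤ D)

  module Heat (G : WeightedGraph) where

    open WeightedGraph G public

    Positive : (V → Carrier) → Set
    Positive f = ∀ x → 0# < f x

    Bounded : (V → Carrier) → Set
    Bounded f = ∃[ C ] (∀ x → - C ≤ f x × f x ≤ C)

    Δ : (V → Carrier) → V → Carrier
    Δ f x = (1# / μ x) * ∑[ elements (nbrs x) ] λ y → ω x y * (f y - f x)

    -- From 2Γ(f,g) = Δ(fg) - fΔg - gΔf.
    Γ : (V → Carrier) → (V → Carrier) → V → Carrier
    Γ f g x = (1# / 2#) * (Δ (λ y → f y * g y) x - f x * Δ g x - g x * Δ f x)

    Γ₁ : (V → Carrier) → V → Carrier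
    Γ₁ f = Γ f f

    Γ̃₂ : (V → Carrier) → V → Carrier
    Γ̃₂ f x = (1# / 2#) * Δ (Γ₁ f) x
           - Γ f (λ y → Δ (λ z → f z ^ 2) y / (2# * f y)) x

    CDE′ : Dimension → Carrier → Set
    CDE′ n K = ∀ f → Positive f → ∀ x →
      (1/ n) * f x ^ 2 * Δ (log ∘ f) x ^ 2 + K * Γ₁ f x ≤ Γ̃₂ f x

    IsInterior : FinSet V → V → Set
    IsInterior U x = x ∈ elements U × (∀ y → x ∼ y → y ∈ elements U)

    interior : FinSet V → List V
    interior U = filter (λ x → lem {IsInterior U x}) (elements U)

    -- A function on the interior of U is represented by any f : V → Carrier,
    -- of which only the values on the interior are used.
    extend : FinSet V → (V → Carrier) → V → Carrier
    extend U f x = if does (lem {IsInterior U x}) then f x else 0#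

    Δ[_] : FinSet V → (V → Carrier) → V → Carrier
    Δ[ U ] f = Δ (extend U f)

    ⟨_,_⟩[_] : (V → Carrier) → (V → Carrier) → FinSet V → Carrier
    ⟨ f , g ⟩[ U ] = ∑[ interior U ] λ x → μ x * f x * g x

    -- A complete orthonormal family of eigenfunctions of -Δ[ U ] in ℓ²(interior U, μ);
    -- linear independence follows from orthonormality.
    record Eigenbasis (U : FinSet V) : Set where
      field
        dim        : ℕ
        eigenvalue : Fin dim → Carrier
        φ          : Fin dim → V → Carrier
        eigen      : ∀ i x → IsInterior U x →
                     - Δ[ U ] (φ i) x ≈ eigenvalue i * φ i x
        normal     : ∀ i → ⟨ φ i , φ i ⟩[ U ] ≈ 1#
        orthogonal : ∀ i j → ¬ i ≡ j → ⟨ φ i , φ j ⟩[ U ] ≈ 0#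
        spanning   : (f : V → Carrier) →
                     Σ[ c ∈ (Fin dim → Carrier) ] (∀ x → IsInterior U x →
                       f x ≈ sum {dim} (λ i → c i * φ i x))

    -- Extending the eigenfunctions by zero extends the kernel by zero to V × V.
    dirichletKernel : (U : FinSet V) → Eigenbasis U →
                      Carrier → V → V → Carrier
    dirichletKernel U B t x y =
      sum {dim} λ i →
        exp (- eigenvalue i * t) * extend U (φ i) x * extend U (φ i) y
      where open Eigenbasis B

    record Exhaustion : Set where
      field
        U         : ℕ → FinSet V
        nested    : ∀ k x → x ∈ elements (U k) → IsInterior (U (ℕ.suc k)) x
        exhausts  : ∀ x → ∃[ k ] x ∈ elements (U k)

    open Exhaustion public using (U)

    module Semigroup (E : Exhaustion) (B : ∀ k → Eigenbasis (U E k)) where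

      heatKernel : Carrier → V → V → Carrier
      heatKernel t x y = lim λ k → dirichletKernel (U E k) (B k) t x y

      -- Meaningful for t ≥ 0 and f bounded.
      P : Carrier → (V → Carrier) → V → Carrier
      P t f x = if does (lem {t ≈ 0#}) then f x
                else ∑ λ y → μ y * heatKernel t x y * f y

module Submission where

-- With D an upper bound of m/μ and h D ≤ 1, the operator Q = I + h Δ is Markov, and
-- P t f = lim (I + (t/n) Δ)ⁿ f.  For the Dirichlet kernel of a finite set this is the spectral
-- expansion together with (1 - λ t/n)ⁿ → exp (- λ t); the error of killing the scheme outside the
-- k-th set of the exhaustion is O(2⁻ᵏ), uniformly in n, because 2 to the power of the first index
-- of a set containing the point is a barrier growing by at most the factor 1 + h D in each step.
--
-- If 0 < δ ≤ g ≤ M and u = g² + h Δ(g²) + O(h²), then √u = g + h Δ(g²)/(2g) + O(h²), so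
-- Γ(√u) = Γ(g) + 2h Γ(g, Δ(g²)/(2g)) + O(h²).  Under CDE′(∞,-K) one Euler step therefore satisfies
-- Γ(√(Q f)) ≤ (1 + 2Kh) Q Γ(√f) + O(h²), and iterating n times with h = t/n gives the gradient
-- bound when f is bounded below.  Conversely, expanding the gradient bound for P t (g²) to first
-- order at t = 0 gives CDE′(∞,-K) for g, which suffices because Γ̃₂ is local.

open import Axiom.ExcludedMiddle using (ExcludedMiddle)
import Algebra.Properties.CommutativeSemiring.Exp as PowerProperties
import Algebra.Properties.Ring as RingProperties
import Algebra.Properties.Semiring.Mult as Multiples
import Algebra.Properties.Semiring.Mult.TCOptimised as TCMultiples
import Algebra.Solver.Ring as RingSolver
open import Algebra.Solver.Ring.AlmostCommutativeRing using (fromCommutativeRing; _-Raw-AlmostCommutative⟶_)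
open import Data.Bool using (if_then_else_)
open import Data.Empty using (⊥-elim)
open import Data.Fin using (Fin)
open import Data.Integer as ℤ using (ℤ; +_; -[1+_])
import Data.Integer.Properties as ℤ
open import Data.List using (List; []; _∷_; _++_; allFin; applyUpTo; concatMap; deduplicate; tabulate; upTo)
open import Data.List.Membership.Propositional using (_∈_; lose)
open import Data.List.Membership.Propositional.Properties
  using (∈-++⁺ˡ; ∈-++⁺ʳ; ∈-++⁻; ∈-∃++; ∈-allFin; ∈-concatMap⁺; ∈-deduplicate⁺; ∈-filter⁺; ∈-filter⁻; ∈-upTo⁻)
open import Data.List.Relation.Binary.Subset.Propositional using (_⊆_)
import Data.List.Relation.Unary.All as All
open import Data.List.Relation.Unary.AllPairs using ([]; _∷_)
open import Data.List.Relation.Unary.Any using (here; there)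
open import Data.List.Relation.Unary.Unique.Propositional using (Unique)
import Data.List.Relation.Unary.Unique.DecPropositional.Properties as DecUnique
import Data.List.Relation.Unary.Unique.Propositional.Properties as Unique
open import Data.Maybe using (Maybe; just; nothing)
open import Data.Nat as ℕ using (ℕ; zero; suc; _!)
import Data.Nat.Properties as ℕ
open import Data.Product using (Σ-syntax; ∃; ∃-syntax; _×_; _,_; proj₁; proj₂)
open import Data.Sum using (_⊎_; inj₁; inj₂)
open import Function using (_∘_; _⇔_; Equivalence; mk⇔)
open import Level using (0ℓ)
open import Relation.Binary.Bundles using (Poset)
open import Relation.Binary.PropositionalEquality as ≡ using (_≡_)
open import Relation.Binary.Structures using (IsTotalOrder)
open import Relation.Nullary using (¬_; Dec; yes; no; does)
open import Defs

-- The O(h²) terms come from dividing by `2g` and by `√u + g`, so they need a lower bound that is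
-- uniform over the graph, while a positive function may have infimum zero. Hence the iteration runs
-- on functions with values in a fixed interval [ε, M]. Constants are fixed by `Q`, so the Markov
-- property keeps every iterate in that interval and a single constant serves for all steps and all
-- meshes; n errors of order (t/n)² then add up to O(1/n).
--
-- Working with the scheme avoids differentiating `P t f` in time and exchanging Γ with an infinite
-- sum: at each vertex `Q`, `Δ` and `Γ` are finite sums, and infinite sums occur only in identifying
-- `P t f` with the limit of the scheme. The uniform exit estimate is what lets the limit over the
-- exhaustion be exchanged with the limit over the mesh.

-- A ring solver with integer coefficients

module IntegerSolver (lem : ExcludedMiddle 0ℓ) (ℛ : Reals) where

  open Analysis lem ℛ
  open TCMultiples semiring using (×1-homo-*; ×-homo-+; 1+×) renaming (_×_ to _×′_)
  open RingProperties ring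
  open import Relation.Binary.Reasoning.Setoid setoid

  -- With this form of multiples `con (+ 1)` denotes `1#` and `con (+ 2)` denotes `2#`
  -- definitionally, so solver equations match goals written with these constants.
  ⟦_⟧ℤ : ℤ → Carrier
  ⟦ + n      ⟧ℤ = n ×′ 1#
  ⟦ -[1+ n ] ⟧ℤ = - (suc n ×′ 1#)

  -- Mixed-sign addition in `ℤ` computes by `⊖`; cancelling a common successor there corresponds to
  -- inserting `1# - 1#` in the ring.
  ⟦⊖⟧ : ∀ m n → ⟦ m ℤ.⊖ n ⟧ℤ ≈ m ×′ 1# - n ×′ 1#
  ⟦⊖⟧ zero    zero    = sym (-‿inverseʳ 0#)
  ⟦⊖⟧ zero    (suc n) = sym (+-identityˡ _)
  ⟦⊖⟧ (suc m) zero    = sym (trans (+-congˡ -0#≈0#) (+-identityʳ _))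
  ⟦⊖⟧ (suc m) (suc n) = begin
    ⟦ suc m ℤ.⊖ suc n ⟧ℤ             ≡⟨ ≡.cong ⟦_⟧ℤ (ℤ.[1+m]⊖[1+n]≡m⊖n m n) ⟩
    ⟦ m ℤ.⊖ n ⟧ℤ                     ≈⟨ ⟦⊖⟧ m n ⟩
    m ×′ 1# - n ×′ 1#                ≈⟨ +-congʳ (+-identityʳ _) ⟨
    m ×′ 1# + 0# - n ×′ 1#           ≈⟨ +-congʳ (+-congˡ (-‿inverseʳ 1#)) ⟨
    m ×′ 1# + (1# - 1#) - n ×′ 1#    ≈⟨ +-congʳ (+-assoc _ _ _) ⟨
    m ×′ 1# + 1# - 1# - n ×′ 1#      ≈⟨ +-assoc _ _ _ ⟩
    m ×′ 1# + 1# + (- 1# - n ×′ 1#)  ≈⟨ +-cong (+-comm _ _) (-‿+-comm _ _) ⟩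
    1# + m ×′ 1# - (1# + n ×′ 1#)    ≈⟨ +-cong (1+× m 1#) (-‿cong (1+× n 1#)) ⟨
    suc m ×′ 1# - suc n ×′ 1#        ∎

  ⟦⟧-+ : ∀ i j → ⟦ i ℤ.+ j ⟧ℤ ≈ ⟦ i ⟧ℤ + ⟦ j ⟧ℤ
  ⟦⟧-+ (+ m)      (+ n)      = ×-homo-+ 1# m n
  ⟦⟧-+ (+ m)      -[1+ n ]   = ⟦⊖⟧ m (suc n)
  ⟦⟧-+ -[1+ m ]   (+ n)      = trans (⟦⊖⟧ n (suc m)) (+-comm _ _)
  ⟦⟧-+ -[1+ m ]   -[1+ n ]   = begin
    - (suc (suc (m ℕ.+ n)) ×′ 1#)    ≡⟨ ≡.cong (λ k → - (k ×′ 1#)) (≡.cong suc (ℕ.+-suc m n)) ⟨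
    - ((suc m ℕ.+ suc n) ×′ 1#)      ≈⟨ -‿cong (×-homo-+ 1# (suc m) (suc n)) ⟩
    - (suc m ×′ 1# + suc n ×′ 1#)    ≈⟨ -‿+-comm _ _ ⟨
    - (suc m ×′ 1#) - (suc n ×′ 1#)  ∎

  ⟦⟧-neg : ∀ i → ⟦ ℤ.- i ⟧ℤ ≈ - ⟦ i ⟧ℤ
  ⟦⟧-neg (+ zero)   = sym -0#≈0#
  ⟦⟧-neg (+ suc n)  = refl
  ⟦⟧-neg -[1+ n ]   = sym (-‿involutive _)

  ⟦⟧-*-pos : ∀ m n → ⟦ + m ℤ.* + n ⟧ℤ ≈ ⟦ + m ⟧ℤ * ⟦ + n ⟧ℤ
  ⟦⟧-*-pos m n = begin
    ⟦ + m ℤ.* + n ⟧ℤ      ≡⟨ ≡.cong ⟦_⟧ℤ (ℤ.pos-* m n) ⟨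
    (m ℕ.* n) ×′ 1#       ≈⟨ ×1-homo-* m n ⟩
    m ×′ 1# * (n ×′ 1#)   ∎

  ⟦⟧-*-posˡ : ∀ m j → ⟦ + m ℤ.* j ⟧ℤ ≈ ⟦ + m ⟧ℤ * ⟦ j ⟧ℤ
  ⟦⟧-*-posˡ m (+ n)    = ⟦⟧-*-pos m n
  ⟦⟧-*-posˡ m -[1+ n ] = begin
    ⟦ + m ℤ.* -[1+ n ] ⟧ℤ        ≡⟨ ≡.cong ⟦_⟧ℤ (ℤ.neg-distribʳ-* (+ m) (+ suc n)) ⟨
    ⟦ ℤ.- (+ m ℤ.* + suc n) ⟧ℤ   ≈⟨ ⟦⟧-neg (+ m ℤ.* + suc n) ⟩
    - ⟦ + m ℤ.* + suc n ⟧ℤ       ≈⟨ -‿cong (⟦⟧-*-pos m (suc n)) ⟩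
    - (m ×′ 1# * (suc n ×′ 1#))  ≈⟨ -‿distribʳ-* _ _ ⟩
    m ×′ 1# * - (suc n ×′ 1#)    ∎

  ⟦⟧-* : ∀ i j → ⟦ i ℤ.* j ⟧ℤ ≈ ⟦ i ⟧ℤ * ⟦ j ⟧ℤ
  ⟦⟧-* (+ m)    j = ⟦⟧-*-posˡ m j
  ⟦⟧-* -[1+ m ] j = begin
    ⟦ -[1+ m ] ℤ.* j ⟧ℤ          ≡⟨ ≡.cong ⟦_⟧ℤ (ℤ.neg-distribˡ-* (+ suc m) j) ⟨
    ⟦ ℤ.- (+ suc m ℤ.* j) ⟧ℤ     ≈⟨ ⟦⟧-neg (+ suc m ℤ.* j) ⟩
    - ⟦ + suc m ℤ.* j ⟧ℤ         ≈⟨ -‿cong (⟦⟧-*-posˡ (suc m) j) ⟩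
    - (suc m ×′ 1# * ⟦ j ⟧ℤ)     ≈⟨ -‿distribˡ-* _ _ ⟩
    - (suc m ×′ 1#) * ⟦ j ⟧ℤ     ∎

  morphism : ℤ.+-*-rawRing -Raw-AlmostCommutative⟶ fromCommutativeRing commutativeRing
  morphism = record
    { ⟦_⟧    = ⟦_⟧ℤ
    ; +-homo = ⟦⟧-+
    ; *-homo = ⟦⟧-*
    ; -‿homo = ⟦⟧-neg
    ; 0-homo = refl
    ; 1-homo = refl
    }

  _≟ℤ_ : ∀ i j → Maybe (⟦ i ⟧ℤ ≈ ⟦ j ⟧ℤ)
  i ≟ℤ j with i ℤ.≟ j
  ... | yes ≡.refl = just refl
  ... | no  _      = nothing

  open RingSolver ℤ.+-*-rawRing (fromCommutativeRing commutativeRing) morphism _≟ℤ_ public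
    using (solve; con; _:+_; _:*_; _:-_; :-_; _:^_; _:=_)

-- Ordered-field arithmetic, two-sided bounds and square roots

module OrderedField (lem : ExcludedMiddle 0ℓ) (ℛ : Reals) where

  open Analysis lem ℛ public
  open IntegerSolver lem ℛ public
  open IsTotalOrder isTotalOrder public using (antisym; total; isPartialOrder)
    renaming (refl to ≤-refl; trans to ≤-trans; reflexive to ≤-reflexive)

  poset : Poset 0ℓ 0ℓ 0ℓ
  poset = record { isPartialOrder = isPartialOrder }

  open import Relation.Binary.Reasoning.PartialOrder poset public

  infix 4 ∣_∣≤_
  infix 9 _⁻¹

  -- A relation instead of an absolute value: such bounds combine under sums and products without
  -- case distinctions on signs.
  record ∣_∣≤_ (x c : Carrier) : Set where
    constructor _,_
    field
      upper : x ≤ c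
      lower : - x ≤ c

  open ∣_∣≤_ public

  ≤-resp : ∀ {x x′ y y′} → x ≈ x′ → y ≈ y′ → x ≤ y → x′ ≤ y′
  ≤-resp p q r = ≤-trans (≤-reflexive (sym p)) (≤-trans r (≤-reflexive q))

  ≤-by : ∀ {x y e} → 0# ≤ e → y - x ≈ e → x ≤ y
  ≤-by {x} {y} {e} 0≤e eq =
    ≤-resp (+-identityʳ x) (trans (+-congˡ (sym eq)) (solve 2 (λ x y → x :+ (y :- x) := y) refl x y)) (+-monoʳ-≤ x 0≤e)

  gap : ∀ {x y} → x ≤ y → 0# ≤ y - x
  gap {x} {y} p = ≤-resp (solve 1 (λ x → :- x :+ x := con (+ 0)) refl x) (+-comm (- x) y) (+-monoʳ-≤ (- x) p)

  <⇒≤ : ∀ {x y} → x < y → x ≤ y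
  <⇒≤ = proj₁

  ≰⇒≥ : ∀ {x y} → ¬ x ≤ y → y ≤ x
  ≰⇒≥ {x} {y} ¬p with total x y
  ... | inj₁ p = ⊥-elim (¬p p)
  ... | inj₂ q = q

  ≰⇒> : ∀ {x y} → ¬ x ≤ y → y < x
  ≰⇒> ¬p = ≰⇒≥ ¬p , λ y≈x → ¬p (≤-reflexive (sym y≈x))

  <⇒≱ : ∀ {x y} → x < y → ¬ y ≤ x
  <⇒≱ (x≤y , x≉y) y≤x = x≉y (antisym x≤y y≤x)

  <-≤-trans : ∀ {x y z} → x < y → y ≤ z → x < z
  <-≤-trans p q = ≰⇒> λ z≤x → <⇒≱ p (≤-trans q z≤x)

  ≤-<-trans : ∀ {x y z} → x ≤ y → y < z → x < z
  ≤-<-trans p q = ≰⇒> λ z≤x → <⇒≱ q (≤-trans z≤x p)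

  +-mono-≤ : ∀ {x y z w} → x ≤ y → z ≤ w → x + z ≤ y + w
  +-mono-≤ {x} {y} {z} {w} p q =
    ≤-trans (+-monoʳ-≤ x q) (≤-resp (+-comm w x) (+-comm w y) (+-monoʳ-≤ w p))

  +-nonNeg : ∀ {x y} → 0# ≤ x → 0# ≤ y → 0# ≤ x + y
  +-nonNeg p q = ≤-resp (+-identityˡ 0#) refl (+-mono-≤ p q)

  *-monoˡ-≤ : ∀ {x y z} → 0# ≤ z → x ≤ y → z * x ≤ z * y
  *-monoˡ-≤ {x} {y} {z} p q = ≤-by (*-nonNeg p (gap q)) (solve 3 (λ z y x → z :* y :- z :* x := z :* (y :- x)) refl z y x)

  *-monoʳ-≤ : ∀ {x y z} → 0# ≤ z → x ≤ y → x * z ≤ y * z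
  *-monoʳ-≤ {x} {y} {z} p q = ≤-by (*-nonNeg p (gap q)) (solve 3 (λ y z x → y :* z :- x :* z := z :* (y :- x)) refl y z x)

  *-mono-≤ : ∀ {x y z w} → 0# ≤ x → 0# ≤ w → x ≤ y → z ≤ w → x * z ≤ y * w
  *-mono-≤ 0≤x 0≤w p q = ≤-trans (*-monoˡ-≤ 0≤x q) (*-monoʳ-≤ 0≤w p)

  neg-nonNeg : ∀ {x} → x ≤ 0# → 0# ≤ - x
  neg-nonNeg {x} p = ≤-by (gap p) (solve 1 (λ x → :- x :- con (+ 0) := con (+ 0) :- x) refl x)

  square-nonNeg : ∀ x → 0# ≤ x * x
  square-nonNeg x with total 0# x
  ... | inj₁ p = *-nonNeg p p
  ... | inj₂ q = ≤-resp refl (solve 1 (λ x → :- x :* :- x := x :* x) refl x) (*-nonNeg (neg-nonNeg q) (neg-nonNeg q))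

  0≤1 : 0# ≤ 1#
  0≤1 = ≤-resp refl (*-identityˡ 1#) (square-nonNeg 1#)

  0<1 : 0# < 1#
  0<1 = 0≤1 , 0≉1

  +-pos : ∀ {x y} → 0# < x → 0# ≤ y → 0# < x + y
  +-pos {x} {y} p q = <-≤-trans p (≤-by q (solve 2 (λ x y → x :+ y :- x := y) refl x y))

  0<2 : 0# < 2#
  0<2 = +-pos 0<1 0≤1

  pos⇒≉0 : ∀ {x} → 0# < x → ¬ x ≈ 0#
  pos⇒≉0 (_ , p) q = p (sym q)

  gap-pos : ∀ {x y} → x < y → 0# < y - x
  gap-pos {x} {y} (p , q) = gap p , λ r → q (trans (solve 1 (λ x → x := con (+ 0) :+ x) refl x) (trans (+-congʳ r) (solve 2 (λ y x → y :- x :+ x := y) refl y x)))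

  <-by : ∀ {x y e} → 0# < e → y - x ≈ e → x < y
  <-by {x} {y} {e} (p , q) r = ≤-by p r , λ x≈y → q (trans (trans (sym (-‿inverseʳ x)) (+-congʳ x≈y)) r)

  /-cancelʳ : ∀ x {y} → ¬ y ≈ 0# → x / y * y ≈ x
  /-cancelʳ x {y} y≉0 with lem {∃ λ z → z * y ≈ x × ¬ y ≈ 0#}
  ... | yes (_ , p , _) = p
  ... | no ¬p with w , p ← invertible y y≉0 =
    ⊥-elim (¬p (x * w , trans (solve 3 (λ x w y → x :* w :* y
          := x :* (y :* w)) refl x w y) (trans (*-congˡ p) (*-identityʳ x)) , y≉0))

  _⁻¹ : Carrier → Carrier
  x ⁻¹ = 1# / x

  ⁻¹-inverseˡ : ∀ {x} → 0# < x → x ⁻¹ * x ≈ 1#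
  ⁻¹-inverseˡ p = /-cancelʳ 1# (pos⇒≉0 p)

  ⁻¹-nonNeg : ∀ {x} → 0# < x → 0# ≤ x ⁻¹
  ⁻¹-nonNeg {x} p with total 0# (x ⁻¹)
  ... | inj₁ q = q
  ... | inj₂ q = ⊥-elim (<⇒≱ 0<1 (≤-by (*-nonNeg (neg-nonNeg q) (<⇒≤ p))
                   (trans (trans (+-identityˡ _) (-‿cong (sym (⁻¹-inverseˡ p)))) ((solve 2 (λ t₁ x → :- (t₁ :* x)
                         := :- t₁ :* x) refl (x ⁻¹) x)))))

  ⁻¹-pos : ∀ {x} → 0# < x → 0# < x ⁻¹
  ⁻¹-pos {x} p = ⁻¹-nonNeg p , λ q → 0≉1 (trans (sym (zeroˡ x)) (trans (*-congʳ q) (⁻¹-inverseˡ p)))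

  *-cancelʳ-≤ : ∀ {x y z} → 0# < z → x * z ≤ y * z → x ≤ y
  *-cancelʳ-≤ {x} {y} {z} p q = ≤-resp (simp x) (simp y) (*-monoʳ-≤ (⁻¹-nonNeg p) q)
    where
    simp : ∀ u → u * z * z ⁻¹ ≈ u
    simp u = trans (solve 3 (λ u z t₁ → u :* z :* t₁
          := u :* (t₁ :* z)) refl u z (z ⁻¹)) (trans (*-congˡ (⁻¹-inverseˡ p)) (*-identityʳ u))

  *-cancelˡ-≤ : ∀ {x y z} → 0# < z → z * x ≤ z * y → x ≤ y
  *-cancelˡ-≤ p q = *-cancelʳ-≤ p (≤-resp (*-comm _ _) (*-comm _ _) q)

  *-cancelʳ : ∀ {x y z} → 0# < z → x * z ≈ y * z → x ≈ y
  *-cancelʳ p q = antisym (*-cancelʳ-≤ p (≤-reflexive q)) (*-cancelʳ-≤ p (≤-reflexive (sym q)))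

  *-pos : ∀ {x y} → 0# < x → 0# < y → 0# < x * y
  *-pos {x} {y} p q = *-nonNeg (<⇒≤ p) (<⇒≤ q) , λ r → pos⇒≉0 p (*-cancelʳ q (trans (sym r) (sym (zeroˡ y))))

  /-def : ∀ x {y} → 0# < y → x / y ≈ x * y ⁻¹
  /-def x {y} p = *-cancelʳ p (begin-equality
    x / y * y         ≈⟨ /-cancelʳ x (pos⇒≉0 p) ⟩
    x                 ≈⟨ *-identityʳ x ⟨
    x * 1#            ≈⟨ *-congˡ (⁻¹-inverseˡ p) ⟨
    x * (y ⁻¹ * y)    ≈⟨ *-assoc _ _ _ ⟨
    x * y ⁻¹ * y      ∎)

  half : Carrier
  half = 2# ⁻¹

  half-nonNeg : 0# ≤ half
  half-nonNeg = ⁻¹-nonNeg 0<2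

  half+half : half + half ≈ 1#
  half+half = trans (solve 1 (λ half → half :+ half := half :* con (+ 2)) refl half) (⁻¹-inverseˡ 0<2)

  half-< : ∀ {ε} → 0# < ε → half * ε < ε
  half-< {ε} p = <-by (*-pos (⁻¹-pos 0<2) p)
    (trans (+-congʳ (sym (trans (*-congʳ half+half) (*-identityˡ ε)))) (solve 2 (λ half ε → (half :+ half) :* ε :- half :* ε
          := half :* ε) refl half ε))

  max : Carrier → Carrier → Carrier
  max x y with total x y
  ... | inj₁ _ = y
  ... | inj₂ _ = x

  x≤max : ∀ x y → x ≤ max x y
  x≤max x y with total x y
  ... | inj₁ p = p
  ... | inj₂ _ = ≤-refl

  y≤max : ∀ x y → y ≤ max x y
  y≤max x y with total x y
  ... | inj₁ _ = ≤-refl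
  ... | inj₂ p = p

  abs : Carrier → Carrier
  abs x = max x (- x)

  ∣x∣≤abs : ∀ x → ∣ x ∣≤ abs x
  ∣x∣≤abs x = x≤max x (- x) , y≤max x (- x)

  ∣∣≤-nonNeg : ∀ {x c} → ∣ x ∣≤ c → 0# ≤ c
  ∣∣≤-nonNeg {x} {c} (p , q) = *-cancelʳ-≤ 0<2 (≤-by (+-nonNeg (gap p) (gap q))
      (solve 2 (λ c x → c :* con (+ 2) :- con (+ 0) :* con (+ 2)
        := c :- x :+ (c :- :- x)) refl c x))

  abs-nonNeg : ∀ x → 0# ≤ abs x
  abs-nonNeg x = ∣∣≤-nonNeg (∣x∣≤abs x)

  nonNeg⇒∣∣≤ : ∀ {x c} → 0# ≤ x → x ≤ c → ∣ x ∣≤ c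
  nonNeg⇒∣∣≤ {x} {c} p q = q , ≤-by (+-nonNeg (+-nonNeg p p) (gap q)) (solve 2 (λ c x → c :- :- x
        := x :+ x :+ (c :- x)) refl c x)

  ∣∣≤-resp : ∀ {x y c} → x ≈ y → ∣ x ∣≤ c → ∣ y ∣≤ c
  ∣∣≤-resp e (p , q) = ≤-resp e refl p , ≤-resp (-‿cong e) refl q

  ∣∣≤-trans : ∀ {x c d} → ∣ x ∣≤ c → c ≤ d → ∣ x ∣≤ d
  ∣∣≤-trans (p , q) r = ≤-trans p r , ≤-trans q r

  ∣0∣≤ : ∀ {c} → 0# ≤ c → ∣ 0# ∣≤ c
  ∣0∣≤ p = nonNeg⇒∣∣≤ ≤-refl p

  ∣-∣≤ : ∀ {x c} → ∣ x ∣≤ c → ∣ - x ∣≤ c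
  ∣-∣≤ {x} (p , q) = q , ≤-resp (sym (solve 1 (λ x → :- (:- x) := x) refl x)) refl p

  ∣+∣≤ : ∀ {x y c d} → ∣ x ∣≤ c → ∣ y ∣≤ d → ∣ x + y ∣≤ c + d
  ∣+∣≤ {x} {y} (p , q) (r , s) = +-mono-≤ p r , ≤-resp (solve 2 (λ x y → :- x :+ :- y
        := :- (x :+ y)) refl x y) refl (+-mono-≤ q s)

  ∣∸∣≤ : ∀ {x y c d} → ∣ x ∣≤ c → ∣ y ∣≤ d → ∣ x - y ∣≤ c + d
  ∣∸∣≤ p q = ∣+∣≤ p (∣-∣≤ q)

  -- Twice the difference cd - xy equals (c - x)(d + y) + (c + x)(d - y), a sum of products of
  -- nonnegative gaps.
  *-upper : ∀ {x y c d} → ∣ x ∣≤ c → ∣ y ∣≤ d → x * y ≤ c * d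
  *-upper {x} {y} {c} {d} (p , q) (r , s) = *-cancelʳ-≤ 0<2 (≤-by
    (+-nonNeg (*-nonNeg (gap p) (gap s)) (*-nonNeg (gap q) (gap r)))
    (solve 4 (λ c d x y → c :* d :* con (+ 2) :- x :* y :* con (+ 2)
       := (c :- x) :* (d :- :- y) :+ (c :- :- x) :* (d :- y))
       refl c d x y))

  ∣*∣≤ : ∀ {x y c d} → ∣ x ∣≤ c → ∣ y ∣≤ d → ∣ x * y ∣≤ c * d
  ∣*∣≤ {x} {y} p q = *-upper p q , ≤-resp (solve 2 (λ x y → :- x :* y := :- (x :* y)) refl x y) refl (*-upper (∣-∣≤ p) q)

  ∣^∣≤ : ∀ {x c} n → ∣ x ∣≤ c → ∣ x ^ n ∣≤ c ^ n
  ∣^∣≤ zero    p = nonNeg⇒∣∣≤ 0≤1 ≤-refl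
  ∣^∣≤ (suc n) p = ∣*∣≤ p (∣^∣≤ n p)

  ^-nonNeg : ∀ {x} n → 0# ≤ x → 0# ≤ x ^ n
  ^-nonNeg zero    p = 0≤1
  ^-nonNeg (suc n) p = *-nonNeg p (^-nonNeg n p)

  ^-cong : ∀ {x y} n → x ≈ y → x ^ n ≈ y ^ n
  ^-cong zero    p = refl
  ^-cong (suc n) p = *-cong p (^-cong n p)

  square-mono⁻¹ : ∀ {x y} → 0# ≤ x → 0# ≤ y → x * x ≤ y * y → x ≤ y
  square-mono⁻¹ {x} {y} 0≤x 0≤y p with lem {x ≤ y}
  ... | yes q = q
  ... | no ¬q = ⊥-elim (<⇒≱ (<-by (*-pos (gap-pos (≰⇒> ¬q)) (+-pos (≤-<-trans 0≤y (≰⇒> ¬q)) 0≤y))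
      (solve 2 (λ x y → x :* x :- y :* y
        := (x :- y) :* (x :+ y)) refl x y)) p)

  -- The supremum of { y ≥ 0 ∣ y² ≤ x }: the increments d / (2 s + 1 + d) stay within the defect d of s².
  √-exists : ∀ x → 0# ≤ x → ∃[ y ] 0# ≤ y × y * y ≈ x
  √-exists x 0≤x = s , 0≤s , antisym (case-≤ (lem {s * s ≤ x})) (case-≥ (lem {x ≤ s * s}))
    where
    S : Carrier → Set
    S y = 0# ≤ y × y * y ≤ x
    bounded : IsUpperBound S (x + 1#)
    bounded y (0≤y , p) = square-mono⁻¹ 0≤y (+-nonNeg 0≤x 0≤1) (≤-trans p
      (≤-by (+-nonNeg (+-nonNeg (square-nonNeg x) 0≤x) 0≤1) (solve 1 (λ x → (x :+ con (+ 1)) :* (x :+ con (+ 1)) :- x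
            := x :* x :+ x :+ con (+ 1)) refl x)))
    sup : ∃[ s ] IsUpperBound S s × (∀ b → IsUpperBound S b → s ≤ b)
    sup = supremum S (0# , ≤-refl , ≤-resp (sym (zeroˡ 0#)) refl 0≤x) (x + 1# , bounded)
    s : Carrier
    s = proj₁ sup
    s-upper : IsUpperBound S s
    s-upper = proj₁ (proj₂ sup)
    s-least : ∀ b → IsUpperBound S b → s ≤ b
    s-least = proj₂ (proj₂ sup)
    0≤s : 0# ≤ s
    0≤s = s-upper 0# (≤-refl , ≤-resp (sym (zeroˡ 0#)) refl 0≤x)
    0<w : ∀ {d} → 0# < d → 0# < 1# + (s + s) + d
    0<w p = +-pos (+-pos 0<1 (+-nonNeg 0≤s 0≤s)) (<⇒≤ p)
    η : Carrier → Carrier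
    η d = d * (1# + (s + s) + d) ⁻¹
    0<η : ∀ {d} → 0# < d → 0# < η d
    0<η p = *-pos p (⁻¹-pos (0<w p))
    η-def : ∀ {d} → 0# < d → η d * (1# + (s + s) + d) ≈ d
    η-def {d} p = trans (*-assoc _ _ _) (trans (*-congˡ (⁻¹-inverseˡ (0<w p))) (*-identityʳ d))
    case-≥ : Dec (x ≤ s * s) → x ≤ s * s
    case-≥ (yes p) = p
    case-≥ (no ¬p) = ⊥-elim (<⇒≱ (<-by (0<η 0<d) (solve 2 (λ s e → s :+ e :- s := e) refl s e))
      (s-upper (s + e) (+-nonNeg 0≤s (<⇒≤ (0<η 0<d)) , ≤-by (+-nonNeg (*-nonNeg (<⇒≤ (0<η 0<d)) (gap e≤1)) (*-nonNeg (<⇒≤ (0<η 0<d)) (<⇒≤ 0<d))) defect)))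
      where
      d e : Carrier
      d = x - s * s
      e = η d
      0<d : 0# < d
      0<d = gap-pos (≰⇒> ¬p)
      e≤1 : e ≤ 1#
      e≤1 = *-cancelʳ-≤ (0<w 0<d) (≤-resp (sym (η-def 0<d)) refl (≤-by (+-nonNeg 0≤1 (+-nonNeg 0≤s 0≤s))
          (solve 2 (λ s d → con (+ 1) :* (con (+ 1) :+ (s :+ s) :+ d) :- d
            := con (+ 1) :+ (s :+ s)) refl s d)))
      defect : x - (s + e) * (s + e) ≈ e * (1# - e) + e * d
      defect = begin-equality
        x - (s + e) * (s + e)                           ≈⟨ solve 3 (λ x s e → x :- (s :+ e) :* (s :+ e)
              := x :- s :* s :- e :* (s :+ s :+ e)) refl x s e ⟩
        d - e * (s + s + e)                             ≈⟨ +-congʳ (η-def 0<d) ⟨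
        e * (1# + (s + s) + d) - e * (s + s + e)        ≈⟨
            (solve 3 (λ e s d → e :* (con (+ 1) :+ (s :+ s) :+ d) :- e :* (s :+ s :+ e)
              := e :* (con (+ 1) :- e) :+ e :* d) refl e s d) ⟩
        e * (1# - e) + e * d                            ∎
    case-≤ : Dec (s * s ≤ x) → s * s ≤ x
    case-≤ (yes p) = p
    case-≤ (no ¬p) = ⊥-elim (<⇒≱ (<-by (0<η 0<d) (solve 2 (λ s e → s :- (s :- e)
          := e) refl s e)) (s-least (s - e) λ y (0≤y , q) →
      square-mono⁻¹ 0≤y (gap e≤s) (≤-trans q (≤-by (+-nonNeg (+-nonNeg (square-nonNeg e) (<⇒≤ (0<η 0<d))) (*-nonNeg (<⇒≤ (0<η 0<d)) (<⇒≤ 0<d))) defect))))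
      where
      d e : Carrier
      d = s * s - x
      e = η d
      0<d : 0# < d
      0<d = gap-pos (≰⇒> ¬p)
      e≤s : e ≤ s
      e≤s = *-cancelʳ-≤ (0<w 0<d) (≤-resp (sym (η-def 0<d)) refl
        (≤-by (+-nonNeg (+-nonNeg (+-nonNeg 0≤s (square-nonNeg s)) 0≤x) (*-nonNeg 0≤s (<⇒≤ 0<d)))
          (solve 2 (λ s x → s :* (con (+ 1) :+ (s :+ s) :+ (s :* s :- x)) :- (s :* s :- x)
             := s :+ s :* s :+ x :+ s :* (s :* s :- x))
             refl s x)))
      defect : (s - e) * (s - e) - x ≈ e * e + e + e * d
      defect = begin-equality
        (s - e) * (s - e) - x                           ≈⟨ solve 3 (λ s e x → (s :- e) :* (s :- e) :- x
              := e :* e :+ (s :* s :- x) :- e :* (s :+ s)) refl s e x ⟩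
        e * e + d - e * (s + s)                         ≈⟨ +-congʳ (+-congˡ (η-def 0<d)) ⟨
        e * e + e * (1# + (s + s) + d) - e * (s + s)    ≈⟨
            (solve 3 (λ e s d → e :* e :+ e :* (con (+ 1) :+ (s :+ s) :+ d) :- e :* (s :+ s)
              := e :* e :+ e :+ e :* d) refl e s d) ⟩
        e * e + e + e * d                               ∎

  √-spec : ∀ {x} → 0# ≤ x → 0# ≤ √ x × √ x * √ x ≈ x
  √-spec {x} p with lem {∃ λ y → 0# ≤ y × y * y ≈ x}
  ... | yes (_ , q) = q
  ... | no ¬q       = ⊥-elim (¬q (√-exists x p))

  √-nonNeg : ∀ {x} → 0# ≤ x → 0# ≤ √ x
  √-nonNeg = proj₁ ∘ √-spec

  √-square : ∀ {x} → 0# ≤ x → √ x * √ x ≈ x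
  √-square = proj₂ ∘ √-spec

-- Limits of sequences and finite sums

module Limits (lem : ExcludedMiddle 0ℓ) (ℛ : Reals) where

  open OrderedField lem ℛ public

  Eventually : (ℕ → Set) → Set
  Eventually Q = ∃[ N ] (∀ n → N ℕ.≤ n → Q n)

  always : {Q : ℕ → Set} → (∀ n → Q n) → Eventually Q
  always q = 0 , λ n _ → q n

  eventually-map : {Q R : ℕ → Set} → (∀ n → Q n → R n) → Eventually Q → Eventually R
  eventually-map f (N , q) = N , λ n N≤n → f n (q n N≤n)

  eventually-zip : {Q R S : ℕ → Set} → (∀ n → Q n → R n → S n) → Eventually Q → Eventually R → Eventually S
  eventually-zip f (N , q) (M , r) = N ℕ.⊔ M , λ n p →
    f n (q n (ℕ.≤-trans (ℕ.m≤m⊔n N M) p)) (r n (ℕ.≤-trans (ℕ.m≤n⊔m N M) p))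

  eventually-point : {Q : ℕ → Set} → Eventually Q → ∃ Q
  eventually-point (N , q) = N , q N ℕ.≤-refl

  -- `Within` is strict and `∣_∣≤_` is not; halving the tolerance makes up the difference.
  ∣∣≤⇒Within : ∀ {ε x y} → 0# < ε → ∣ x - y ∣≤ half * ε → Within ε x y
  ∣∣≤⇒Within {ε} {x} {y} 0<ε (p , q) =
    ≤-<-trans p (half-< 0<ε) , ≤-<-trans (≤-resp (solve 2 (λ x y → :- (x :- y) := y :- x) refl x y) refl q) (half-< 0<ε)

  Within⇒∣∣≤ : ∀ {ε x y} → Within ε x y → ∣ x - y ∣≤ ε
  Within⇒∣∣≤ {ε} {x} {y} (p , q) = <⇒≤ p , ≤-resp (solve 2 (λ y x → y :- x := :- (x :- y)) refl y x) refl (<⇒≤ q)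

  half-pos : ∀ {ε} → 0# < ε → 0# < half * ε
  half-pos p = *-pos (⁻¹-pos 0<2) p

  halves : ∀ ε → half * ε + half * ε ≈ ε
  halves ε = trans (sym (distribʳ ε half half)) (trans (*-congʳ half+half) (*-identityˡ ε))

  ⟶-intro : ∀ {a l} → (∀ ε → 0# < ε → Eventually λ n → ∣ a n - l ∣≤ ε) → a ⟶ l
  ⟶-intro h ε 0<ε = eventually-map (λ n → ∣∣≤⇒Within 0<ε) (h (half * ε) (half-pos 0<ε))

  ⟶-elim : ∀ {a l} → a ⟶ l → ∀ ε → 0# < ε → Eventually λ n → ∣ a n - l ∣≤ ε
  ⟶-elim h ε 0<ε = eventually-map (λ n → Within⇒∣∣≤) (h ε 0<ε)

  ⟶-cong : ∀ {a b l m} → (∀ n → a n ≈ b n) → l ≈ m → a ⟶ l → b ⟶ m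
  ⟶-cong e f h = ⟶-intro λ ε 0<ε → eventually-map (λ n → ∣∣≤-resp (+-cong (e n) (-‿cong f))) (⟶-elim h ε 0<ε)

  ⟶-const : ∀ c → (λ _ → c) ⟶ c
  ⟶-const c = ⟶-intro λ ε 0<ε → always λ n → ∣∣≤-resp (sym (-‿inverseʳ c)) (∣0∣≤ (<⇒≤ 0<ε))

  ⟶-+ : ∀ {a b l m} → a ⟶ l → b ⟶ m → (λ n → a n + b n) ⟶ (l + m)
  ⟶-+ {a} {b} {l} {m} p q = ⟶-intro λ ε 0<ε → eventually-zip
    (λ n r s → ∣∣≤-trans (∣∣≤-resp (solve 4 (λ t₁ l t₂ m → t₁ :- l :+ (t₂ :- m)
          := t₁ :+ t₂ :- (l :+ m)) refl (a n) l (b n) m) (∣+∣≤ r s)) (≤-reflexive (halves ε)))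
    (⟶-elim p (half * ε) (half-pos 0<ε)) (⟶-elim q (half * ε) (half-pos 0<ε))

  ⟶-bounded : ∀ {a l} → a ⟶ l → Eventually λ n → ∣ a n ∣≤ abs l + 1#
  ⟶-bounded {a} {l} p = eventually-map
    (λ n r → ∣∣≤-resp (solve 2 (λ l t₁ → l :+ (t₁ :- l) := t₁) refl l (a n)) (∣+∣≤ (∣x∣≤abs l) r)) (⟶-elim p 1# 0<1)

  null-*-bounded : ∀ {a b : ℕ → Carrier} {c : Carrier} → a ⟶ 0# → (Eventually λ n → ∣ b n ∣≤ c) → (λ n → a n * b n) ⟶ 0#
  null-*-bounded {a} {b} {c} p q = ⟶-intro λ ε 0<ε →
    -- The summand `1#` keeps the divisor positive even if `c` is zero.
    let δ = ε * (1# + abs c) ⁻¹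
        0<w = +-pos 0<1 (abs-nonNeg c)
        0<δ = *-pos 0<ε (⁻¹-pos 0<w)
    in eventually-zip (λ n r s → ∣∣≤-resp (solve 2 (λ t₁ t₂ → (t₁ :- con (+ 0)) :* t₂
          := t₁ :* t₂ :- con (+ 0)) refl (a n) (b n))
         (∣∣≤-trans (∣*∣≤ r (∣∣≤-trans s (≤-by (+-nonNeg 0≤1 (gap (upper (∣x∣≤abs c))))
             (solve 2 (λ t₁ c → con (+ 1) :+ t₁ :- c
               := con (+ 1) :+ (t₁ :- c)) refl (abs c) c))))
           (≤-reflexive (trans (solve 3 (λ ε t₁ t₂ → ε :* t₁ :* (con (+ 1) :+ t₂)
                 := ε :* (t₁ :* (con (+ 1) :+ t₂))) refl ε ((1# + abs c) ⁻¹) (abs c))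
             (trans (*-congˡ (⁻¹-inverseˡ 0<w)) (*-identityʳ ε)))))) (⟶-elim p δ 0<δ) q

  ⟶-shift : ∀ {a l} → (λ n → a n - l) ⟶ 0# → a ⟶ l
  ⟶-shift {a} {l} p = ⟶-cong (λ n → (solve 2 (λ t₁ l → t₁ :- l :+ l := t₁) refl (a n) l)) (+-identityˡ l) (⟶-+ p (⟶-const l))

  ⟶-unshift : ∀ {a l} → a ⟶ l → (λ n → a n - l) ⟶ 0#
  ⟶-unshift {a} {l} p = ⟶-cong (λ n → refl) (-‿inverseʳ l) (⟶-+ p (⟶-const (- l)))

  ⟶-*ˡ : ∀ {a l} c → a ⟶ l → (λ n → c * a n) ⟶ (c * l)
  ⟶-*ˡ {a} {l} c p = ⟶-shift (⟶-cong (λ n → (solve 3 (λ t₁ l c → (t₁ :- l) :* c := c :* t₁ :- c :* l) refl (a n) l c)) refl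
    (null-*-bounded (⟶-unshift p) (always λ n → ∣x∣≤abs c)))

  ⟶-neg : ∀ {a l} → a ⟶ l → (λ n → - a n) ⟶ (- l)
  ⟶-neg {a} {l} p = ⟶-cong (λ n → (solve 1 (λ t₁ → :- con (+ 1) :* t₁ := :- t₁) refl (a n))) (solve 1 (λ l → :- con (+ 1) :* l := :- l) refl l) (⟶-*ˡ (- 1#) p)

  ⟶-- : ∀ {a b l m} → a ⟶ l → b ⟶ m → (λ n → a n - b n) ⟶ (l - m)
  ⟶-- p q = ⟶-+ p (⟶-neg q)

  ⟶-* : ∀ {a b l m} → a ⟶ l → b ⟶ m → (λ n → a n * b n) ⟶ (l * m)
  ⟶-* {a} {b} {l} {m} p q = ⟶-cong (λ n → (solve 3 (λ t₁ l t₂ → (t₁ :- l) :* t₂ :+ l :* t₂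
        := t₁ :* t₂) refl (a n) l (b n))) (+-identityˡ (l * m))
    (⟶-+ (null-*-bounded (⟶-unshift p) (⟶-bounded q)) (⟶-*ˡ l q))

  ⟶-squeeze : ∀ {a b l} → (Eventually λ n → ∣ a n - l ∣≤ b n) → b ⟶ 0# → a ⟶ l
  ⟶-squeeze {a} {b} {l} p q = ⟶-intro λ ε 0<ε → eventually-zip
    (λ n r s → ∣∣≤-trans r (≤-trans (≤-reflexive (solve 1 (λ t₁ → t₁
          := t₁ :- con (+ 0)) refl (b n))) (upper s))) p (⟶-elim q ε 0<ε)

  ≤-from-ε : ∀ {x y} → (∀ ε → 0# < ε → x ≤ y + ε) → x ≤ y
  ≤-from-ε {x} {y} h with lem {x ≤ y}
  ... | yes p = p
  ... | no ¬p = ⊥-elim (<⇒≱ (half-< 0<d) (≤-by (gap (h (half * (x - y)) (half-pos 0<d)))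
      (solve 3 (λ half x y → half :* (x :- y) :- (x :- y) := y :+ half :* (x :- y) :- x) refl half x y)))
    where
    0<d : 0# < x - y
    0<d = gap-pos (≰⇒> ¬p)

  ⟶-≤-const : ∀ {a l c} → (Eventually λ n → a n ≤ c) → a ⟶ l → l ≤ c
  ⟶-≤-const {a} {l} {c} p q = ≤-from-ε λ ε 0<ε →
    let n , r , s = eventually-point {λ n → a n ≤ c × ∣ a n - l ∣≤ ε} (eventually-zip (λ n → _,_) p (⟶-elim q ε 0<ε))
    in ≤-by (+-nonNeg (gap r) (gap (lower s))) (solve 4 (λ c ε l t₁ → c :+ ε :- l
          := c :- t₁ :+ (ε :- :- (t₁ :- l))) refl c ε l (a n))

  ⟶-mono-≤ : ∀ {a b l m} → (Eventually λ n → a n ≤ b n) → a ⟶ l → b ⟶ m → l ≤ m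
  ⟶-mono-≤ {a} {b} {l} {m} p q r = ≤-by (gap (⟶-≤-const {c = 0#}
    (eventually-map (λ n s → ≤-by (gap s) (solve 2 (λ t₁ t₂ → con (+ 0) :- (t₁ :- t₂)
          := t₂ :- t₁) refl (a n) (b n))) p) (⟶-- q r)))
    (solve 2 (λ m l → m :- l := con (+ 0) :- (l :- m)) refl m l)

  const-≤-⟶ : ∀ {a l c} → (Eventually λ n → c ≤ a n) → a ⟶ l → c ≤ l
  const-≤-⟶ p q = ⟶-mono-≤ p (⟶-const _) q

  ⟶-unique : ∀ {a l m} → a ⟶ l → a ⟶ m → l ≈ m
  ⟶-unique p q = antisym (⟶-mono-≤ (always λ n → ≤-refl) p q) (⟶-mono-≤ (always λ n → ≤-refl) q p)

  lim-spec : ∀ {a l} → a ⟶ l → a ⟶ lim a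
  lim-spec {a} {l} p with lem {∃ λ m → a ⟶ m}
  ... | yes (_ , q) = q
  ... | no ¬q       = ⊥-elim (¬q (l , p))

  -- The approximating sequence may depend on ε. This is the form in which the limits over the mesh
  -- and over the exhaustion are exchanged.
  ⟶-approx : ∀ {a : ℕ → Carrier} {l : Carrier} →
             (∀ ε → 0# < ε → Σ[ b ∈ (ℕ → Carrier) ] Σ[ l′ ∈ Carrier ] (Eventually λ n → ∣ a n - b n ∣≤ ε) × (b ⟶ l′) × ∣ l′ - l ∣≤ ε) → a ⟶ l
  ⟶-approx {a} {l} h = ⟶-intro λ ε 0<ε →
    -- Two errors of a quarter of ε come from the approximation, and half of ε is left for the
    -- convergence of `b`.
    let δ = half * (half * ε)
        0<δ = half-pos (half-pos 0<ε)
        b , l′ , p , q , r = h δ 0<δ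
    in eventually-zip (λ n s t → ∣∣≤-trans
         (∣∣≤-resp (solve 4 (λ t₁ t₂ l′ l → t₁ :- t₂ :+ (l′ :- l) :+ (t₂ :- l′)
               := t₁ :- l) refl (a n) (b n) l′ l) (∣+∣≤ (∣+∣≤ s r) t))
         (≤-reflexive (trans (+-congʳ (halves (half * ε))) (halves ε)))) p (⟶-elim q (half * ε) (half-pos 0<ε))

  ⟶-∘suc : ∀ {a l} → a ⟶ l → (λ n → a (suc n)) ⟶ l
  ⟶-∘suc p ε 0<ε with N , q ← p ε 0<ε = N , λ n N≤n → q (suc n) (ℕ.m≤n⇒m≤1+n N≤n)

  monotone : ∀ {a : ℕ → Carrier} → (∀ n → a n ≤ a (suc n)) → ∀ {m n} → m ℕ.≤ n → a m ≤ a n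
  monotone {a} h {m} p = go (ℕ.≤⇒≤′ p)
    where
    go : ∀ {n} → m ℕ.≤′ n → a m ≤ a n
    go (ℕ.≤′-reflexive ≡.refl) = ≤-refl
    go (ℕ.≤′-step q)           = ≤-trans (go q) (h _)

  ⟶-sup : ∀ {a c} → (∀ n → a n ≤ a (suc n)) → (∀ n → a n ≤ c) → ∃[ l ] a ⟶ l
  ⟶-sup {a} {c} inc bd = s , ⟶-intro λ ε 0<ε → close ε 0<ε (lem {∃ λ n → ¬ a n ≤ s - ε})
    where
    S : Carrier → Set
    S x = ∃[ n ] x ≈ a n
    sup : ∃[ s ] IsUpperBound S s × (∀ b → IsUpperBound S b → s ≤ b)
    sup = supremum S (a 0 , 0 , refl) (c , λ x (n , e) → ≤-resp (sym e) refl (bd n))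
    s : Carrier
    s = proj₁ sup
    close : ∀ ε → 0# < ε → Dec (∃ λ n → ¬ a n ≤ s - ε) → Eventually λ n → ∣ a n - s ∣≤ ε
    close ε 0<ε (yes (N , p)) = N , λ n N≤n →
        ≤-trans (≤-by (gap (proj₁ (proj₂ sup) (a n) (n , refl))) (solve 2 (λ t₁ s → con (+ 0) :- (t₁ :- s)
              := s :- t₁) refl (a n) s)) (<⇒≤ 0<ε)
      , ≤-by (gap (≤-trans (≰⇒≥ p) (monotone inc N≤n))) (solve 3 (λ ε t₁ s → ε :- :- (t₁ :- s)
            := t₁ :- (s :- ε)) refl ε (a n) s)
    close ε 0<ε (no ¬p) = ⊥-elim (<⇒≱ (<-by 0<ε (solve 2 (λ s ε → s :- (s :- ε) := ε) refl s ε))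
      (proj₂ (proj₂ sup) (s - ε) λ x (n , e) → ≤-resp (sym e) refl (below n (lem {a n ≤ s - ε}))))
      where
      below : ∀ n → Dec (a n ≤ s - ε) → a n ≤ s - ε
      below n (yes q) = q
      below n (no ¬q) = ⊥-elim (¬p (n , ¬q))

  ι : ℕ → Carrier
  ι n = n · 1#

  ι-nonNeg : ∀ n → 0# ≤ ι n
  ι-nonNeg zero    = ≤-refl
  ι-nonNeg (suc n) = +-nonNeg 0≤1 (ι-nonNeg n)

  ι-mono : ∀ {m n} → m ℕ.≤ n → ι m ≤ ι n
  ι-mono = monotone λ n → ≤-by 0≤1 (solve 1 (λ t₁ → con (+ 1) :+ t₁ :- t₁ := con (+ 1)) refl (ι n))

  0<ι-suc : ∀ n → 0# < ι (suc n)
  0<ι-suc n = +-pos 0<1 (ι-nonNeg n)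

  -- If all `ι n` stayed below `x`, the increasing sequence `ι` would converge to some `l`; shifting
  -- its index by one would give `1# + l ≈ l`.
  archimedean : ∀ x → ∃[ n ] x ≤ ι n
  archimedean x with lem {∃[ n ] x ≤ ι n}
  ... | yes p = p
  ... | no ¬p = ⊥-elim (<⇒≱ (<-by 0<1 (solve 1 (λ l → l :+ con (+ 1) :- l := con (+ 1)) refl l)) (≤-resp (+-comm 1# l) refl
      (⟶-unique-suc)))
    where
    conv : ∃[ l ] ι ⟶ l
    conv = ⟶-sup (λ n → ι-mono (ℕ.n≤1+n n)) (λ n → ≰⇒≥ λ q → ¬p (n , q))
    l : Carrier
    l = proj₁ conv
    ⟶-unique-suc : 1# + l ≤ l
    ⟶-unique-suc = ≤-reflexive (⟶-unique (⟶-+ (⟶-const 1#) (proj₂ conv)) (⟶-∘suc (proj₂ conv)))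

  -- The mesh of a division into `suc n` equal parts. The shift makes it positive for every `n`,
  -- which is why the powers and iterates paired with it carry the exponent `suc n`.
  step : ℕ → Carrier
  step n = ι (suc n) ⁻¹

  step-nonNeg : ∀ n → 0# ≤ step n
  step-nonNeg n = ⁻¹-nonNeg (0<ι-suc n)

  step-pos : ∀ n → 0# < step n
  step-pos n = ⁻¹-pos (0<ι-suc n)

  step-* : ∀ n → ι (suc n) * step n ≈ 1#
  step-* n = trans (*-comm _ _) (⁻¹-inverseˡ (0<ι-suc n))

  step-null : step ⟶ 0#
  step-null = ⟶-intro λ ε 0<ε →
    let N , p = archimedean (ε ⁻¹)
    in N , λ n N≤n → ∣∣≤-resp (solve 1 (λ t₁ → t₁ := t₁ :- con (+ 0)) refl (step n)) (nonNeg⇒∣∣≤ (step-nonNeg n)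
         (*-cancelʳ-≤ (0<ι-suc n) (≤-resp (sym (⁻¹-inverseˡ (0<ι-suc n))) refl
           (≤-trans (≤-reflexive (sym (⁻¹-inverseˡ 0<ε))) (≤-trans (≤-reflexive (*-comm _ _))
             (*-monoˡ-≤ (<⇒≤ 0<ε) (≤-trans p (ι-mono (ℕ.m≤n⇒m≤1+n N≤n)))))))))

  eventually-small : ∀ {a} c → a ⟶ 0# → 0# < c → Eventually λ n → a n ≤ c
  eventually-small {a} c p 0<c = eventually-map (λ n q → ≤-resp (solve 1 (λ t₁ → t₁ :- con (+ 0)
        := t₁) refl (a n)) refl (upper q)) (⟶-elim p c 0<c)

  module _ {A : Set} where

    ∑-cong-∈ : ∀ (xs : List A) {f g : A → Carrier} → (∀ y → y ∈ xs → f y ≈ g y) → ∑[ xs ] f ≈ ∑[ xs ] g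
    ∑-cong-∈ []       e = refl
    ∑-cong-∈ (x ∷ xs) e = +-cong (e x (here ≡.refl)) (∑-cong-∈ xs λ y y∈ → e y (there y∈))

    ∑-cong : ∀ (xs : List A) {f g : A → Carrier} → (∀ y → f y ≈ g y) → ∑[ xs ] f ≈ ∑[ xs ] g
    ∑-cong xs e = ∑-cong-∈ xs λ y _ → e y

    ∑-mono-∈ : ∀ (xs : List A) {f g : A → Carrier} → (∀ y → y ∈ xs → f y ≤ g y) → ∑[ xs ] f ≤ ∑[ xs ] g
    ∑-mono-∈ []       e = ≤-refl
    ∑-mono-∈ (x ∷ xs) e = +-mono-≤ (e x (here ≡.refl)) (∑-mono-∈ xs λ y y∈ → e y (there y∈))

    ∑-mono : ∀ (xs : List A) {f g : A → Carrier} → (∀ y → f y ≤ g y) → ∑[ xs ] f ≤ ∑[ xs ] g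
    ∑-mono xs e = ∑-mono-∈ xs λ y _ → e y

    ∑-0 : ∀ (xs : List A) → ∑[ xs ] (λ _ → 0#) ≈ 0#
    ∑-0 []       = refl
    ∑-0 (x ∷ xs) = trans (+-identityˡ _) (∑-0 xs)

    ∑-zero : ∀ (xs : List A) {f} → (∀ y → y ∈ xs → f y ≈ 0#) → ∑[ xs ] f ≈ 0#
    ∑-zero xs e = trans (∑-cong-∈ xs e) (∑-0 xs)

    ∑-nonNeg : ∀ (xs : List A) {f} → (∀ y → 0# ≤ f y) → 0# ≤ ∑[ xs ] f
    ∑-nonNeg xs e = ≤-resp (∑-0 xs) refl (∑-mono xs e)

    ∑-+ : ∀ (xs : List A) (f g : A → Carrier) → ∑[ xs ] (λ y → f y + g y) ≈ ∑[ xs ] f + ∑[ xs ] g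
    ∑-+ []       f g = sym (+-identityˡ 0#)
    ∑-+ (x ∷ xs) f g = trans (+-congˡ (∑-+ xs f g))
      (solve 4 (λ t₁ t₂ t₃ t₄ → t₁ :+ t₂ :+ (t₃ :+ t₄) := t₁ :+ t₃ :+ (t₂ :+ t₄)) refl (f x) (g x) (∑[ xs ] f) (∑[ xs ] g))

    ∑-*ˡ : ∀ c (xs : List A) (f : A → Carrier) → ∑[ xs ] (λ y → c * f y) ≈ c * ∑[ xs ] f
    ∑-*ˡ c []       f = sym (zeroʳ c)
    ∑-*ˡ c (x ∷ xs) f = trans (+-congˡ (∑-*ˡ c xs f)) (sym (distribˡ c _ _))

    ∑-neg : ∀ (xs : List A) (f : A → Carrier) → ∑[ xs ] (λ y → - f y) ≈ - ∑[ xs ] f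
    ∑-neg xs f = trans (∑-cong xs λ y → (solve 1 (λ t₁ → :- t₁ := :- con (+ 1) :* t₁) refl (f y))) (trans (∑-*ˡ (- 1#) xs f) (solve 1 (λ t₁ → :- con (+ 1) :* t₁ := :- t₁) refl (∑[ xs ] f)))

    ∑-- : ∀ (xs : List A) (f g : A → Carrier) → ∑[ xs ] (λ y → f y - g y) ≈ ∑[ xs ] f - ∑[ xs ] g
    ∑-- xs f g = trans (∑-+ xs f (λ y → - g y)) (+-congˡ (∑-neg xs g))

    ∑-∣∣≤-∈ : ∀ (xs : List A) {f g : A → Carrier} → (∀ y → y ∈ xs → ∣ f y ∣≤ g y) → ∣ ∑[ xs ] f ∣≤ ∑[ xs ] g
    ∑-∣∣≤-∈ xs {f} h = ∑-mono-∈ xs (λ y y∈ → upper (h y y∈)) , ≤-resp (∑-neg xs f) refl (∑-mono-∈ xs (λ y y∈ → lower (h y y∈)))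

    ∑-++ : ∀ (xs ys : List A) (f : A → Carrier) → ∑[ xs ++ ys ] f ≈ ∑[ xs ] f + ∑[ ys ] f
    ∑-++ []       ys f = sym (+-identityˡ _)
    ∑-++ (x ∷ xs) ys f = trans (+-congˡ (∑-++ xs ys f)) (sym (+-assoc _ _ _))

    ∑-⟶ : ∀ (xs : List A) {a : ℕ → A → Carrier} {l : A → Carrier} → (∀ y → y ∈ xs → (λ n → a n y) ⟶ l y) →
          (λ n → ∑[ xs ] (a n)) ⟶ ∑[ xs ] l
    ∑-⟶ []       h = ⟶-const 0#
    ∑-⟶ (x ∷ xs) h = ⟶-+ (h x (here ≡.refl)) (∑-⟶ xs λ y y∈ → h y (there y∈))

    -- A head that occurs in `ys` is cut out of it; since `xs` has no repetitions, the later
    -- elements that lie in `ys` survive the cut. The alternative `f y ≈ 0#` admits points where a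
    -- Dirichlet kernel vanishes.
    ∑-⊆ : ∀ {xs ys : List A} {f : A → Carrier} → Unique xs → (∀ {y} → y ∈ xs → y ∈ ys ⊎ f y ≈ 0#) → (∀ y → 0# ≤ f y) →
          ∑[ xs ] f ≤ ∑[ ys ] f
    ∑-⊆ {[]}     {ys} {f} u        s p = ∑-nonNeg ys p
    ∑-⊆ {x ∷ xs} {ys} {f} (x∉ ∷ u) s p with s (here ≡.refl)
    ... | inj₂ fx≈0 = ≤-resp (+-congʳ (sym fx≈0)) refl
                        (≤-trans (≤-reflexive (+-identityˡ _)) (∑-⊆ {xs} {ys} u (λ y∈ → s (there y∈)) p))
    ... | inj₁ x∈ys with as , bs , ≡.refl ← ∈-∃++ x∈ys =
      ≤-resp refl shuffle (+-mono-≤ (≤-refl {f x}) (∑-⊆ {xs} {as ++ bs} u s′ p))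
      where
      shuffle : f x + ∑[ as ++ bs ] f ≈ ∑[ as ++ x ∷ bs ] f
      shuffle = trans (+-congˡ (∑-++ as bs f)) (trans
        (solve 3 (λ t₁ t₂ t₃ → t₁ :+ (t₂ :+ t₃)
           := t₂ :+ (t₁ :+ t₃))
           refl (f x) (∑[ as ] f) (∑[ bs ] f)) (sym (∑-++ as (x ∷ bs) f)))
      s′ : ∀ {y} → y ∈ xs → y ∈ as ++ bs ⊎ f y ≈ 0#
      s′ {y} y∈xs with s (there y∈xs)
      ... | inj₂ fy≈0 = inj₂ fy≈0
      ... | inj₁ y∈ with ∈-++⁻ as y∈
      ...   | inj₁ q           = inj₁ (∈-++⁺ˡ q)
      ...   | inj₂ (here y≡x)  = ⊥-elim (All.lookup x∉ y∈xs (≡.sym y≡x))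
      ...   | inj₂ (there q)   = inj₁ (∈-++⁺ʳ as q)

    ∑-single : ∀ {xs : List A} {f : A → Carrier} {x} → Unique xs → x ∈ xs → (∀ y → y ∈ xs → ¬ y ≡ x → f y ≈ 0#) →
               ∑[ xs ] f ≈ f x
    ∑-single {x ∷ xs} (x∉ ∷ u) (here ≡.refl) h =
      trans (+-congˡ (∑-zero xs λ y y∈ → h y (there y∈) λ y≡x → All.lookup x∉ y∈ (≡.sym y≡x))) (+-identityʳ _)
    ∑-single {z ∷ xs} (z∉ ∷ u) (there x∈) h =
      trans (+-congʳ (h z (here ≡.refl) (All.lookup z∉ x∈))) (trans (+-identityˡ _) (∑-single u x∈ λ y y∈ → h y (there y∈)))

  ∑-swap : ∀ {A B : Set} (xs : List A) (ys : List B) (f : A → B → Carrier) →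
           ∑[ xs ] (λ x → ∑[ ys ] (f x)) ≈ ∑[ ys ] (λ y → ∑[ xs ] (λ x → f x y))
  ∑-swap []       ys f = sym (∑-0 ys)
  ∑-swap (x ∷ xs) ys f = trans (+-congˡ (∑-swap xs ys f)) (sym (∑-+ ys (f x) _))

  ∑-applyUpTo : ∀ (g : ℕ → Carrier) (h : ℕ → ℕ) n → ∑[ applyUpTo h (suc n) ] g ≈ ∑[ applyUpTo h n ] g + g (h n)
  ∑-applyUpTo g h zero    = +-comm _ _
  ∑-applyUpTo g h (suc n) = trans (+-congˡ (∑-applyUpTo g (h ∘ suc) n)) (sym (+-assoc _ _ _))

  ∑-upTo-suc : ∀ (g : ℕ → Carrier) n → ∑[ upTo (suc n) ] g ≈ ∑[ upTo n ] g + g n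
  ∑-upTo-suc g n = ∑-applyUpTo g (λ k → k) n

  sum≈∑ : ∀ n (f : Fin n → Carrier) → sum {n} f ≈ ∑[ allFin n ] f
  sum≈∑ n f = go n (λ i → i)
    where
    go : ∀ m (g : Fin m → Fin n) → sum {m} (f ∘ g) ≈ ∑[ tabulate g ] f
    go zero    g = refl
    go (suc m) g = +-congˡ (go m (g ∘ Fin.suc))

-- The exponential series and its Euler limit

module Exponential (lem : ExcludedMiddle 0ℓ) (ℛ : Reals) where

  open Limits lem ℛ public
  open PowerProperties commutativeSemiring public using (^-distrib-*; ^-homo-*)
  open Multiples semiring using (×1-homo-*)

  *-null : ∀ {a} c → a ⟶ 0# → (λ n → c * a n) ⟶ 0#
  *-null c p = ⟶-cong (λ _ → refl) (zeroʳ c) (⟶-*ˡ c p)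

  0<ι! : ∀ k → 0# < ι (k !)
  0<ι! zero    = 0<ι-suc 0
  0<ι! (suc k) = ≤-resp refl (sym e) (<⇒≤ q) , λ z → pos⇒≉0 q (trans (sym e) (sym z))
    where
    e : ι (suc k !) ≈ ι (suc k) * ι (k !)
    e = ×1-homo-* (suc k) (k !)
    q : 0# < ι (suc k) * ι (k !)
    q = *-pos (0<ι-suc k) (0<ι! k)

  τ : Carrier → ℕ → Carrier
  τ x k = x ^ k / ι (k !)

  τ-zero : ∀ x → τ x 0 ≈ 1#
  τ-zero x = *-cancelʳ (0<ι! 0) (trans (/-cancelʳ 1# (pos⇒≉0 (0<ι! 0))) ((solve 0 (con (+ 1)
        := con (+ 1) :* (con (+ 1) :+ con (+ 0))) refl)))

  τ-suc : ∀ x k → ι (suc k) * τ x (suc k) ≈ x * τ x k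
  τ-suc x k = *-cancelʳ (0<ι! k) (begin-equality
    ι (suc k) * τ x (suc k) * ι (k !)    ≈⟨ solve 3 (λ t₁ t₂ t₃ → t₁ :* t₂ :* t₃
          := t₂ :* (t₁ :* t₃)) refl (ι (suc k)) (τ x (suc k)) (ι (k !)) ⟩
    τ x (suc k) * (ι (suc k) * ι (k !))  ≈⟨ *-congˡ (×1-homo-* (suc k) (k !)) ⟨
    τ x (suc k) * ι (suc k !)            ≈⟨ /-cancelʳ _ (pos⇒≉0 (0<ι! (suc k))) ⟩
    x * x ^ k                            ≈⟨ *-congˡ (/-cancelʳ _ (pos⇒≉0 (0<ι! k))) ⟨
    x * (τ x k * ι (k !))                ≈⟨ *-assoc _ _ _ ⟨
    x * τ x k * ι (k !)                  ∎)

  -- binomial h m k is the term C(m,k) h^k.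
  binomial : Carrier → ℕ → ℕ → Carrier
  binomial h m       zero    = 1#
  binomial h zero    (suc k) = 0#
  binomial h (suc m) (suc k) = binomial h m (suc k) + h * binomial h m k

  binomial-> : ∀ h {m k} → m ℕ.< k → binomial h m k ≈ 0#
  binomial-> h {zero}  {suc k} p           = refl
  binomial-> h {suc m} {suc k} (ℕ.s≤s p) = trans (+-cong (binomial-> h (ℕ.m<n⇒m<1+n p)) (*-congˡ (binomial-> h p)))
    (solve 1 (λ h → con (+ 0) :+ h :* con (+ 0) := con (+ 0)) refl h)

  ∑-binomial-pascal : ∀ h m n → ∑[ upTo (suc n) ] (binomial h (suc m)) ≈ ∑[ upTo (suc n) ] (binomial h m) + h * ∑[ upTo n ] (binomial h m)
  ∑-binomial-pascal h m zero    = (solve 1 (λ h → con (+ 1) :+ con (+ 0) := con (+ 1) :+ con (+ 0) :+ h :* con (+ 0)) refl h)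
  ∑-binomial-pascal h m (suc n) = begin-equality
    ∑[ upTo (suc (suc n)) ] (b (suc m))             ≈⟨ ∑-upTo-suc (b (suc m)) (suc n) ⟩
    ∑[ upTo (suc n) ] (b (suc m)) + (b m (suc n) + h * b m n)
      ≈⟨ +-congʳ (∑-binomial-pascal h m n) ⟩
    ∑[ upTo (suc n) ] (b m) + h * ∑[ upTo n ] (b m) + (b m (suc n) + h * b m n)
      ≈⟨ solve 5 (λ t₁ h t₂ t₃ t₄ → t₁ :+ h :* t₂ :+ (t₃ :+ h :* t₄)
            := t₁ :+ t₃ :+ h :* (t₂ :+ t₄))
            refl (∑[ upTo (suc n) ] (b m)) h (∑[ upTo n ] (b m)) (b m (suc n)) (b m n) ⟩
    ∑[ upTo (suc n) ] (b m) + b m (suc n) + h * (∑[ upTo n ] (b m) + b m n)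
      ≈⟨ +-cong (∑-upTo-suc (b m) (suc n)) (*-congˡ (∑-upTo-suc (b m) n)) ⟨
    ∑[ upTo (suc (suc n)) ] (b m) + h * ∑[ upTo (suc n) ] (b m) ∎
    where
    b : ℕ → ℕ → Carrier
    b = binomial h

  ∑-binomial : ∀ h m → ∑[ upTo (suc m) ] (binomial h m) ≈ (1# + h) ^ m
  ∑-binomial h zero    = +-identityʳ 1#
  ∑-binomial h (suc m) = begin-equality
    ∑[ upTo (suc (suc m)) ] (b (suc m))                ≈⟨ ∑-binomial-pascal h m (suc m) ⟩
    ∑[ upTo (suc (suc m)) ] (b m) + h * s              ≈⟨ +-congʳ (∑-upTo-suc (b m) (suc m)) ⟩
    s + b m (suc m) + h * s                            ≈⟨ +-congʳ (+-congˡ (binomial-> h (ℕ.n<1+n m))) ⟩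
    s + 0# + h * s                                     ≈⟨ solve 2 (λ s h → s :+ con (+ 0) :+ h :* s
          := (con (+ 1) :+ h) :* s) refl s h ⟩
    (1# + h) * s                                       ≈⟨ *-congˡ (∑-binomial h m) ⟩
    (1# + h) * (1# + h) ^ m                            ∎
    where
    b : ℕ → ℕ → Carrier
    b = binomial h
    s : Carrier
    s = ∑[ upTo (suc m) ] (b m)

  -- The counterpart of `τ-suc`: for h = x/m the factor is x(1 - k/m) instead of x, so both kinds of
  -- terms can be compared by induction on `k`. The difference is taken in the field, so no
  -- truncated subtraction arises.
  binomial-suc : ∀ h m k → ι (suc k) * binomial h m (suc k) ≈ (ι m - ι k) * h * binomial h m k
  binomial-suc h zero    zero    = (solve 1 (λ h → (con (+ 1) :+ con (+ 0)) :* con (+ 0)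
        := (con (+ 0) :- con (+ 0)) :* h :* con (+ 1)) refl h)
  binomial-suc h zero    (suc k) = (solve 3 (λ t₁ t₂ h → t₁ :* con (+ 0)
        := (con (+ 0) :- t₂) :* h :* con (+ 0)) refl (ι (suc (suc k))) (ι (suc k)) h)
  binomial-suc h (suc m) zero    = begin-equality
    ι 1 * (b m 1 + h * 1#)             ≈⟨ solve 3 (λ t₁ t₂ h → t₁ :* (t₂ :+ h :* con (+ 1))
          := t₁ :* t₂ :+ t₁ :* h) refl (ι 1) (b m 1) h ⟩
    ι 1 * b m 1 + ι 1 * h              ≈⟨ +-congʳ (binomial-suc h m 0) ⟩
    (ι m - 0#) * h * 1# + ι 1 * h      ≈⟨
        (solve 2 (λ t₁ h → (t₁ :- con (+ 0)) :* h :* con (+ 1) :+ (con (+ 1) :+ con (+ 0)) :* h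
          := (con (+ 1) :+ t₁ :- con (+ 0)) :* h :* con (+ 1)) refl (ι m) h) ⟩
    (ι (suc m) - 0#) * h * 1#          ∎
    where
    b : ℕ → ℕ → Carrier
    b = binomial h
  binomial-suc h (suc m) (suc k) = begin-equality
    ι (suc (suc k)) * (b m (suc (suc k)) + h * β)
      ≈⟨ solve 4 (λ t₁ t₂ h β → t₁ :* (t₂ :+ h :* β)
            := t₁ :* t₂ :+ t₁ :* h :* β)
            refl (ι (suc (suc k))) (b m (suc (suc k))) h β ⟩
    ι (suc (suc k)) * b m (suc (suc k)) + ι (suc (suc k)) * h * β
      ≈⟨ +-congʳ (binomial-suc h m (suc k)) ⟩
    (ι m - (1# + ι k)) * h * β + (1# + (1# + ι k)) * h * β
      ≈⟨ solve 4 (λ t₁ t₂ h β → (t₁ :- (con (+ 1) :+ t₂)) :* h :* β :+ (con (+ 1) :+ (con (+ 1) :+ t₂)) :* h :* β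
            := (con (+ 1) :+ t₁ :- (con (+ 1) :+ t₂)) :* h :* β :+ h :* ((con (+ 1) :+ t₂) :* β))
            refl (ι m) (ι k) h β ⟩
    (1# + ι m - (1# + ι k)) * h * β + h * ((1# + ι k) * β)
      ≈⟨ +-congˡ (*-congˡ (binomial-suc h m k)) ⟩
    (1# + ι m - (1# + ι k)) * h * β + h * ((ι m - ι k) * h * b m k)
      ≈⟨ solve 5 (λ t₁ t₂ h β t₃ → (con (+ 1) :+ t₁ :- (con (+ 1) :+ t₂)) :* h :* β :+ h :* ((t₁ :- t₂) :* h :* t₃)
            := (con (+ 1) :+ t₁ :- (con (+ 1) :+ t₂)) :* h :* (β :+ h :* t₃))
            refl (ι m) (ι k) h β (b m k) ⟩
    (ι (suc m) - ι (suc k)) * h * (β + h * b m k) ∎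
    where
    b : ℕ → ℕ → Carrier
    b = binomial h
    β : Carrier
    β = b m (suc k)

  module _ {x a : Carrier} (0<a : 0# < a) (x≤a : ∣ x ∣≤ a) where

    τ-nonNeg : ∀ k → 0# ≤ τ a k
    τ-nonNeg k = ≤-resp refl (sym (/-def (a ^ k) (0<ι! k))) (*-nonNeg (^-nonNeg k (<⇒≤ 0<a)) (⁻¹-nonNeg (0<ι! k)))

    ∣τ∣≤ : ∀ k → ∣ τ x k ∣≤ τ a k
    ∣τ∣≤ k = ∣∣≤-trans (∣∣≤-resp (sym (/-def (x ^ k) (0<ι! k)))
      (∣*∣≤ (∣^∣≤ k x≤a) (nonNeg⇒∣∣≤ (⁻¹-nonNeg (0<ι! k)) ≤-refl))) (≤-reflexive (sym (/-def (a ^ k) (0<ι! k))))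

    S : ℕ → Carrier
    S n = ∑[ upTo n ] (τ a)

    S-step : ∀ n → S n ≤ S (suc n)
    S-step n = ≤-resp refl (sym (∑-upTo-suc (τ a) n)) (≤-by (τ-nonNeg n) (solve 2 (λ t₁ t₂ → t₁ :+ t₂ :- t₁
          := t₂) refl (S n) (τ a n)))

    -- Once k ≥ 2 a the terms at least halve, so n ↦ S n + 2 τₙ is eventually non-increasing.
    S-bounded : ∃[ C ] (∀ n → S n ≤ C)
    S-bounded = A N , λ n →
      ≤-trans (monotone S-step (ℕ.m≤m+n n N)) (≤-trans (≤-by (*-nonNeg (<⇒≤ 0<2) (τ-nonNeg (n ℕ.+ N)))
        (solve 2 (λ t₁ t₂ → t₁ :+ con (+ 2) :* t₂ :- t₁
           := con (+ 2) :* t₂)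
           refl (S (n ℕ.+ N)) (τ a (n ℕ.+ N)))) (decreasing n))
      where
      N : ℕ
      N = proj₁ (archimedean (2# * a))
      2a≤N : 2# * a ≤ ι N
      2a≤N = proj₂ (archimedean (2# * a))
      A : ℕ → Carrier
      A n = S n + 2# * τ a n
      halving : ∀ k → N ℕ.≤ k → 2# * τ a (suc k) ≤ τ a k
      halving k N≤k = *-cancelʳ-≤ 0<a (begin
        2# * τ a (suc k) * a      ≈⟨ solve 2 (λ t₁ a → con (+ 2) :* t₁ :* a := con (+ 2) :* a :* t₁) refl (τ a (suc k)) a ⟩
        2# * a * τ a (suc k)      ≤⟨ *-monoʳ-≤ (τ-nonNeg (suc k)) (≤-trans 2a≤N (ι-mono (ℕ.m≤n⇒m≤1+n N≤k))) ⟩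
        ι (suc k) * τ a (suc k)   ≈⟨ τ-suc a k ⟩
        a * τ a k                 ≈⟨ *-comm _ _ ⟩
        τ a k * a                 ∎)
      decreasing : ∀ n → A (n ℕ.+ N) ≤ A N
      decreasing zero    = ≤-refl
      decreasing (suc n) = ≤-trans (≤-resp (sym (+-congʳ (∑-upTo-suc (τ a) (n ℕ.+ N)))) refl
        (≤-by (gap (halving (n ℕ.+ N) (ℕ.m≤n+m N n)))
          (solve 3 (λ t₁ t₂ t₃ → t₁ :+ con (+ 2) :* t₂ :- (t₁ :+ t₂ :+ con (+ 2) :* t₃)
             := t₂ :- con (+ 2) :* t₃)
             refl (S (n ℕ.+ N)) (τ a (n ℕ.+ N)) (τ a (suc n ℕ.+ N)))))
        (decreasing n)

    -- The terms `τ x k + τ a k` are nonnegative, so their partial sums are monotone and bounded;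
    -- subtracting the convergent majorant leaves the series for `x`.
    partial-sums-converge : ∃[ l ] (λ n → ∑[ upTo n ] (τ x)) ⟶ l
    partial-sums-converge =
      proj₁ U-sup - proj₁ S-sup , ⟶-cong (λ n → trans (+-congʳ (∑-+ (upTo n) (τ x) (τ a)))
        (solve 2 (λ t₁ t₂ → t₁ :+ t₂ :- t₂ := t₁) refl (∑[ upTo n ] (τ x)) (S n))) refl (⟶-- (proj₂ U-sup) (proj₂ S-sup))
      where
      C : Carrier
      C = proj₁ S-bounded
      S≤C : ∀ n → S n ≤ C
      S≤C = proj₂ S-bounded
      U : ℕ → Carrier
      U n = ∑[ upTo n ] (λ k → τ x k + τ a k)
      S-sup : ∃[ l ] S ⟶ l
      S-sup = ⟶-sup S-step S≤C
      U-sup : ∃[ l ] U ⟶ l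
      U-sup = ⟶-sup {U} {C + C}
        (λ n → ≤-resp refl (sym (∑-upTo-suc _ n)) (≤-by (gap (lower (∣τ∣≤ n))) (solve 3 (λ t₁ t₂ t₃ → t₁ :+ (t₂ :+ t₃) :- t₁
              := t₃ :- :- t₂) refl (U n) (τ x n) (τ a n))))
        (λ n → ≤-trans (≤-reflexive (∑-+ (upTo n) (τ x) (τ a))) (+-mono-≤ (≤-trans (∑-mono (upTo n) λ k → upper (∣τ∣≤ k)) (S≤C n)) (S≤C n)))

    module _ (m : ℕ) {r : Carrier} (0≤r : 0# ≤ r) (mr≈1 : ι m * r ≈ 1#) where

      private
        b : ℕ → Carrier
        b = binomial (x * r) m
        -- For k ≥ 2 this is a² a^(k-2)/(k-2)!, the second-derivative term of the majorant series
        -- times a². The terms 0 and 1 vanish, whence the shift by two in `e-sum`.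
        e : ℕ → Carrier
        e k = ι k * (ι k - 1#) * τ a k

      ∣xr∣≤ : ∣ x * r ∣≤ a * r
      ∣xr∣≤ = ∣*∣≤ x≤a (nonNeg⇒∣∣≤ 0≤r ≤-refl)

      unscale : ∀ {y c} k → ∣ ι (suc k) * y ∣≤ ι (suc k) * c → ∣ y ∣≤ c
      unscale {y} {c} k (p , q) =
          *-cancelʳ-≤ (0<ι-suc k) (≤-resp (*-comm _ _) (*-comm _ _) p)
        , *-cancelʳ-≤ (0<ι-suc k) (≤-resp (solve 2 (λ t₁ y → :- (t₁ :* y) := :- y :* t₁) refl (ι (suc k)) y) (*-comm _ _) q)

      -- By `binomial-suc` each ratio has the factor (m - k)r, which lies between 0 and mr = 1 as
      -- long as k ≤ m.
      ∣binomial∣≤ : ∀ k → k ℕ.≤ m → ∣ b k ∣≤ τ a k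
      ∣binomial∣≤ zero    _   = nonNeg⇒∣∣≤ 0≤1 (≤-reflexive (sym (τ-zero a)))
      ∣binomial∣≤ (suc k) k<m = unscale k (∣∣≤-resp (sym (binomial-suc (x * r) m k)) (∣∣≤-trans
        (∣*∣≤ (∣*∣≤ {c = ι m} (nonNeg⇒∣∣≤ (gap (ι-mono (ℕ.<⇒≤ k<m))) (≤-by (ι-nonNeg k) (solve 2 (λ t₁ t₂ → t₁ :- (t₁ :- t₂)
              := t₂) refl (ι m) (ι k)))) ∣xr∣≤)
              (∣binomial∣≤ k (ℕ.<⇒≤ k<m)))
        (≤-reflexive (begin-equality
          ι m * (a * r) * τ a k        ≈⟨ solve 4 (λ t₁ a r t₂ → t₁ :* (a :* r) :* t₂
                := t₁ :* r :* (a :* t₂)) refl (ι m) a r (τ a k) ⟩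
          ι m * r * (a * τ a k)        ≈⟨ *-congʳ mr≈1 ⟩
          1# * (a * τ a k)             ≈⟨ *-identityˡ _ ⟩
          a * τ a k                    ≈⟨ τ-suc a k ⟨
          ι (suc k) * τ a (suc k)      ∎))))

      -- The discrepancy d satisfies (k+1) d(k+1) = x d(k) + k x r b(k). With the weights k(k-1) the
      -- induction hypothesis and the new term add up to r k² a τ(k), which is at most (k+1) r
      -- e(k+1).
      ∣τ-binomial∣≤ : ∀ k → k ℕ.≤ m → ∣ τ x k - b k ∣≤ r * e k
      ∣τ-binomial∣≤ zero    _   = ∣∣≤-resp (sym (trans (+-congʳ (τ-zero x)) (-‿inverseʳ 1#)))
        (∣0∣≤ (≤-reflexive (solve 2 (λ r t₁ → con (+ 0)
              := r :* (con (+ 0) :* (con (+ 0) :- con (+ 1)) :* t₁)) refl r (τ a 0))))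
      ∣τ-binomial∣≤ (suc k) k<m = unscale k (∣∣≤-resp recurrence (∣∣≤-trans
          (∣+∣≤ (∣*∣≤ x≤a (∣τ-binomial∣≤ k (ℕ.<⇒≤ k<m)))
                (∣*∣≤ (∣*∣≤ (nonNeg⇒∣∣≤ (ι-nonNeg k) ≤-refl) ∣xr∣≤) (∣binomial∣≤ k (ℕ.<⇒≤ k<m))))
          bound))
        where
        recurrence : x * (τ x k - b k) + ι k * (x * r) * b k ≈ ι (suc k) * (τ x (suc k) - b (suc k))
        recurrence = begin-equality
          x * (τ x k - b k) + ι k * (x * r) * b k
            ≈⟨ solve 5 (λ x t₁ t₂ t₃ r → x :* (t₁ :- t₂) :+ t₃ :* (x :* r) :* t₂
                  := x :* t₁ :- (con (+ 1) :- t₃ :* r) :* x :* t₂)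
                  refl x (τ x k) (b k) (ι k) r ⟩
          x * τ x k - (1# - ι k * r) * x * b k
            ≈⟨ +-congˡ (-‿cong (*-congʳ (*-congʳ (+-congʳ mr≈1)))) ⟨
          x * τ x k - (ι m * r - ι k * r) * x * b k
            ≈⟨ solve 6 (λ x t₁ t₂ r t₃ t₄ → x :* t₁ :- (t₂ :* r :- t₃ :* r) :* x :* t₄
                  := x :* t₁ :- (t₂ :- t₃) :* (x :* r) :* t₄)
                  refl x (τ x k) (ι m) r (ι k) (b k) ⟩
          x * τ x k - (ι m - ι k) * (x * r) * b k
            ≈⟨ +-cong (τ-suc x k) (-‿cong (binomial-suc (x * r) m k)) ⟨
          ι (suc k) * τ x (suc k) - ι (suc k) * b (suc k)
            ≈⟨ solve 3 (λ t₁ t₂ t₃ → t₁ :* t₂ :- t₁ :* t₃ := t₁ :* (t₂ :- t₃)) refl (ι (suc k)) (τ x (suc k)) (b (suc k)) ⟩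
          ι (suc k) * (τ x (suc k) - b (suc k)) ∎
        bound : a * (r * e k) + ι k * (a * r) * τ a k ≤ ι (suc k) * (r * e (suc k))
        bound = begin
          a * (r * e k) + ι k * (a * r) * τ a k
            ≈⟨ solve 4 (λ a r t₁ t₂ → a :* (r :* (t₁ :* (t₁ :- con (+ 1)) :* t₂)) :+ t₁ :* (a :* r) :* t₂
                  := r :* (t₁ :* t₁) :* (a :* t₂))
                  refl a r (ι k) (τ a k) ⟩
          r * (ι k * ι k) * (a * τ a k)
            ≤⟨ *-monoʳ-≤ (*-nonNeg (<⇒≤ 0<a) (τ-nonNeg k)) (≤-by (*-nonNeg 0≤r (ι-nonNeg k))
                (solve 2 (λ r t₁ → r :* ((con (+ 1) :+ t₁) :* t₁) :- r :* (t₁ :* t₁)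
                  := r :* t₁) refl r (ι k))) ⟩
          r * (ι (suc k) * ι k) * (a * τ a k)
            ≈⟨ *-congˡ (τ-suc a k) ⟨
          r * (ι (suc k) * ι k) * (ι (suc k) * τ a (suc k))
            ≈⟨ solve 3 (λ r t₁ t₂ → r :* ((con (+ 1) :+ t₁) :* t₁) :* ((con (+ 1) :+ t₁) :* t₂)
                  := (con (+ 1) :+ t₁) :* (r :* ((con (+ 1) :+ t₁) :* (con (+ 1) :+ t₁ :- con (+ 1)) :* t₂)))
                  refl r (ι k) (τ a (suc k)) ⟩
          ι (suc k) * (r * e (suc k)) ∎

      e-sum : ∀ n → ∑[ upTo (suc (suc n)) ] e ≈ a * a * S n
      e-sum zero    =
          (solve 3 (λ t₁ t₂ a → con (+ 0) :* (con (+ 0) :- con (+ 1)) :* t₁ :+ ((con (+ 1) :+ con (+ 0)) :* (con (+ 1) :+ con (+ 0) :- con (+ 1)) :* t₂ :+ con (+ 0))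
            := a :* a :* con (+ 0)) refl (τ a 0) (τ a 1) a)
      e-sum (suc n) = begin-equality
        ∑[ upTo (suc (suc (suc n))) ] e          ≈⟨ ∑-upTo-suc e (suc (suc n)) ⟩
        ∑[ upTo (suc (suc n)) ] e + e (suc (suc n)) ≈⟨ +-cong (e-sum n) last-term ⟩
        a * a * S n + a * a * τ a n              ≈⟨ distribˡ _ _ _ ⟨
        a * a * (S n + τ a n)                    ≈⟨ *-congˡ (∑-upTo-suc (τ a) n) ⟨
        a * a * S (suc n)                        ∎
        where
        last-term : e (suc (suc n)) ≈ a * a * τ a n
        last-term = begin-equality
          e (suc (suc n))
            ≈⟨ solve 2 (λ t₁ t₂ → (con (+ 1) :+ (con (+ 1) :+ t₁)) :* (con (+ 1) :+ (con (+ 1) :+ t₁) :- con (+ 1)) :* t₂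
                  := (con (+ 1) :+ t₁) :* ((con (+ 1) :+ (con (+ 1) :+ t₁)) :* t₂))
                  refl (ι n) (τ a (suc (suc n))) ⟩
          (1# + ι n) * (ι (suc (suc n)) * τ a (suc (suc n)))   ≈⟨ *-congˡ (τ-suc a (suc n)) ⟩
          (1# + ι n) * (a * τ a (suc n))                       ≈⟨ solve 3 (λ t₁ a t₂ → (con (+ 1) :+ t₁) :* (a :* t₂)
                := a :* ((con (+ 1) :+ t₁) :* t₂)) refl (ι n) a (τ a (suc n)) ⟩
          a * (ι (suc n) * τ a (suc n))                        ≈⟨ *-congˡ (τ-suc a n) ⟩
          a * (a * τ a n)                                      ≈⟨ *-assoc _ _ _ ⟨
          a * a * τ a n                                        ∎

      euler-error : ∣ ∑[ upTo (suc m) ] (τ x) - (1# + x * r) ^ m ∣≤ r * ∑[ upTo (suc m) ] e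
      euler-error = ∣∣≤-trans
        (∣∣≤-resp (trans (∑-- (upTo (suc m)) (τ x) b) (+-congˡ (-‿cong (∑-binomial (x * r) m))))
          (∑-∣∣≤-∈ (upTo (suc m)) λ k k∈ → ∣τ-binomial∣≤ k (ℕ.≤-pred (∈-upTo⁻ k∈))))
        (≤-reflexive (∑-*ˡ r (upTo (suc m)) e))

    euler-⟶-series : ∀ {l} → (λ n → ∑[ upTo n ] (τ x)) ⟶ l → (λ n → (1# + x * step n) ^ suc n) ⟶ l
    euler-⟶-series {l} p = ⟶-cong {λ n → s n - (s n - E n)} (λ n → (solve 2 (λ t₁ t₂ → t₁ :- (t₁ :- t₂) := t₂) refl (s n) (E n))) (solve 1 (λ l → l :- con (+ 0) := l) refl l)
      (⟶-- (⟶-∘suc (⟶-∘suc p)) (⟶-squeeze (always error) null))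
      where
      s E : ℕ → Carrier
      s n = ∑[ upTo (suc (suc n)) ] (τ x)
      E n = (1# + x * step n) ^ suc n
      C : Carrier
      C = proj₁ S-bounded
      error : ∀ n → ∣ s n - E n - 0# ∣≤ a * a * C * step n
      error n = ∣∣≤-resp (solve 2 (λ t₁ t₂ → t₁ :- t₂
            := t₁ :- t₂ :- con (+ 0))
            refl (s n) (E n)) (∣∣≤-trans (euler-error (suc n) (step-nonNeg n) (step-* n)) (begin
        step n * _                   ≈⟨ *-congˡ (e-sum (suc n) (step-nonNeg n) (step-* n) n) ⟩
        step n * (a * a * S n)       ≤⟨ *-monoˡ-≤ (step-nonNeg n) (*-monoˡ-≤ (square-nonNeg a) (proj₂ S-bounded n)) ⟩
        step n * (a * a * C)         ≈⟨ *-comm _ _ ⟩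
        a * a * C * step n           ∎))
      null : (λ n → a * a * C * step n) ⟶ 0#
      null = *-null (a * a * C) step-null

  module _ (x : Carrier) where

    private
      0<1+∣x∣ : 0# < 1# + abs x
      0<1+∣x∣ = +-pos 0<1 (abs-nonNeg x)

      ∣x∣≤1+∣x∣ : ∣ x ∣≤ 1# + abs x
      ∣x∣≤1+∣x∣ = ∣∣≤-trans (∣x∣≤abs x) (≤-by 0≤1 (solve 1 (λ t₁ → con (+ 1) :+ t₁ :- t₁ := con (+ 1)) refl (abs x)))

    euler : (λ n → (1# + x * step n) ^ suc n) ⟶ exp x
    -- The majorant's argument has to be positive, also for `x` zero; hence `1# + abs x`.
    euler = euler-⟶-series 0<1+∣x∣ ∣x∣≤1+∣x∣ (lim-spec (proj₂ (partial-sums-converge 0<1+∣x∣ ∣x∣≤1+∣x∣)))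

  bernoulli : ∀ {y} n → y ≤ 1# → 1# - ι n * y ≤ (1# - y) ^ n
  bernoulli {y} zero    y≤1 = ≤-reflexive (solve 1 (λ y → con (+ 1) :- con (+ 0) :* y := con (+ 1)) refl y)
  bernoulli {y} (suc n) y≤1 = ≤-trans
    (≤-by (*-nonNeg (ι-nonNeg n) (square-nonNeg y))
        (solve 2 (λ y t₁ → (con (+ 1) :- y) :* (con (+ 1) :- t₁ :* y) :- (con (+ 1) :- (con (+ 1) :+ t₁) :* y)
          := t₁ :* (y :* y)) refl y (ι n)))
    (*-monoˡ-≤ (gap y≤1) (bernoulli n y≤1))

  1≤^ : ∀ {x} n → 1# ≤ x → 1# ≤ x ^ n
  1≤^ zero    p = ≤-refl
  1≤^ (suc n) p = ≤-resp (*-identityˡ 1#) refl (*-mono-≤ 0≤1 (≤-trans 0≤1 (1≤^ n p)) p (1≤^ n p))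

  ^-≤1 : ∀ {x} n → 0# ≤ x → x ≤ 1# → x ^ n ≤ 1#
  ^-≤1 zero    p q = ≤-refl
  ^-≤1 (suc n) p q = ≤-resp refl (*-identityˡ 1#) (*-mono-≤ p 0≤1 q (^-≤1 n p q))

  -- Bernoulli's inequality replaces 1 - ny by (1 - y)^n, and the product becomes (1 - y²)^n.
  1+y^n*[1-ny]≤1 : ∀ {y} n → ∣ y ∣≤ 1# → (1# + y) ^ n * (1# - ι n * y) ≤ 1#
  1+y^n*[1-ny]≤1 {y} n (p , q) = begin
    (1# + y) ^ n * (1# - ι n * y)    ≤⟨ *-monoˡ-≤ (^-nonNeg n 0≤1+y) (bernoulli n p) ⟩
    (1# + y) ^ n * (1# - y) ^ n      ≈⟨ ^-distrib-* (1# + y) (1# - y) n ⟨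
    ((1# + y) * (1# - y)) ^ n        ≤⟨ ^-≤1 n (*-nonNeg 0≤1+y (gap p)) (≤-by (square-nonNeg y)
        (solve 1 (λ y → con (+ 1) :- (con (+ 1) :+ y) :* (con (+ 1) :- y)
          := y :* y) refl y)) ⟩
    1#                               ∎
    where
    0≤1+y : 0# ≤ 1# + y
    0≤1+y = ≤-by (gap q) (solve 1 (λ y → con (+ 1) :+ y :- con (+ 0) := con (+ 1) :- :- y) refl y)

  -- Takes the place of the derivative of `exp` at zero: it trades the exponential in the gradient
  -- bound for a linear factor.
  exp*[1-x]≤1 : ∀ x → exp x * (1# - x) ≤ 1#
  exp*[1-x]≤1 x = ⟶-≤-const
    (eventually-map (λ n p → ≤-resp (*-congˡ (+-congˡ (-‿cong (begin-equality
        ι (suc n) * (x * step n)     ≈⟨ solve 3 (λ t₁ x t₂ → t₁ :* (x :* t₂)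
              := x :* (t₁ :* t₂)) refl (ι (suc n)) x (step n) ⟩
        x * (ι (suc n) * step n)     ≈⟨ *-congˡ (step-* n) ⟩
        x * 1#                       ≈⟨ *-identityʳ x ⟩
        x                            ∎)))) refl (1+y^n*[1-ny]≤1 (suc n) (∣∣≤-resp (solve 2 (λ x t₁ → x :* t₁ :- con (+ 0)
              := x :* t₁) refl x (step n)) p)))
      (⟶-elim (*-null x step-null) 1# 0<1))
    (⟶-* (euler x) (⟶-const (1# - x)))

-- Laplacian and gradient form as weighted neighbour sums

module GraphCalculus (lem : ExcludedMiddle 0ℓ) (ℛ : Reals) (G : Analysis.WeightedGraph lem ℛ) where

  open Exponential lem ℛ public
  open Heat G public

  Fun : Set
  Fun = V → Carrier

  nb : V → List V
  nb x = elements (nbrs x)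

  -- Δ f x is definitionally mean (λ y → f y - f x) x.
  mean : Fun → Fun
  mean g x = (μ x) ⁻¹ * ∑[ nb x ] λ y → ω x y * g y

  mean-cong-nb : ∀ x {f g : Fun} → (∀ y → y ∈ nb x → f y ≈ g y) → mean f x ≈ mean g x
  mean-cong-nb x e = *-congˡ (∑-cong-∈ (nb x) λ y y∈ → *-congˡ (e y y∈))

  mean-cong : ∀ x {f g : Fun} → (∀ y → f y ≈ g y) → mean f x ≈ mean g x
  mean-cong x e = mean-cong-nb x λ y _ → e y

  mean-+ : ∀ x (f g : Fun) → mean (λ y → f y + g y) x ≈ mean f x + mean g x
  mean-+ x f g = trans (*-congˡ (trans (∑-cong (nb x) λ y → distribˡ (ω x y) (f y) (g y)) (∑-+ (nb x) _ _))) (distribˡ _ _ _)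

  mean-*ˡ : ∀ x c (f : Fun) → mean (λ y → c * f y) x ≈ c * mean f x
  mean-*ˡ x c f = trans (*-congˡ (trans (∑-cong (nb x) λ y → (solve 3 (λ t₁ c t₂ → t₁ :* (c :* t₂)
        := c :* (t₁ :* t₂)) refl (ω x y) c (f y))) (∑-*ˡ c (nb x) _)))
    (solve 3 (λ t₁ c t₂ → t₁ :* (c :* t₂) := c :* (t₁ :* t₂)) refl ((μ x) ⁻¹) c (∑[ nb x ] (λ y → ω x y * f y)))

  mean-neg : ∀ x (f : Fun) → mean (λ y → - f y) x ≈ - mean f x
  mean-neg x f = trans (mean-cong x λ y → (solve 1 (λ t₁ → :- t₁ := :- con (+ 1) :* t₁) refl (f y))) (trans (mean-*ˡ x (- 1#) f) (solve 1 (λ t₁ → :- con (+ 1) :* t₁ := :- t₁) refl (mean f x)))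

  mean-- : ∀ x (f g : Fun) → mean (λ y → f y - g y) x ≈ mean f x - mean g x
  mean-- x f g = trans (mean-+ x f (λ y → - g y)) (+-congˡ (mean-neg x g))

  mean-nonNeg : ∀ x {f : Fun} → (∀ y → 0# ≤ f y) → 0# ≤ mean f x
  mean-nonNeg x p = *-nonNeg (⁻¹-nonNeg (μ-pos x)) (∑-nonNeg (nb x) λ y → *-nonNeg (ω-nonNeg x y) (p y))

  mean-mono : ∀ x {f g : Fun} → (∀ y → f y ≤ g y) → mean f x ≤ mean g x
  mean-mono x p = *-monoˡ-≤ (⁻¹-nonNeg (μ-pos x)) (∑-mono (nb x) λ y → *-monoˡ-≤ (ω-nonNeg x y) (p y))

  mean-mono-nb : ∀ x {f g : Fun} → (∀ y → y ∈ nb x → f y ≤ g y) → mean f x ≤ mean g x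
  mean-mono-nb x p = *-monoˡ-≤ (⁻¹-nonNeg (μ-pos x)) (∑-mono-∈ (nb x) λ y y∈ → *-monoˡ-≤ (ω-nonNeg x y) (p y y∈))

  mean-⟶ : ∀ x {a : ℕ → Fun} {l : Fun} → (∀ y → (λ n → a n y) ⟶ l y) → (λ n → mean (a n) x) ⟶ mean l x
  mean-⟶ x p = ⟶-*ˡ _ (∑-⟶ (nb x) λ y _ → ⟶-*ˡ (ω x y) (p y))

  degree : Fun
  degree = mean (λ _ → 1#)

  -- The absolute value yields `0# ≤ D` without choosing a vertex.
  D : Carrier
  D = abs (proj₁ D-bound)

  D-nonNeg : 0# ≤ D
  D-nonNeg = abs-nonNeg _

  degree≤D : ∀ x → degree x ≤ D
  degree≤D x = begin
    degree x            ≈⟨ *-congˡ (∑-cong (nb x) λ y → *-identityʳ (ω x y)) ⟩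
    (μ x) ⁻¹ * m x      ≈⟨ *-comm _ _ ⟩
    m x * (μ x) ⁻¹      ≈⟨ /-def (m x) (μ-pos x) ⟨
    m x / μ x           ≤⟨ proj₂ D-bound x ⟩
    proj₁ D-bound       ≤⟨ upper (∣x∣≤abs _) ⟩
    D                   ∎

  mean-const : ∀ x c → mean (λ _ → c) x ≈ c * degree x
  mean-const x c = trans (mean-cong x λ _ → sym (*-identityʳ c)) (mean-*ˡ x c (λ _ → 1#))

  mean-∣∣≤ : ∀ x {f : Fun} {c} → (∀ y → ∣ f y ∣≤ c) → ∣ mean f x ∣≤ D * c
  mean-∣∣≤ x {f} {c} p = bound (λ y → upper (p y)) , ≤-resp (mean-neg x f) refl (bound λ y → lower (p y))
    where
    bound : ∀ {g : Fun} → (∀ y → g y ≤ c) → mean g x ≤ D * c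
    bound {g} q = begin
      mean g x            ≤⟨ mean-mono x q ⟩
      mean (λ _ → c) x    ≈⟨ mean-const x c ⟩
      c * degree x        ≤⟨ *-monoˡ-≤ (∣∣≤-nonNeg (p x)) (degree≤D x) ⟩
      c * D               ≈⟨ *-comm c D ⟩
      D * c               ∎

  Δ-mean : ∀ f x → Δ f x ≈ mean f x - degree x * f x
  Δ-mean f x = trans (mean-- x f (λ _ → f x)) (+-congˡ (-‿cong (trans (mean-const x (f x)) (*-comm _ _))))

  Δ-cong-nb : ∀ x {f g : Fun} → f x ≈ g x → (∀ y → y ∈ nb x → f y ≈ g y) → Δ f x ≈ Δ g x
  Δ-cong-nb x e e′ = mean-cong-nb x λ y y∈ → +-cong (e′ y y∈) (-‿cong e)

  Δ-cong : ∀ x {f g : Fun} → (∀ y → f y ≈ g y) → Δ f x ≈ Δ g x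
  Δ-cong x e = Δ-cong-nb x (e x) λ y _ → e y

  Δ-+ : ∀ x (f g : Fun) → Δ (λ y → f y + g y) x ≈ Δ f x + Δ g x
  Δ-+ x f g = trans (mean-cong x λ y → (solve 4 (λ t₁ t₂ t₃ t₄ → t₁ :+ t₂ :- (t₃ :+ t₄)
        := t₁ :- t₃ :+ (t₂ :- t₄)) refl (f y) (g y) (f x) (g x))) (mean-+ x _ _)

  Δ-*ˡ : ∀ x c (f : Fun) → Δ (λ y → c * f y) x ≈ c * Δ f x
  Δ-*ˡ x c f = trans (mean-cong x λ y → (solve 3 (λ c t₁ t₂ → c :* t₁ :- c :* t₂
        := c :* (t₁ :- t₂)) refl c (f y) (f x))) (mean-*ˡ x c _)

  Δ-- : ∀ x (f g : Fun) → Δ (λ y → f y - g y) x ≈ Δ f x - Δ g x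
  Δ-- x f g = trans (mean-cong x λ y → (solve 4 (λ t₁ t₂ t₃ t₄ → t₁ :- t₂ :- (t₃ :- t₄)
        := t₁ :- t₃ :- (t₂ :- t₄)) refl (f y) (g y) (f x) (g x))) (mean-- x _ _)

  Δ-const : ∀ x c → Δ (λ _ → c) x ≈ 0#
  Δ-const x c = trans (mean-const x (c - c)) (trans (*-congʳ (-‿inverseʳ c)) (zeroˡ _))

  Δ-∣∣≤ : ∀ x {f : Fun} {c} → (∀ y → ∣ f y ∣≤ c) → ∣ Δ f x ∣≤ D * (c + c)
  Δ-∣∣≤ x p = mean-∣∣≤ x λ y → ∣∸∣≤ (p y) (p x)

  -- `Γ` is defined as the defect of the product rule; in the form with increments, bilinearity,
  -- positivity and the sup-norm bound can be read off.
  Γ-mean : ∀ f g x → Γ f g x ≈ half * mean (λ y → (f y - f x) * (g y - g x)) x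
  Γ-mean f g x = *-congˡ (begin-equality
    Δ (λ y → f y * g y) x - f x * Δ g x - g x * Δ f x
      ≈⟨ +-cong (+-congˡ (-‿cong (sym (mean-*ˡ x (f x) _)))) (-‿cong (sym (mean-*ˡ x (g x) _))) ⟩
    mean (λ y → f y * g y - f x * g x) x - mean (λ y → f x * (g y - g x)) x - mean (λ y → g x * (f y - f x)) x
      ≈⟨ +-congʳ (mean-- x _ _) ⟨
    mean (λ y → f y * g y - f x * g x - f x * (g y - g x)) x - mean (λ y → g x * (f y - f x)) x
      ≈⟨ mean-- x _ _ ⟨
    mean (λ y → f y * g y - f x * g x - f x * (g y - g x) - g x * (f y - f x)) x
      ≈⟨ mean-cong x (λ y → (solve 4 (λ t₁ t₂ t₃ t₄ → t₁ :* t₂ :- t₃ :* t₄ :- t₃ :* (t₂ :- t₄) :- t₄ :* (t₁ :- t₃)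
            := (t₁ :- t₃) :* (t₂ :- t₄)) refl (f y) (g y) (f x) (g x))) ⟩
    mean (λ y → (f y - f x) * (g y - g x)) x ∎)

  Γ-cong-nb : ∀ x {f f′ g g′ : Fun} → f x ≈ f′ x → (∀ y → y ∈ nb x → f y ≈ f′ y) → g x ≈ g′ x → (∀ y → y ∈ nb x → g y ≈ g′ y) →
              Γ f g x ≈ Γ f′ g′ x
  Γ-cong-nb x p p′ q q′ = *-congˡ (+-cong (+-cong (Δ-cong-nb x (*-cong p q) λ y y∈ → *-cong (p′ y y∈) (q′ y y∈))
    (-‿cong (*-cong p (Δ-cong-nb x q q′)))) (-‿cong (*-cong q (Δ-cong-nb x p p′))))

  Γ-cong : ∀ x {f f′ g g′ : Fun} → (∀ y → f y ≈ f′ y) → (∀ y → g y ≈ g′ y) → Γ f g x ≈ Γ f′ g′ x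
  Γ-cong x p q = Γ-cong-nb x (p x) (λ y _ → p y) (q x) (λ y _ → q y)

  Γ₁-cong : ∀ x {f g : Fun} → (∀ y → f y ≈ g y) → Γ₁ f x ≈ Γ₁ g x
  Γ₁-cong x p = Γ-cong x p p

  Γ-comm : ∀ f g x → Γ f g x ≈ Γ g f x
  Γ-comm f g x = trans (Γ-mean f g x) (trans (*-congˡ (mean-cong x λ y → *-comm _ _)) (sym (Γ-mean g f x)))

  Γ-+ʳ : ∀ f g k x → Γ f (λ y → g y + k y) x ≈ Γ f g x + Γ f k x
  Γ-+ʳ f g k x = begin-equality
    Γ f (λ y → g y + k y) x
      ≈⟨ Γ-mean f _ x ⟩
    half * mean (λ y → (f y - f x) * (g y + k y - (g x + k x))) x
      ≈⟨ *-congˡ (mean-cong x λ y → (solve 6 (λ t₁ t₂ t₃ t₄ t₅ t₆ → (t₁ :- t₂) :* (t₃ :+ t₄ :- (t₅ :+ t₆))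
            := (t₁ :- t₂) :* (t₃ :- t₅) :+ (t₁ :- t₂) :* (t₄ :- t₆)) refl (f y) (f x) (g y) (k y) (g x) (k x))) ⟩
    half * mean (λ y → (f y - f x) * (g y - g x) + (f y - f x) * (k y - k x)) x
      ≈⟨ *-congˡ (mean-+ x _ _) ⟩
    half * (mean (λ y → (f y - f x) * (g y - g x)) x + mean (λ y → (f y - f x) * (k y - k x)) x)
      ≈⟨ distribˡ _ _ _ ⟩
    half * mean (λ y → (f y - f x) * (g y - g x)) x + half * mean (λ y → (f y - f x) * (k y - k x)) x
      ≈⟨ +-cong (Γ-mean f g x) (Γ-mean f k x) ⟨
    Γ f g x + Γ f k x ∎

  Γ-*ʳ : ∀ c f g x → Γ f (λ y → c * g y) x ≈ c * Γ f g x
  Γ-*ʳ c f g x = begin-equality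
    Γ f (λ y → c * g y) x
      ≈⟨ Γ-mean f _ x ⟩
    half * mean (λ y → (f y - f x) * (c * g y - c * g x)) x
      ≈⟨ *-congˡ (mean-cong x λ y → (solve 5 (λ t₁ t₂ c t₃ t₄ → (t₁ :- t₂) :* (c :* t₃ :- c :* t₄)
            := c :* ((t₁ :- t₂) :* (t₃ :- t₄))) refl (f y) (f x) c (g y) (g x))) ⟩
    half * mean (λ y → c * ((f y - f x) * (g y - g x))) x
      ≈⟨ *-congˡ (mean-*ˡ x c _) ⟩
    half * (c * mean (λ y → (f y - f x) * (g y - g x)) x)
      ≈⟨ solve 3 (λ half c t₁ → half :* (c :* t₁)
            := c :* (half :* t₁))
            refl half c (mean (λ y → (f y - f x) * (g y - g x)) x) ⟩
    c * (half * mean (λ y → (f y - f x) * (g y - g x)) x)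
      ≈⟨ *-congˡ (Γ-mean f g x) ⟨
    c * Γ f g x ∎

  Γ-+ˡ : ∀ f g k x → Γ (λ y → f y + g y) k x ≈ Γ f k x + Γ g k x
  Γ-+ˡ f g k x = trans (Γ-comm _ k x) (trans (Γ-+ʳ k f g x) (+-cong (Γ-comm k f x) (Γ-comm k g x)))

  Γ₁-+ : ∀ f g x → Γ₁ (λ y → f y + g y) x ≈ Γ₁ f x + 2# * Γ f g x + Γ₁ g x
  Γ₁-+ f g x = begin-equality
    Γ₁ (λ y → f y + g y) x                               ≈⟨ Γ-+ˡ f g _ x ⟩
    Γ f (λ y → f y + g y) x + Γ g (λ y → f y + g y) x    ≈⟨ +-cong (Γ-+ʳ f f g x) (Γ-+ʳ g f g x) ⟩
    Γ₁ f x + Γ f g x + (Γ g f x + Γ₁ g x)                ≈⟨ +-congˡ (+-congʳ (Γ-comm g f x)) ⟩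
    Γ₁ f x + Γ f g x + (Γ f g x + Γ₁ g x)                ≈⟨ solve 3 (λ t₁ t₂ t₃ → t₁ :+ t₂ :+ (t₂ :+ t₃)
          := t₁ :+ con (+ 2) :* t₂ :+ t₃) refl (Γ₁ f x) (Γ f g x) (Γ₁ g x) ⟩
    Γ₁ f x + 2# * Γ f g x + Γ₁ g x                       ∎

  Γ₁-nonNeg : ∀ f x → 0# ≤ Γ₁ f x
  Γ₁-nonNeg f x = ≤-resp refl (sym (Γ-mean f f x)) (*-nonNeg half-nonNeg (mean-nonNeg x λ y → square-nonNeg _))

  Γ-∣∣≤ : ∀ x {f g : Fun} {a b} → (∀ y → ∣ f y ∣≤ a) → (∀ y → ∣ g y ∣≤ b) → ∣ Γ f g x ∣≤ half * (D * ((a + a) * (b + b)))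
  Γ-∣∣≤ x {f} {g} p q = ∣∣≤-resp (sym (Γ-mean f g x)) (∣*∣≤ (nonNeg⇒∣∣≤ half-nonNeg ≤-refl)
    (mean-∣∣≤ x λ y → ∣*∣≤ (∣∸∣≤ (p y) (p x)) (∣∸∣≤ (q y) (q x))))

  Γ₁-⟶ : ∀ x {a : ℕ → Fun} {l : Fun} → (∀ y → (λ n → a n y) ⟶ l y) → (λ n → Γ₁ (a n) x) ⟶ Γ₁ l x
  Γ₁-⟶ x {a} {l} p = ⟶-cong (λ n → sym (Γ-mean (a n) (a n) x)) (sym (Γ-mean l l x))
    (⟶-*ˡ half (mean-⟶ x λ y → ⟶-* (⟶-- (p y) (p x)) (⟶-- (p y) (p x))))

  -- Uniform asymptotics

  module Asymptotics {I : Set} (h : I → Carrier) (0≤h : ∀ i → 0# ≤ h i) where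

    -- The constant is uniform over the vertices and over `I`. The index type is left open: it is a
    -- type of admissible steps and functions for the gradient bound, and `ℕ` for its converse.
    record O (k : ℕ) (F : I → Fun) : Set where
      constructor within
      field
        C     : Carrier
        0≤C   : 0# ≤ C
        ∣F∣≤ : ∀ i x → ∣ F i x ∣≤ C * h i ^ k

    O-cong : ∀ {k} {F F′ : I → Fun} → (∀ i x → F i x ≈ F′ i x) → O k F → O k F′
    O-cong e (within C p q) = within C p λ i x → ∣∣≤-resp (e i x) (q i x)

    O-bounded : ∀ {F : I → Fun} {c} → 0# ≤ c → (∀ i x → ∣ F i x ∣≤ c) → O 0 F
    O-bounded {c = c} p q = within c p λ i x → ∣∣≤-trans (q i x) (≤-reflexive (sym (*-identityʳ c)))

    O-0 : ∀ k {F : I → Fun} → (∀ i x → F i x ≈ 0#) → O k F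
    O-0 k e = within 0# ≤-refl λ i x → ∣∣≤-resp (sym (e i x)) (∣0∣≤ (≤-reflexive (sym (zeroˡ _))))

    O-h : O 1 (λ i x → h i)
    O-h = within 1# 0≤1 λ i x → nonNeg⇒∣∣≤ (0≤h i) (≤-reflexive (solve 1 (λ t₁ → t₁
          := con (+ 1) :* (t₁ :* con (+ 1))) refl (h i)))

    O-+ : ∀ {k} {F F′ : I → Fun} → O k F → O k F′ → O k (λ i x → F i x + F′ i x)
    O-+ (within C p q) (within C′ p′ q′) = within (C + C′) (+-nonNeg p p′) λ i x →
      ∣∣≤-trans (∣+∣≤ (q i x) (q′ i x)) (≤-reflexive (sym (distribʳ _ C C′)))

    O-neg : ∀ {k} {F : I → Fun} → O k F → O k (λ i x → - F i x)
    O-neg (within C p q) = within C p λ i x → ∣-∣≤ (q i x)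

    O-- : ∀ {k} {F F′ : I → Fun} → O k F → O k F′ → O k (λ i x → F i x - F′ i x)
    O-- p q = O-+ p (O-neg q)

    O-* : ∀ {j k} {F F′ : I → Fun} → O j F → O k F′ → O (j ℕ.+ k) (λ i x → F i x * F′ i x)
    O-* {j} {k} (within C p q) (within C′ p′ q′) = within (C * C′) (*-nonNeg p p′) λ i x →
      ∣∣≤-trans (∣*∣≤ (q i x) (q′ i x)) (≤-reflexive (trans
        (solve 4 (λ C t₁ C′ t₂ → C :* t₁ :* (C′ :* t₂)
           := C :* C′ :* (t₁ :* t₂))
           refl C (h i ^ j) C′ (h i ^ k)) (*-congˡ (sym (^-homo-* (h i) j k)))))

    O-const : ∀ c → O 0 (λ i x → c)
    O-const c = O-bounded (abs-nonNeg c) λ i x → ∣x∣≤abs c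

    O-*ˡ : ∀ {k} {F : I → Fun} c → O k F → O k (λ i x → c * F i x)
    O-*ˡ c p = O-* (O-const c) p

    O-Δ : ∀ {k} {F : I → Fun} → O k F → O k (λ i x → Δ (F i) x)
    O-Δ {k} (within C p q) = within (D * (C + C)) (*-nonNeg D-nonNeg (+-nonNeg p p)) λ i x →
      ∣∣≤-trans (Δ-∣∣≤ x (q i)) (≤-reflexive (solve 3 (λ D C t₁ → D :* (C :* t₁ :+ C :* t₁)
            := D :* (C :+ C) :* t₁) refl D C (h i ^ k)))

    O-Γ : ∀ {j k} {F F′ : I → Fun} → O j F → O k F′ → O (j ℕ.+ k) (λ i x → Γ (F i) (F′ i) x)
    O-Γ {j} {k} (within C p q) (within C′ p′ q′) =
      within (half * (D * ((C + C) * (C′ + C′)))) (*-nonNeg half-nonNeg (*-nonNeg D-nonNeg (*-nonNeg (+-nonNeg p p) (+-nonNeg p′ p′)))) λ i x →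
      ∣∣≤-trans (Γ-∣∣≤ x (q i) (q′ i)) (≤-reflexive (trans
        (solve 6 (λ half D C t₁ C′ t₂ → half :* (D :* ((C :* t₁ :+ C :* t₁) :* (C′ :* t₂ :+ C′ :* t₂)))
           := half :* (D :* ((C :+ C) :* (C′ :+ C′))) :* (t₁ :* t₂))
           refl half D C (h i ^ j) C′ (h i ^ k))
        (*-congˡ (sym (^-homo-* (h i) j k)))))

    -- Division by a factor bounded away from zero. The expansion of the square root uses its
    -- uniform lower bound through this lemma.
    O-cancel : ∀ {k} {F F′ : I → Fun} {δ} → 0# < δ → (∀ i x → δ ≤ F′ i x) → O k (λ i x → F i x * F′ i x) → O k F
    O-cancel {k} {F} {F′} {δ} 0<δ lb (within C p q) = within (C * δ ⁻¹) (*-nonNeg p (⁻¹-nonNeg 0<δ)) λ i x →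
      let B≥0 = *-nonNeg (*-nonNeg p (⁻¹-nonNeg 0<δ)) (^-nonNeg k (0≤h i))
          C≤B*F′ = begin
            C * h i ^ k                          ≈⟨ trans (sym (*-identityˡ _)) (*-congʳ (sym (⁻¹-inverseˡ 0<δ))) ⟩
            δ ⁻¹ * δ * (C * h i ^ k)             ≈⟨ solve 4 (λ t₁ δ C t₂ → t₁ :* δ :* (C :* t₂)
                  := C :* t₁ :* t₂ :* δ) refl (δ ⁻¹) δ C (h i ^ k) ⟩
            C * δ ⁻¹ * h i ^ k * δ               ≤⟨ *-monoˡ-≤ B≥0 (lb i x) ⟩
            C * δ ⁻¹ * h i ^ k * F′ i x          ∎
          0<F′ = <-≤-trans 0<δ (lb i x)
      in *-cancelʳ-≤ 0<F′ (≤-trans (upper (q i x)) C≤B*F′)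
       , *-cancelʳ-≤ 0<F′ (≤-trans (≤-resp (solve 2 (λ t₁ t₂ → :- (t₁ :* t₂)
             := :- t₁ :* t₂) refl (F i x) (F′ i x)) refl (lower (q i x))) C≤B*F′)

    -- First-order expansion of Γ(√u) when u = g² + h Δ(g²) + O(h²): with w = Δ(g²)/(2g) one has √u = g + h w + O(h²).
    module Expansion (g v : I → Fun) {δ : Carrier} (0<δ : 0# < δ) (δ≤g : ∀ i x → δ ≤ g i x) (g-bounded : O 0 g) (0≤v : ∀ i x → 0# ≤ v i x)
      (expansion : O 2 (λ i x → v i x * v i x - (g i x * g i x + h i * Δ (λ y → g i y ^ 2) x))) where

      w : I → Fun
      w i y = Δ (λ z → g i z ^ 2) y / (2# * g i y)

      0<2g : ∀ i x → 0# < 2# * g i x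
      0<2g i x = *-pos 0<2 (<-≤-trans 0<δ (δ≤g i x))

      w-spec : ∀ i x → w i x * (2# * g i x) ≈ Δ (λ z → g i z ^ 2) x
      w-spec i x = /-cancelʳ _ (pos⇒≉0 (0<2g i x))

      Δg²-bounded : O 0 (λ i → Δ (λ z → g i z ^ 2))
      Δg²-bounded = O-Δ (O-cong (λ i x → (solve 1 (λ t₁ → t₁ :* t₁ := t₁ :^ 2) refl (g i x))) (O-* g-bounded g-bounded))

      w-bounded : O 0 w
      w-bounded = O-cancel (*-pos 0<2 0<δ) (λ i x → *-monoˡ-≤ (<⇒≤ 0<2) (δ≤g i x)) (O-cong (λ i x → sym (w-spec i x)) Δg²-bounded)

      δ≤v+g : ∀ i x → δ ≤ v i x + g i x
      δ≤v+g i x = ≤-by (+-nonNeg (0≤v i x) (gap (δ≤g i x))) (solve 3 (λ t₁ t₂ δ → t₁ :+ t₂ :- δ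
            := t₁ :+ (t₂ :- δ)) refl (v i x) (g i x) δ)

      r a e : I → Fun
      r i x = v i x * v i x - (g i x * g i x + h i * Δ (λ y → g i y ^ 2) x)
      a i x = v i x - g i x
      e i x = a i x - h i * w i x

      w-terms : ∀ i x → h i * Δ (λ y → g i y ^ 2) x ≈ h i * w i x * (2# * g i x)
      w-terms i x = trans (*-congˡ (sym (w-spec i x))) (sym (*-assoc _ _ _))

      h≤1-drop : (∀ i → h i ≤ 1#) → ∀ {F : I → Fun} → O 2 F → O 1 F
      h≤1-drop h≤1 (within C p q) = within C p λ i x → ∣∣≤-trans (q i x) (*-monoˡ-≤ p
        (≤-by (*-nonNeg (0≤h i) (gap (h≤1 i))) (solve 1 (λ t₁ → t₁ :* con (+ 1) :- t₁ :* (t₁ :* con (+ 1))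
              := t₁ :* (con (+ 1) :- t₁)) refl (h i))))

      module _ (h≤1 : ∀ i → h i ≤ 1#) where

        -- (v - g)(v + g) = v² - g² is the remainder plus hΔ(g²), and v + g ≥ δ.
        a-small : O 1 a
        a-small = O-cancel 0<δ δ≤v+g (O-cong
          (λ i x → (solve 4 (λ t₁ t₂ t₃ t₄ → t₁ :* t₁ :- (t₂ :* t₂ :+ t₃ :* t₄) :+ t₃ :* t₄
                := (t₁ :- t₂) :* (t₁ :+ t₂)) refl (v i x) (g i x) (h i) (Δ (λ y → g i y ^ 2) x)))
          (O-+ (h≤1-drop h≤1 expansion) (O-* O-h Δg²-bounded)))

        -- Since hΔ(g²) = 2ghw, the product (v - g - hw)(v + g) equals the remainder minus hw(v -
        -- g), and `a-small` gives the latter its second power of h.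
        e-small : O 2 e
        e-small = O-cancel 0<δ δ≤v+g (O-cong
          (λ i x → trans (+-congʳ (+-congˡ (-‿cong (+-congˡ (w-terms i x)))))
            (solve 4 (λ t₁ t₂ t₃ t₄ → t₁ :* t₁ :- (t₂ :* t₂ :+ t₃ :* t₄ :* (con (+ 2) :* t₂)) :- t₃ :* t₄ :* (t₁ :- t₂)
               := (t₁ :- t₂ :- t₃ :* t₄) :* (t₁ :+ t₂))
               refl (v i x) (g i x) (h i) (w i x)))
          (O-- expansion (O-* (O-* O-h w-bounded) a-small)))

        -- With v = g + a and a = hw + e, only 2Γ(g,e) and Γ(a) are left over: the first is small by
        -- `e`, the second is quadratic in `a`.
        Γ₁-expansion : O 2 (λ i x → Γ₁ (v i) x - (Γ₁ (g i) x + 2# * h i * Γ (g i) (w i) x))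
        Γ₁-expansion = O-cong (λ i x → sym (expand i x)) (O-+ (O-*ˡ 2# (O-Γ g-bounded e-small)) (O-Γ a-small a-small))
          where
          expand : ∀ i x → Γ₁ (v i) x - (Γ₁ (g i) x + 2# * h i * Γ (g i) (w i) x) ≈ 2# * Γ (g i) (e i) x + Γ (a i) (a i) x
          expand i x = begin-equality
            Γ₁ (v i) x - (Γ₁ (g i) x + 2# * h i * Γ (g i) (w i) x)
              ≈⟨ +-congʳ (trans (Γ₁-cong x (λ y → (solve 2 (λ t₁ t₂ → t₁
                    := t₂ :+ (t₁ :- t₂)) refl (v i y) (g i y)))) (Γ₁-+ (g i) (a i) x)) ⟩
            Γ₁ (g i) x + 2# * Γ (g i) (a i) x + Γ₁ (a i) x - (Γ₁ (g i) x + 2# * h i * Γ (g i) (w i) x)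
              ≈⟨ +-congʳ (+-congʳ (+-congˡ (*-congˡ Γga))) ⟩
            Γ₁ (g i) x + 2# * (h i * Γ (g i) (w i) x + Γ (g i) (e i) x) + Γ₁ (a i) x - (Γ₁ (g i) x + 2# * h i * Γ (g i) (w i) x)
              ≈⟨ solve 5 (λ t₁ t₂ t₃ t₄ t₅ → t₁ :+ con (+ 2) :* (t₂ :* t₃ :+ t₄) :+ t₅ :- (t₁ :+ con (+ 2) :* t₂ :* t₃)
                    := con (+ 2) :* t₄ :+ t₅)
                    refl (Γ₁ (g i) x) (h i) (Γ (g i) (w i) x) (Γ (g i) (e i) x) (Γ₁ (a i) x) ⟩
            2# * Γ (g i) (e i) x + Γ (a i) (a i) x ∎
            where
            Γga : Γ (g i) (a i) x ≈ h i * Γ (g i) (w i) x + Γ (g i) (e i) x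
            Γga = begin-equality
              Γ (g i) (a i) x
                ≈⟨ Γ-cong x (λ y → refl) (λ y → (solve 3 (λ t₁ t₂ t₃ → t₁
                      := t₂ :* t₃ :+ (t₁ :- t₂ :* t₃)) refl (a i y) (h i) (w i y))) ⟩
              Γ (g i) (λ y → h i * w i y + e i y) x
                ≈⟨ Γ-+ʳ (g i) _ _ x ⟩
              Γ (g i) (λ y → h i * w i y) x + Γ (g i) (e i) x
                ≈⟨ +-congʳ (Γ-*ʳ (h i) (g i) (w i) x) ⟩
              h i * Γ (g i) (w i) x + Γ (g i) (e i) x ∎

-- Unconditional sums; the Euler scheme and its killed version

module EulerScheme (lem : ExcludedMiddle 0ℓ) (ℛ : Reals) (G : Analysis.WeightedGraph lem ℛ) where

  open GraphCalculus lem ℛ G public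

  -- Unconditional sums

  module _ {A : Set} where

    union : FinSet A → FinSet A → FinSet A
    union S T = record
      { elements = deduplicate _≟_ (elements S ++ elements T)
      ; unique   = DecUnique.deduplicate-! _≟_ (elements S ++ elements T)
      }
      where
      _≟_ : (x y : A) → Dec (x ≡ y)
      x ≟ y = lem

    HasSum-unique : ∀ {g : A → Carrier} {s s′} → HasSum g s → HasSum g s′ → s ≈ s′
    HasSum-unique {g} {s} {s′} p q = antisym (≤-from-ε (bound p q)) (≤-from-ε (bound q p))
      where
      bound : ∀ {s s′} → HasSum g s → HasSum g s′ → ∀ ε → 0# < ε → s ≤ s′ + ε
      bound {s} {s′} p q ε 0<ε =
        let S , p′ = p (half * ε) (half-pos 0<ε)
            T , q′ = q (half * ε) (half-pos 0<ε)
            R      = union S T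
            r₁     = p′ R λ x∈ → ∈-deduplicate⁺ (λ _ _ → lem) (∈-++⁺ˡ x∈)
            r₂     = q′ R λ x∈ → ∈-deduplicate⁺ (λ _ _ → lem) (∈-++⁺ʳ (elements S) x∈)
            σ      = ∑[ elements R ] g
        in ≤-by (+-nonNeg (gap (<⇒≤ (proj₂ r₁))) (gap (<⇒≤ (proj₁ r₂))))
             (trans (+-congʳ (+-congˡ (sym (halves ε)))) (solve 5 (λ s′ half ε s σ → s′ :+ (half :* ε :+ half :* ε) :- s
                   := half :* ε :- (s :- σ) :+ (half :* ε :- (σ :- s′))) refl s′ half ε s σ))

    ∑-≈ : ∀ {g : A → Carrier} {s} → HasSum g s → ∑ g ≈ s
    ∑-≈ {g} {s} p = HasSum-unique (spec) p
      where
      spec : HasSum g (∑ g)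
      spec with lem {∃ λ s → HasSum g s}
      ... | yes (_ , q) = q
      ... | no ¬q       = ⊥-elim (¬q (s , p))

  -- The explicit Euler scheme for ∂ₜ u = Δ u

  Q : Carrier → Fun → Fun
  Q h f x = f x + h * Δ f x

  Qⁿ : ℕ → Carrier → Fun → Fun
  Qⁿ zero    h f = f
  Qⁿ (suc n) h f = Q h (Qⁿ n h f)

  Q-cong : ∀ h {f g : Fun} → (∀ y → f y ≈ g y) → ∀ x → Q h f x ≈ Q h g x
  Q-cong h e x = +-cong (e x) (*-congˡ (Δ-cong x e))

  Q-+ : ∀ h (f g : Fun) x → Q h (λ y → f y + g y) x ≈ Q h f x + Q h g x
  Q-+ h f g x = trans (+-congˡ (*-congˡ (Δ-+ x f g))) (solve 5 (λ t₁ t₂ h t₃ t₄ → t₁ :+ t₂ :+ h :* (t₃ :+ t₄)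
        := t₁ :+ h :* t₃ :+ (t₂ :+ h :* t₄)) refl (f x) (g x) h (Δ f x) (Δ g x))

  Q-- : ∀ h (f g : Fun) x → Q h (λ y → f y - g y) x ≈ Q h f x - Q h g x
  Q-- h f g x = trans (+-congˡ (*-congˡ (Δ-- x f g))) (solve 5 (λ t₁ t₂ h t₃ t₄ → t₁ :- t₂ :+ h :* (t₃ :- t₄)
        := t₁ :+ h :* t₃ :- (t₂ :+ h :* t₄)) refl (f x) (g x) h (Δ f x) (Δ g x))

  Q-*ˡ : ∀ h c (f : Fun) x → Q h (λ y → c * f y) x ≈ c * Q h f x
  Q-*ˡ h c f x = trans (+-congˡ (*-congˡ (Δ-*ˡ x c f))) (solve 4 (λ c t₁ h t₂ → c :* t₁ :+ h :* (c :* t₂)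
        := c :* (t₁ :+ h :* t₂)) refl c (f x) h (Δ f x))

  Q-const : ∀ h c x → Q h (λ _ → c) x ≈ c
  Q-const h c x = trans (+-congˡ (trans (*-congˡ (Δ-const x c)) (zeroʳ h))) (+-identityʳ c)

  Qⁿ-cong : ∀ n h {f g : Fun} → (∀ y → f y ≈ g y) → ∀ x → Qⁿ n h f x ≈ Qⁿ n h g x
  Qⁿ-cong zero    h e = e
  Qⁿ-cong (suc n) h e = Q-cong h (Qⁿ-cong n h e)

  Qⁿ-+ : ∀ n h (f g : Fun) x → Qⁿ n h (λ y → f y + g y) x ≈ Qⁿ n h f x + Qⁿ n h g x
  Qⁿ-+ zero    h f g x = refl
  Qⁿ-+ (suc n) h f g x = trans (Q-cong h (Qⁿ-+ n h f g) x) (Q-+ h _ _ x)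

  Qⁿ-const : ∀ n h c x → Qⁿ n h (λ _ → c) x ≈ c
  Qⁿ-const zero    h c x = refl
  Qⁿ-const (suc n) h c x = trans (Q-cong h (Qⁿ-const n h c) x) (Q-const h c x)

  if-elim : ∀ {A : Set} (R : Carrier → Set) (d : Dec A) {x y} → (A → R x) → (¬ A → R y) → R (if does d then x else y)
  if-elim R (yes p) r s = r p
  if-elim R (no ¬p) r s = s ¬p

  extend-elim : ∀ (R : Carrier → Set) U (f : Fun) x → (IsInterior U x → R (f x)) → (¬ IsInterior U x → R 0#) → R (extend U f x)
  extend-elim R U f x = if-elim R lem

  extend-in : ∀ U (f : Fun) {x} → IsInterior U x → extend U f x ≈ f x
  extend-in U f {x} p = extend-elim (_≈ f x) U f x (λ _ → refl) (λ ¬p → ⊥-elim (¬p p))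

  extend-out : ∀ U (f : Fun) {x} → ¬ IsInterior U x → extend U f x ≈ 0#
  extend-out U f {x} ¬p = extend-elim (_≈ 0#) U f x (λ p → ⊥-elim (¬p p)) (λ _ → refl)

  extend-nonNeg : ∀ U (f : Fun) x → 0# ≤ f x → 0# ≤ extend U f x
  extend-nonNeg U f x p = extend-elim (0# ≤_) U f x (λ _ → p) (λ _ → ≤-refl)

  extend-≤ : ∀ U (f : Fun) {c} x → f x ≤ c → 0# ≤ c → extend U f x ≤ c
  extend-≤ U f {c} x p q = extend-elim (_≤ c) U f x (λ _ → p) (λ _ → q)

  extend-mono : ∀ U U′ (f g : Fun) x → (IsInterior U x → IsInterior U′ x) → f x ≤ g x → 0# ≤ g x → extend U f x ≤ extend U′ g x
  extend-mono U U′ f g x i p q = extend-elim (_≤ extend U′ g x) U f x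
    (λ j → ≤-trans p (≤-reflexive (sym (extend-in U′ g (i j))))) (λ _ → extend-nonNeg U′ g x q)

  -- The Euler scheme killed outside the interior of U.
  Kⁿ : FinSet V → ℕ → Carrier → Fun → Fun
  Kⁿ U zero    h f = extend U f
  Kⁿ U (suc n) h f = extend U (Q h (Kⁿ U n h f))

  Kⁿ-out : ∀ U n h (f : Fun) {x} → ¬ IsInterior U x → Kⁿ U n h f x ≈ 0#
  Kⁿ-out U zero    h f = extend-out U f
  Kⁿ-out U (suc n) h f = extend-out U (Q h (Kⁿ U n h f))

  module Markov {h : Carrier} (0≤h : 0# ≤ h) (hD≤1 : h * D ≤ 1#) where

    -- `Q h f x` puts the weight 1 - h deg(x) on `f x`, nonnegative because hD ≤ 1, and nonnegative
    -- weights on the neighbours.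
    Q-nonNeg : ∀ {f : Fun} → (∀ y → 0# ≤ f y) → ∀ x → 0# ≤ Q h f x
    Q-nonNeg {f} p x = ≤-resp refl (sym form) (+-nonNeg (*-nonNeg stay (p x)) (*-nonNeg 0≤h (mean-nonNeg x p)))
      where
      stay : 0# ≤ 1# - h * degree x
      stay = gap (≤-trans (*-monoˡ-≤ 0≤h (degree≤D x)) hD≤1)
      form : Q h f x ≈ (1# - h * degree x) * f x + h * mean f x
      form = trans (+-congˡ (*-congˡ (Δ-mean f x))) (solve 4 (λ t₁ h t₂ t₃ → t₁ :+ h :* (t₂ :- t₃ :* t₁)
            := (con (+ 1) :- h :* t₃) :* t₁ :+ h :* t₂) refl (f x) h (mean f x) (degree x))

    Q-mono : ∀ {f g : Fun} → (∀ y → f y ≤ g y) → ∀ x → Q h f x ≤ Q h g x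
    Q-mono {f} {g} p x = ≤-by (Q-nonNeg (λ y → gap (p y)) x) (sym (Q-- h g f x))

    Qⁿ-mono : ∀ n {f g : Fun} → (∀ y → f y ≤ g y) → ∀ x → Qⁿ n h f x ≤ Qⁿ n h g x
    Qⁿ-mono zero    p = p
    Qⁿ-mono (suc n) p = Q-mono (Qⁿ-mono n p)

    Qⁿ-≤ : ∀ n {f : Fun} {c} → (∀ y → f y ≤ c) → ∀ x → Qⁿ n h f x ≤ c
    Qⁿ-≤ n p x = ≤-trans (Qⁿ-mono n p x) (≤-reflexive (Qⁿ-const n h _ x))

    Qⁿ-≥ : ∀ n {f : Fun} {c} → (∀ y → c ≤ f y) → ∀ x → c ≤ Qⁿ n h f x
    Qⁿ-≥ n p x = ≤-trans (≤-reflexive (sym (Qⁿ-const n h _ x))) (Qⁿ-mono n p x)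

    Qⁿ-∣∣≤ : ∀ n {f : Fun} {c} → (∀ y → ∣ f y ∣≤ c) → ∀ x → ∣ Qⁿ n h f x ∣≤ c
    Qⁿ-∣∣≤ n {f} {c} p x = Qⁿ-≤ n (λ y → upper (p y)) x
      , ≤-by (gap (Qⁿ-≥ n { f } { - c} (λ y → ≤-by (gap (lower (p y))) (solve 2 (λ t₁ c → t₁ :- :- c := c :- :- t₁) refl (f y) c)) x)) (solve 2 (λ c t₁ → c :- :- t₁ := t₁ :- :- c) refl c (Qⁿ n h f x))

    Qⁿ-zeroth : ∀ n {f : Fun} {c} → (∀ y → ∣ Δ f y ∣≤ c) → ∀ x → ∣ Qⁿ n h f x - f x ∣≤ ι n * h * c
    Qⁿ-zeroth zero    {f} {c} p x = ∣∣≤-resp (sym (-‿inverseʳ (f x))) (∣0∣≤ (≤-reflexive (solve 2 (λ h c → con (+ 0)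
          := con (+ 0) :* h :* c) refl h c)))
    Qⁿ-zeroth (suc n) {f} {c} p x = ∣∣≤-trans (∣∣≤-resp (begin-equality
        Q h (λ y → Qⁿ n h f y - f y) x + h * Δ f x       ≈⟨ +-congʳ (Q-- h _ f x) ⟩
        Q h (Qⁿ n h f) x - Q h f x + h * Δ f x           ≈⟨ solve 4 (λ t₁ t₂ h t₃ → t₁ :- (t₂ :+ h :* t₃) :+ h :* t₃
              := t₁ :- t₂) refl (Q h (Qⁿ n h f) x) (f x) h (Δ f x) ⟩
        Qⁿ (suc n) h f x - f x                           ∎)
      (∣+∣≤ (Qⁿ-∣∣≤ 1 (Qⁿ-zeroth n p) x) (∣*∣≤ (nonNeg⇒∣∣≤ 0≤h ≤-refl) (p x))))
      (≤-reflexive (solve 3 (λ t₁ h c → t₁ :* h :* c :+ h :* c := (con (+ 1) :+ t₁) :* h :* c) refl (ι n) h c))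

    -- One more step adds h · nh · Δ(Δf) to the defect, and `Q` contracts the sup norm, used below
    -- as `Qⁿ-∣∣≤ 1`. The induction closes because (nh)² + nh² ≤ ((n+1)h)².
    Qⁿ-first : ∀ n {f : Fun} {c} → (∀ y → ∣ Δ (Δ f) y ∣≤ c) → ∀ x → ∣ Qⁿ n h f x - (f x + ι n * h * Δ f x) ∣≤ ι n * h * (ι n * h) * c
    Qⁿ-first zero    {f} {c} p x = ∣∣≤-resp (solve 3 (λ t₁ h t₂ → con (+ 0) := t₁ :- (t₁ :+ con (+ 0) :* h :* t₂)) refl (f x) h (Δ f x)) (∣0∣≤ (≤-reflexive (solve 2 (λ h c → con (+ 0) := con (+ 0) :* h :* (con (+ 0) :* h) :* c) refl h c)))
    Qⁿ-first (suc n) {f} {c} p x = ∣∣≤-trans (∣∣≤-resp eq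
      (∣+∣≤ (Qⁿ-∣∣≤ 1 (Qⁿ-first n p) x) (∣*∣≤ (nonNeg⇒∣∣≤ (*-nonNeg 0≤h (*-nonNeg (ι-nonNeg n) 0≤h)) ≤-refl) (p x))))
      (≤-by (*-nonNeg (*-nonNeg (*-nonNeg 0≤h 0≤h) (+-nonNeg 0≤1 (ι-nonNeg n))) (∣∣≤-nonNeg (p x)))
        (solve 3 (λ t₁ h c → (con (+ 1) :+ t₁) :* h :* ((con (+ 1) :+ t₁) :* h) :* c :- (t₁ :* h :* (t₁ :* h) :* c :+ h :* (t₁ :* h) :* c)
           := h :* h :* (con (+ 1) :+ t₁) :* c)
           refl (ι n) h c))
      where
      s : Carrier
      s = ι n * h
      eq : Q h (λ y → Qⁿ n h f y - (f y + s * Δ f y)) x + h * s * Δ (Δ f) x ≈ Qⁿ (suc n) h f x - (f x + ι (suc n) * h * Δ f x)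
      eq = begin-equality
        Q h (λ y → Qⁿ n h f y - (f y + s * Δ f y)) x + h * s * Δ (Δ f) x
          ≈⟨ +-congʳ (Q-- h _ _ x) ⟩
        Q h (Qⁿ n h f) x - Q h (λ y → f y + s * Δ f y) x + h * s * Δ (Δ f) x
          ≈⟨ +-congʳ (+-congˡ (-‿cong (trans (Q-+ h f _ x) (+-congˡ (Q-*ˡ h s (Δ f) x))))) ⟩
        Q h (Qⁿ n h f) x - (Q h f x + s * Q h (Δ f) x) + h * s * Δ (Δ f) x
          ≈⟨ solve 6 (λ t₁ t₂ h t₃ s t₄ → t₁ :- (t₂ :+ h :* t₃ :+ s :* (t₃ :+ h :* t₄)) :+ h :* s :* t₄
                := t₁ :- (t₂ :+ (h :+ s) :* t₃))
                refl (Q h (Qⁿ n h f) x) (f x) h (Δ f x) s (Δ (Δ f) x) ⟩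
        Q h (Qⁿ n h f) x - (f x + (h + s) * Δ f x)
          ≈⟨ +-congˡ (-‿cong (+-congˡ (*-congʳ (solve 2 (λ h t₁ → h :+ t₁ :* h := (con (+ 1) :+ t₁) :* h) refl h (ι n))))) ⟩
        Qⁿ (suc n) h f x - (f x + ι (suc n) * h * Δ f x) ∎

    Kⁿ-nonNeg : ∀ U n {f : Fun} → (∀ y → 0# ≤ f y) → ∀ x → 0# ≤ Kⁿ U n h f x
    Kⁿ-nonNeg U zero    {f} p x = extend-nonNeg U f x (p x)
    Kⁿ-nonNeg U (suc n) {f} p x = extend-nonNeg U (Q h (Kⁿ U n h f)) x (Q-nonNeg (Kⁿ-nonNeg U n p) x)

    Kⁿ-mono : ∀ U U′ n {f : Fun} → (∀ y → IsInterior U y → IsInterior U′ y) → (∀ y → 0# ≤ f y) → ∀ x → Kⁿ U n h f x ≤ Kⁿ U′ n h f x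
    Kⁿ-mono U U′ zero    {f} i p x = extend-mono U U′ f f x (i x) ≤-refl (p x)
    Kⁿ-mono U U′ (suc n) {f} i p x = extend-mono U U′ (Q h (Kⁿ U n h f)) (Q h (Kⁿ U′ n h f)) x (i x) (Q-mono (Kⁿ-mono U U′ n i p) x) (Q-nonNeg (Kⁿ-nonNeg U′ n p) x)

    Kⁿ≤Qⁿ : ∀ U n {f : Fun} → (∀ y → 0# ≤ f y) → ∀ x → Kⁿ U n h f x ≤ Qⁿ n h f x
    Kⁿ≤Qⁿ U zero    {f} p x = extend-≤ U f x ≤-refl (p x)
    Kⁿ≤Qⁿ U (suc n) {f} p x = extend-≤ U (Q h (Kⁿ U n h f)) x (Q-mono (Kⁿ≤Qⁿ U n p) x) (Q-nonNeg (Qⁿ-≥ n p) x)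

    -- W is a barrier: it is at least c where the chain is killed, and Q h multiplies it by at most 1 + h D.
    exit-bound : ∀ U {W : Fun} {c M} → 0# ≤ c → (∀ y → ¬ IsInterior U y → c ≤ W y) → (∀ y → 0# ≤ W y) → (∀ y → Δ W y ≤ D * W y) →
                 ∀ n {f : Fun} → (∀ y → 0# ≤ f y) → (∀ y → f y ≤ M) → 0# ≤ M →
                 ∀ x → c * (Qⁿ n h f x - Kⁿ U n h f x) ≤ M * (1# + D * h) ^ n * W x
    exit-bound U {W} {c} {M} 0≤c out 0≤W ΔW≤DW n {f} 0≤f f≤M 0≤M = go n
      where
      κ : ℕ → Carrier
      κ n = M * (1# + D * h) ^ n
      1≤[1+Dh]^ : ∀ n → 1# ≤ (1# + D * h) ^ n
      1≤[1+Dh]^ n = 1≤^ n (≤-by (*-nonNeg D-nonNeg 0≤h) (solve 2 (λ D h → con (+ 1) :+ D :* h :- con (+ 1)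
            := D :* h) refl D h))
      0≤κ : ∀ n → 0# ≤ κ n
      0≤κ n = *-nonNeg 0≤M (≤-trans 0≤1 (1≤[1+Dh]^ n))
      -- Off the interior the killed scheme is zero, so `W` alone has to pay for the whole value of
      -- `Qⁿ`.
      outside : ∀ n x → ¬ IsInterior U x → c * (Qⁿ n h f x - 0#) ≤ κ n * W x
      outside n x i = begin
        c * (Qⁿ n h f x - 0#)   ≈⟨ solve 2 (λ c t₁ → c :* (t₁ :- con (+ 0)) := t₁ :* c) refl c (Qⁿ n h f x) ⟩
        Qⁿ n h f x * c          ≤⟨ *-mono-≤ (Qⁿ-≥ n 0≤f x) (0≤W x) (Qⁿ-≤ n f≤M x) (out x i) ⟩
        M * W x                 ≈⟨ *-congʳ (*-identityʳ M) ⟨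
        M * 1# * W x            ≤⟨ *-monoʳ-≤ (0≤W x) (*-monoˡ-≤ 0≤M (1≤[1+Dh]^ n)) ⟩
        κ n * W x               ∎
      go : ∀ n x → c * (Qⁿ n h f x - Kⁿ U n h f x) ≤ κ n * W x
      go zero    x = extend-elim (λ z → c * (f x - z) ≤ κ 0 * W x) U f x
        (λ _ → ≤-trans (≤-reflexive (solve 2 (λ c t₁ → c :* (t₁ :- t₁)
              := con (+ 0)) refl c (f x))) (*-nonNeg (0≤κ 0) (0≤W x))) (outside 0 x)
      go (suc n) x = extend-elim (λ z → c * (Qⁿ (suc n) h f x - z) ≤ κ (suc n) * W x) U (Q h (Kⁿ U n h f)) x
        (λ _ → begin
          c * (Q h (Qⁿ n h f) x - Q h (Kⁿ U n h f) x)     ≈⟨ *-congˡ (Q-- h _ _ x) ⟨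
          c * Q h (λ y → Qⁿ n h f y - Kⁿ U n h f y) x     ≈⟨ Q-*ˡ h c _ x ⟨
          Q h (λ y → c * (Qⁿ n h f y - Kⁿ U n h f y)) x   ≤⟨ Q-mono (go n) x ⟩
          Q h (λ y → κ n * W y) x                         ≈⟨ Q-*ˡ h (κ n) W x ⟩
          κ n * (W x + h * Δ W x)                         ≤⟨ *-monoˡ-≤ (0≤κ n) (+-monoʳ-≤ (W x) (*-monoˡ-≤ 0≤h (ΔW≤DW x))) ⟩
          κ n * (W x + h * (D * W x))                     ≈⟨ solve 5 (λ M t₁ t₂ h D → M :* t₁ :* (t₂ :+ h :* (D :* t₂))
                := M :* ((con (+ 1) :+ D :* h) :* t₁) :* t₂) refl M ((1# + D * h) ^ n) (W x) h D ⟩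
          κ (suc n) * W x                                 ∎)
        (outside (suc n) x)

-- The Dirichlet kernel as a limit of killed schemes

module SpectralExpansion (lem : ExcludedMiddle 0ℓ) (ℛ : Reals) (G : Analysis.WeightedGraph lem ℛ) where

  open EulerScheme lem ℛ G public

  interiorSet : FinSet V → FinSet V
  interiorSet U = record
    { elements = interior U
    ; unique   = Unique.filter⁺ (λ x → lem {IsInterior U x}) (unique U)
    }

  ∈interior⁺ : ∀ U {x} → IsInterior U x → x ∈ interior U
  ∈interior⁺ U i = ∈-filter⁺ (λ x → lem {IsInterior U x}) (proj₁ i) i

  ∈interior⁻ : ∀ U {x} → x ∈ interior U → IsInterior U x
  ∈interior⁻ U x∈ = proj₂ (∈-filter⁻ (λ x → lem {IsInterior U x}) {xs = elements U} x∈)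

  Δ-∑ : ∀ {A : Set} (is : List A) (c : A → Carrier) (F : A → Fun) x →
        Δ (λ z → ∑[ is ] (λ i → c i * F i z)) x ≈ ∑[ is ] (λ i → c i * Δ (F i) x)
  Δ-∑ []       c F x = Δ-const x 0#
  Δ-∑ (i ∷ is) c F x = trans (Δ-+ x (λ z → c i * F i z) _) (+-cong (Δ-*ˡ x (c i) (F i)) (Δ-∑ is c F x))

  δ[_] : V → Fun
  δ[ y ] z = if does (lem {z ≡ y}) then 1# else 0#

  δ-same : ∀ y → δ[ y ] y ≈ 1#
  δ-same y = if-elim (_≈ 1#) (lem {y ≡ y}) (λ _ → refl) (λ ¬p → ⊥-elim (¬p ≡.refl))

  δ-other : ∀ y z → ¬ z ≡ y → δ[ y ] z ≈ 0#
  δ-other y z ¬p = if-elim (_≈ 0#) (lem {z ≡ y}) (λ p → ⊥-elim (¬p p)) (λ _ → refl)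

  δ-nonNeg : ∀ y z → 0# ≤ δ[ y ] z
  δ-nonNeg y z = if-elim (0# ≤_) (lem {z ≡ y}) (λ _ → 0≤1) (λ _ → ≤-refl)

  δ≤1 : ∀ y z → δ[ y ] z ≤ 1#
  δ≤1 y z = if-elim (_≤ 1#) (lem {z ≡ y}) (λ _ → ≤-refl) (λ _ → 0≤1)

  module Spectral (U : FinSet V) (B : Eigenbasis U) where

    open Eigenbasis B

    is : List (Fin dim)
    is = allFin dim

    φ̂ : Fin dim → Fun
    φ̂ i = extend U (φ i)

    coefficient : Fun → Fin dim → Carrier
    coefficient f i = ⟨ f , φ i ⟩[ U ]

    -- `spanning` only asserts that some coefficients exist; orthonormality forces them to be the
    -- inner products.
    coefficient-≈ : ∀ f (c : Fin dim → Carrier) → (∀ x → IsInterior U x → f x ≈ ∑[ is ] (λ i → c i * φ i x)) → ∀ j → coefficient f j ≈ c j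
    coefficient-≈ f c e j = begin-equality
      ∑[ interior U ] (λ y → μ y * f y * φ j y)
        ≈⟨ ∑-cong-∈ (interior U) (λ y y∈ → trans (*-congʳ (*-congˡ (e y (∈interior⁻ U y∈)))) (spread y)) ⟩
      ∑[ interior U ] (λ y → ∑[ is ] (λ i → c i * (μ y * φ i y * φ j y)))
        ≈⟨ ∑-swap (interior U) is _ ⟩
      ∑[ is ] (λ i → ∑[ interior U ] (λ y → c i * (μ y * φ i y * φ j y)))
        ≈⟨ ∑-cong is (λ i → ∑-*ˡ (c i) (interior U) _) ⟩
      ∑[ is ] (λ i → c i * ⟨ φ i , φ j ⟩[ U ])
        ≈⟨ ∑-single (Unique.allFin⁺ dim) (∈-allFin j) (λ i _ i≢j → trans (*-congˡ (orthogonal i j i≢j)) (zeroʳ _)) ⟩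
      c j * ⟨ φ j , φ j ⟩[ U ]
        ≈⟨ trans (*-congˡ (normal j)) (*-identityʳ _) ⟩
      c j ∎
      where
      spread : ∀ y → μ y * ∑[ is ] (λ i → c i * φ i y) * φ j y ≈ ∑[ is ] (λ i → c i * (μ y * φ i y * φ j y))
      spread y = begin-equality
        μ y * ∑[ is ] (λ i → c i * φ i y) * φ j y      ≈⟨ solve 3 (λ t₁ t₂ t₃ → t₁ :* t₂ :* t₃
              := t₁ :* t₃ :* t₂) refl (μ y) (∑[ is ] (λ i → c i * φ i y)) (φ j y) ⟩
        μ y * φ j y * ∑[ is ] (λ i → c i * φ i y)      ≈⟨ ∑-*ˡ _ is _ ⟨
        ∑[ is ] (λ i → μ y * φ j y * (c i * φ i y))    ≈⟨ ∑-cong is (λ i → (solve 4 (λ t₁ t₂ t₃ t₄ → t₁ :* t₂ :* (t₃ :* t₄)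
              := t₃ :* (t₁ :* t₄ :* t₂)) refl (μ y) (φ j y) (c i) (φ i y))) ⟩
        ∑[ is ] (λ i → c i * (μ y * φ i y * φ j y))    ∎

    expansion : ∀ f x → IsInterior U x → f x ≈ ∑[ is ] (λ i → coefficient f i * φ i x)
    expansion f x p = trans (e x p) (∑-cong is λ i → *-congʳ (sym (coefficient-≈ f c e i)))
      where
      c : Fin dim → Carrier
      c = proj₁ (spanning f)
      e : ∀ x → IsInterior U x → f x ≈ ∑[ is ] (λ i → c i * φ i x)
      e x p = trans (proj₂ (spanning f) x p) (sum≈∑ dim _)

    -- A killed step multiplies the i-th coefficient by 1 - λh. The eigenvalue equation holds only
    -- at interior points; elsewhere both sides vanish by extension.
    Kⁿ-spectral : ∀ n h f x → Kⁿ U n h f x ≈ ∑[ is ] (λ i → coefficient f i * (1# + - eigenvalue i * h) ^ n * φ̂ i x)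
    Kⁿ-spectral n h f x = by-cases n (lem {IsInterior U x})
      where
      c : ℕ → Fin dim → Carrier
      c n i = coefficient f i * (1# + - eigenvalue i * h) ^ n
      outside : ∀ n → ¬ IsInterior U x → Kⁿ U n h f x ≈ ∑[ is ] (λ i → c n i * φ̂ i x)
      outside n p = trans (Kⁿ-out U n h f p) (sym (∑-zero is λ i _ → trans (*-congˡ (extend-out U (φ i) p)) (zeroʳ _)))
      by-cases : ∀ n → Dec (IsInterior U x) → Kⁿ U n h f x ≈ ∑[ is ] (λ i → c n i * φ̂ i x)
      by-cases n       (no p)  = outside n p
      by-cases zero    (yes p) = trans (extend-in U f p) (trans (expansion f x p)
        (∑-cong is λ i → *-cong (sym (*-identityʳ _)) (sym (extend-in U (φ i) p))))
      by-cases (suc n) (yes p) = begin-equality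
        extend U (Q h (Kⁿ U n h f)) x
          ≈⟨ extend-in U (Q h (Kⁿ U n h f)) p ⟩
        Q h (Kⁿ U n h f) x
          ≈⟨ Q-cong h (Kⁿ-spectral n h f) x ⟩
        ∑[ is ] (λ i → c n i * φ̂ i x) + h * Δ (λ z → ∑[ is ] (λ i → c n i * φ̂ i z)) x
          ≈⟨ +-congˡ (trans (*-congˡ (Δ-∑ is (c n) φ̂ x)) (sym (∑-*ˡ h is _))) ⟩
        ∑[ is ] (λ i → c n i * φ̂ i x) + ∑[ is ] (λ i → h * (c n i * Δ (φ̂ i) x))
          ≈⟨ ∑-+ is _ _ ⟨
        ∑[ is ] (λ i → c n i * φ̂ i x + h * (c n i * Δ (φ̂ i) x))
          ≈⟨ ∑-cong is term ⟩
        ∑[ is ] (λ i → c (suc n) i * φ̂ i x) ∎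
        where
        Δφ̂ : ∀ i → Δ (φ̂ i) x ≈ - eigenvalue i * φ̂ i x
        Δφ̂ i = trans (solve 1 (λ t₁ → t₁ := :- (:- t₁)) refl (Δ (φ̂ i) x)) (trans (-‿cong (eigen i x p))
          (trans (solve 2 (λ t₁ t₂ → :- (t₁ :* t₂)
                := :- t₁ :* t₂) refl (eigenvalue i) (φ i x)) (*-congˡ (sym (extend-in U (φ i) p)))))
        term : ∀ i → c n i * φ̂ i x + h * (c n i * Δ (φ̂ i) x) ≈ c (suc n) i * φ̂ i x
        term i = trans (+-congˡ (*-congˡ (*-congˡ (Δφ̂ i))))
          (solve 5 (λ t₁ t₂ t₃ h t₄ → t₁ :* t₂ :* t₃ :+ h :* (t₁ :* t₂ :* (:- t₄ :* t₃))
             := t₁ :* ((con (+ 1) :+ :- t₄ :* h) :* t₂) :* t₃)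
             refl (coefficient f i) ((1# + - eigenvalue i * h) ^ n) (φ̂ i x) h (eigenvalue i))

    kernelSum : Carrier → Fun → Fun
    kernelSum t f x = ∑[ interior U ] (λ y → μ y * dirichletKernel U B t x y * f y)

    kernelSum-spectral : ∀ t f x → kernelSum t f x ≈ ∑[ is ] (λ i → coefficient f i * exp (- eigenvalue i * t) * φ̂ i x)
    kernelSum-spectral t f x = begin-equality
      ∑[ interior U ] (λ y → μ y * dirichletKernel U B t x y * f y)
        ≈⟨ ∑-cong-∈ (interior U) (λ y y∈ → trans (*-congʳ (*-congˡ (sum≈∑ dim _))) (spread y (∈interior⁻ U y∈))) ⟩
      ∑[ interior U ] (λ y → ∑[ is ] (λ i → ε i * φ̂ i x * (μ y * f y * φ i y)))
        ≈⟨ ∑-swap (interior U) is _ ⟩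
      ∑[ is ] (λ i → ∑[ interior U ] (λ y → ε i * φ̂ i x * (μ y * f y * φ i y)))
        ≈⟨ ∑-cong is (λ i → trans (∑-*ˡ _ (interior U) _) (solve 3 (λ t₁ t₂ t₃ → t₁ :* t₂ :* t₃
              := t₃ :* t₁ :* t₂) refl (ε i) (φ̂ i x) (coefficient f i))) ⟩
      ∑[ is ] (λ i → coefficient f i * ε i * φ̂ i x) ∎
      where
      ε : Fin dim → Carrier
      ε i = exp (- eigenvalue i * t)
      spread : ∀ y → IsInterior U y → μ y * ∑[ is ] (λ i → ε i * φ̂ i x * φ̂ i y) * f y ≈ ∑[ is ] (λ i → ε i * φ̂ i x * (μ y * f y * φ i y))
      spread y p = begin-equality
        μ y * ∑[ is ] (λ i → ε i * φ̂ i x * φ̂ i y) * f y      ≈⟨ solve 3 (λ t₁ t₂ t₃ → t₁ :* t₂ :* t₃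
              := t₁ :* t₃ :* t₂) refl (μ y) (∑[ is ] (λ i → ε i * φ̂ i x * φ̂ i y)) (f y) ⟩
        μ y * f y * ∑[ is ] (λ i → ε i * φ̂ i x * φ̂ i y)      ≈⟨ ∑-*ˡ _ is _ ⟨
        ∑[ is ] (λ i → μ y * f y * (ε i * φ̂ i x * φ̂ i y))
          ≈⟨ ∑-cong is (λ i → trans (*-congˡ (*-congˡ (extend-in U (φ i) p)))
              (solve 5 (λ t₁ t₂ t₃ t₄ t₅ → t₁ :* t₂ :* (t₃ :* t₄ :* t₅)
                := t₃ :* t₄ :* (t₁ :* t₂ :* t₅)) refl (μ y) (f y) (ε i) (φ̂ i x) (φ i y))) ⟩
        ∑[ is ] (λ i → ε i * φ̂ i x * (μ y * f y * φ i y))    ∎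

    Kⁿ-⟶-kernelSum : ∀ t f x → (λ n → Kⁿ U (suc n) (t * step n) f x) ⟶ kernelSum t f x
    Kⁿ-⟶-kernelSum t f x = ⟶-cong
      (λ n → trans (∑-cong is λ i → *-congʳ (*-congˡ (^-cong (suc n) (solve 3 (λ t₁ t t₂ → con (+ 1) :+ :- t₁ :* t :* t₂
            := con (+ 1) :+ :- t₁ :* (t :* t₂)) refl (eigenvalue i) t (step n)))))
        (sym (Kⁿ-spectral (suc n) (t * step n) f x)))
      (sym (kernelSum-spectral t f x))
      (∑-⟶ is λ i _ → ⟶-* (⟶-*ˡ (coefficient f i) (euler (- eigenvalue i * t))) (⟶-const (φ̂ i x)))

    dirichletKernel-out : ∀ t x y → ¬ IsInterior U y → dirichletKernel U B t x y ≈ 0#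
    dirichletKernel-out t x y p = trans (sum≈∑ dim _) (∑-zero is λ i _ → trans (*-congˡ (extend-out U (φ i) p)) (zeroʳ _))

    -- Testing against an indicator transfers sign, monotonicity and bounds from the killed schemes
    -- to the kernel itself.
    kernelSum-δ : ∀ t x y → kernelSum t δ[ y ] x ≈ μ y * dirichletKernel U B t x y
    kernelSum-δ t x y = by-cases (lem {IsInterior U y})
      where
      vanish : ∀ z → z ∈ interior U → ¬ z ≡ y → μ z * dirichletKernel U B t x z * δ[ y ] z ≈ 0#
      vanish z _ z≢y = trans (*-congˡ (δ-other y z z≢y)) (zeroʳ _)
      by-cases : Dec (IsInterior U y) → kernelSum t δ[ y ] x ≈ μ y * dirichletKernel U B t x y
      by-cases (yes p) = trans (∑-single (unique (interiorSet U)) (∈interior⁺ U p) vanish)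
        (trans (*-congˡ (δ-same y)) (*-identityʳ _))
      by-cases (no p)  = trans (∑-zero (interior U) λ z z∈ → vanish z z∈ λ { ≡.refl → p (∈interior⁻ U z∈) })
        (sym (trans (*-congˡ (dirichletKernel-out t x y p)) (zeroʳ _)))

-- The heat semigroup as the limit of the Euler scheme

module EulerFormula (lem : ExcludedMiddle 0ℓ) (ℛ : Reals) (G : Analysis.WeightedGraph lem ℛ)
  (E : Analysis.Heat.Exhaustion lem ℛ G) (B : ∀ k → Analysis.Heat.Eigenbasis lem ℛ G (Analysis.Heat.U E k)) where

  open SpectralExpansion lem ℛ G public
  open Semigroup E B public
  open Exhaustion E using (nested; exhausts)

  least : ∀ {R : ℕ → Set} → ∃ R → ∃[ k ] R k × (∀ j → R j → k ℕ.≤ j)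
  least {R} (n , r) = found (below (suc n))
    where
    below : ∀ n → (∃[ k ] R k × (∀ j → R j → k ℕ.≤ j)) ⊎ (∀ j → R j → n ℕ.≤ j)
    below zero    = inj₂ λ _ _ → ℕ.z≤n
    below (suc n) with below n
    ... | inj₁ p = inj₁ p
    ... | inj₂ b with lem {R n}
    ...   | yes r = inj₁ (n , r , b)
    ...   | no ¬r = inj₂ λ j rj → ℕ.≤∧≢⇒< (b j rj) λ { ≡.refl → ¬r rj }
    found : (∃[ k ] R k × (∀ j → R j → k ℕ.≤ j)) ⊎ (∀ j → R j → suc n ℕ.≤ j) → ∃[ k ] R k × (∀ j → R j → k ℕ.≤ j)
    found (inj₁ p) = p
    found (inj₂ b) = ⊥-elim (ℕ.1+n≰n (b n r))

  level : V → ℕ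
  level y = proj₁ (least (exhausts y))

  level-∈ : ∀ y → y ∈ elements (U E (level y))
  level-∈ y = proj₁ (proj₂ (least (exhausts y)))

  level-≤ : ∀ y k → y ∈ elements (U E k) → level y ℕ.≤ k
  level-≤ y = proj₂ (proj₂ (least (exhausts y)))

  level-neighbour : ∀ y z → z ∈ nb y → level z ℕ.≤ suc (level y)
  level-neighbour y z z∈ = level-≤ z _ (proj₂ (nested (level y) y (level-∈ y)) z (Equivalence.to (∈-nbrs y z) z∈))

  ∈-mono : ∀ {j k x} → j ℕ.≤ k → x ∈ elements (U E j) → x ∈ elements (U E k)
  ∈-mono {j} {k} {x} p x∈ = go (ℕ.≤⇒≤′ p)
    where
    go : ∀ {k} → j ℕ.≤′ k → x ∈ elements (U E k)
    go (ℕ.≤′-reflexive ≡.refl) = x∈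
    go (ℕ.≤′-step q)           = proj₁ (nested _ x (go q))

  -- A point already contained in an earlier set of the exhaustion is, by `nested`, interior to the
  -- k-th one.
  level-outside : ∀ k y → ¬ IsInterior (U E k) y → k ℕ.≤ level y
  level-outside zero    y ¬i = ℕ.z≤n
  level-outside (suc k) y ¬i with ℕ.≤-total (suc k) (level y)
  ... | inj₁ p = p
  ... | inj₂ p with ℕ.m≤n⇒m<n∨m≡n p
  ...   | inj₁ (ℕ.s≤s q) = ⊥-elim (¬i (nested k y (∈-mono q (level-∈ y))))
  ...   | inj₂ q         = ℕ.≤-reflexive (≡.sym q)

  1≤2^ : ∀ n → 1# ≤ 2# ^ n
  1≤2^ n = 1≤^ n (≤-by 0≤1 (solve 0 (con (+ 2) :- con (+ 1) := con (+ 1)) refl))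

  2^-mono : ∀ {m n} → m ℕ.≤ n → 2# ^ m ≤ 2# ^ n
  2^-mono = monotone λ n → ≤-by (≤-trans 0≤1 (1≤2^ n)) (solve 1 (λ t₁ → con (+ 2) :* t₁ :- t₁ := t₁) refl (2# ^ n))

  ι≤2^ : ∀ n → ι n ≤ 2# ^ n
  ι≤2^ zero    = 0≤1
  ι≤2^ (suc n) = ≤-by (+-nonNeg (gap (1≤2^ n)) (gap (ι≤2^ n))) (solve 2 (λ t₁ t₂ → con (+ 2) :* t₁ :- (con (+ 1) :+ t₂)
        := t₁ :- con (+ 1) :+ (t₁ :- t₂)) refl (2# ^ n) (ι n))

  -- Neighbours differ by at most one level, so W grows at most twofold along an edge.
  W : Fun
  W y = 2# ^ level y

  W-nonNeg : ∀ y → 0# ≤ W y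
  W-nonNeg y = ≤-trans 0≤1 (1≤2^ (level y))

  ΔW≤DW : ∀ y → Δ W y ≤ D * W y
  ΔW≤DW y = begin
    Δ W y                 ≤⟨ mean-mono-nb y (λ z z∈ → ≤-by (gap (2^-mono (level-neighbour y z z∈)))
        (solve 2 (λ t₁ t₂ → t₁ :- (t₂ :- t₁)
          := con (+ 2) :* t₁ :- t₂) refl (W y) (W z))) ⟩
    mean (λ _ → W y) y    ≈⟨ mean-const y (W y) ⟩
    W y * degree y        ≤⟨ *-monoˡ-≤ (W-nonNeg y) (degree≤D y) ⟩
    W y * D               ≈⟨ *-comm _ _ ⟩
    D * W y               ∎

  module AtTime (t : Carrier) (0≤t : 0# ≤ t) where

    h : ℕ → Carrier
    h n = t * step n

    0≤h : ∀ n → 0# ≤ h n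
    0≤h n = *-nonNeg 0≤t (step-nonNeg n)

    -- The scheme is known to be Markov only for fine meshes, so comparisons of schemes hold
    -- eventually, which is enough for their limits.
    small : Eventually λ n → h n * D ≤ 1#
    small = eventually-small 1# (⟶-cong (λ n → (solve 3 (λ t D t₁ → t :* D :* t₁
          := t :* t₁ :* D) refl t D (step n))) refl (*-null (t * D) step-null)) 0<1

    pk : ℕ → V → V → Carrier
    pk k = dirichletKernel (U E k) (B k) t

    T : ℕ → Fun → Fun
    T k = Spectral.kernelSum (U E k) (B k) t

    T-limit : ∀ k f x → (λ n → Kⁿ (U E k) (suc n) (h n) f x) ⟶ T k f x
    T-limit k = Spectral.Kⁿ-⟶-kernelSum (U E k) (B k) t

    module _ {f : Fun} (0≤f : ∀ y → 0# ≤ f y) where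

      T-nonNeg : ∀ k x → 0# ≤ T k f x
      T-nonNeg k x = const-≤-⟶ (eventually-map (λ n p → Markov.Kⁿ-nonNeg (0≤h n) p (U E k) (suc n) 0≤f x) small) (T-limit k f x)

      T-mono : ∀ k x → T k f x ≤ T (suc k) f x
      T-mono k x = ⟶-mono-≤
        (eventually-map (λ n p → Markov.Kⁿ-mono (0≤h n) p (U E k) (U E (suc k)) (suc n) (λ y i → nested k y (proj₁ i)) 0≤f x) small)
        (T-limit k f x) (T-limit (suc k) f x)

      T-≤ : ∀ {M} → (∀ y → f y ≤ M) → ∀ k x → T k f x ≤ M
      T-≤ f≤M k x = ⟶-≤-const (eventually-map (λ n p → ≤-trans (Markov.Kⁿ≤Qⁿ (0≤h n) p (U E k) (suc n) 0≤f x) (Markov.Qⁿ-≤ (0≤h n) p (suc n) f≤M x)) small) (T-limit k f x)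

    μpk : ∀ k x y → T k δ[ y ] x ≈ μ y * pk k x y
    μpk k x y = Spectral.kernelSum-δ (U E k) (B k) t x y

    pk-nonNeg : ∀ k x y → 0# ≤ pk k x y
    pk-nonNeg k x y = *-cancelˡ-≤ (μ-pos y) (≤-resp (sym (zeroʳ _)) (μpk k x y) (T-nonNeg (δ-nonNeg y) k x))

    pk-mono : ∀ k x y → pk k x y ≤ pk (suc k) x y
    pk-mono k x y = *-cancelˡ-≤ (μ-pos y) (≤-resp (μpk k x y) (μpk (suc k) x y) (T-mono (δ-nonNeg y) k x))

    -- The indicator of `y` is at most one and the killed semigroup is sub-Markov. With `pk-mono`
    -- this makes the defining limit of the heat kernel exist.
    pk-bounded : ∀ k x y → pk k x y ≤ (μ y) ⁻¹
    pk-bounded k x y = *-cancelˡ-≤ (μ-pos y) (≤-resp (μpk k x y) (trans (sym (⁻¹-inverseˡ (μ-pos y))) (*-comm _ _)) (T-≤ (δ-nonNeg y) (δ≤1 y) k x))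

    pk-limit : ∀ x y → (λ k → pk k x y) ⟶ heatKernel t x y
    pk-limit x y = lim-spec (proj₂ (⟶-sup (λ k → pk-mono k x y) (λ k → pk-bounded k x y)))

    module _ {f : Fun} (0≤f : ∀ y → 0# ≤ f y) {M : Carrier} (f≤M : ∀ y → f y ≤ M) (0≤M : 0# ≤ M) (x : V) where

      a : Fun
      a y = μ y * heatKernel t x y * f y

      ak : ℕ → Fun
      ak k y = μ y * pk k x y * f y

      ak-nonNeg : ∀ k y → 0# ≤ ak k y
      ak-nonNeg k y = *-nonNeg (*-nonNeg (<⇒≤ (μ-pos y)) (pk-nonNeg k x y)) (0≤f y)

      ak-mono : ∀ y k → ak k y ≤ ak (suc k) y
      ak-mono y k = *-monoʳ-≤ (0≤f y) (*-monoˡ-≤ (<⇒≤ (μ-pos y)) (pk-mono k x y))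

      ak-limit : ∀ y → (λ k → ak k y) ⟶ a y
      ak-limit y = ⟶-* (⟶-*ˡ (μ y) (pk-limit x y)) (⟶-const (f y))

      ak≤a : ∀ k y → ak k y ≤ a y
      ak≤a k y = const-≤-⟶ (k , λ n k≤n → monotone (ak-mono y) k≤n) (ak-limit y)

      T-sup : ∃[ s ] (λ k → T k f x) ⟶ s
      T-sup = ⟶-sup (λ k → T-mono 0≤f k x) (λ k → T-≤ 0≤f f≤M k x)

      s : Carrier
      s = proj₁ T-sup

      T≤s : ∀ k → T k f x ≤ s
      T≤s k = const-≤-⟶ (k , λ n k≤n → monotone (λ k → T-mono 0≤f k x) k≤n) (proj₂ T-sup)

      -- On a finite set the sum passes to the limit in `k`, and for each `k` the terms off the
      -- interior vanish, leaving at most `T k f x`.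
      finite≤s : ∀ (R : FinSet V) → ∑[ elements R ] a ≤ s
      finite≤s R = ⟶-≤-const (always λ k → ≤-trans (∑-⊆ (unique R) (λ {y} _ → dichotomy k y) (ak-nonNeg k)) (T≤s k))
        (∑-⟶ (elements R) {λ k → ak k} {a} λ y _ → ak-limit y)
        where
        dichotomy : ∀ k y → y ∈ interior (U E k) ⊎ ak k y ≈ 0#
        dichotomy k y = by-cases (lem {IsInterior (U E k) y})
          where
          by-cases : Dec (IsInterior (U E k) y) → y ∈ interior (U E k) ⊎ ak k y ≈ 0#
          by-cases (yes i) = inj₁ (∈interior⁺ (U E k) i)
          by-cases (no ¬i) = inj₂ (trans (*-congʳ (trans (*-congˡ (Spectral.dirichletKernel-out (U E k) (B k) t x y ¬i)) (zeroʳ _))) (zeroˡ _))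

      -- Monotone convergence: finite sums never exceed `s`, and one that covers the interior of a
      -- late set dominates `T k f x`, which is close to `s`.
      hasSum : HasSum a s
      hasSum ε 0<ε = interiorSet (U E k) , λ R S⊆R →
          ≤-<-trans (≤-by (gap (finite≤s R)) (solve 2 (λ t₁ s → con (+ 0) :- (t₁ :- s)
                := s :- t₁) refl (∑[ elements R ] a) s)) 0<ε
        , ≤-<-trans (≤-by (+-nonNeg (gap (lower near)) (gap (T≤ R S⊆R)))
            (solve 5 (λ half ε s t₁ t₂ → half :* ε :- (s :- t₁)
               := half :* ε :- :- (t₂ :- s) :+ (t₁ :- t₂))
               refl half ε s (∑[ elements R ] a) (T k f x))) (half-< 0<ε)
        where
        point : ∃ λ k → ∣ T k f x - s ∣≤ half * ε
        point = eventually-point (⟶-elim (proj₂ T-sup) (half * ε) (half-pos 0<ε))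
        k : ℕ
        k = proj₁ point
        near : ∣ T k f x - s ∣≤ half * ε
        near = proj₂ point
        T≤ : ∀ R → interior (U E k) ⊆ elements R → T k f x ≤ ∑[ elements R ] a
        T≤ R S⊆R = ≤-trans (∑-mono (interior (U E k)) (ak≤a k))
          (∑-⊆ (unique (interiorSet (U E k))) (λ y∈ → inj₁ (S⊆R y∈))
            λ y → ≤-trans (ak-nonNeg 0 y) (ak≤a 0 y))

      -- The killed schemes approximate the Euler scheme uniformly in the number of steps.
      euler-⟶-s : (λ n → Qⁿ (suc n) (h n) f x) ⟶ s
      euler-⟶-s = ⟶-approx λ ε 0<ε →
        let k₁ , near = ⟶-elim (proj₂ T-sup) ε 0<ε
            -- `exit-bound` at barrier height `2# ^ k` leaves the error M C W(x)/2^k, at most ε once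
            -- `ι k` exceeds this quotient, as `ι k ≤ 2# ^ k`.
            k₂ , big  = archimedean (M * C * W x * ε ⁻¹)
            k         = k₁ ℕ.⊔ k₂
        in (λ n → Kⁿ (U E k) (suc n) (h n) f x) , T k f x
         , eventually-zip (λ n p q → nonNeg⇒∣∣≤ (gap (Markov.Kⁿ≤Qⁿ (0≤h n) p (U E k) (suc n) 0≤f x)) (close ε 0<ε k n (≤-trans big (ι-mono (ℕ.m≤n⊔m k₁ k₂))) p q))
             small growth
         , T-limit k f x
         , near k (ℕ.m≤m⊔n k₁ k₂)
        where
        C : Carrier
        -- The factors (1 + D h)^(n+1) converge to exp(D t), so this bounds them for late `n`; being
        -- independent of `k`, it lets `k` be chosen before `n`.
        C = abs (exp (D * t)) + 1#
        growth : Eventually λ n → ∣ (1# + D * h n) ^ suc n ∣≤ C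
        growth = eventually-map (λ n → ∣∣≤-resp (^-cong (suc n) (solve 3 (λ D t t₁ → con (+ 1) :+ D :* t :* t₁
              := con (+ 1) :+ D :* (t :* t₁)) refl D t (step n)))) (⟶-bounded (euler (D * t)))
        close : ∀ ε → 0# < ε → ∀ k n → M * C * W x * ε ⁻¹ ≤ ι k → h n * D ≤ 1# → ∣ (1# + D * h n) ^ suc n ∣≤ C →
                Qⁿ (suc n) (h n) f x - Kⁿ (U E k) (suc n) (h n) f x ≤ ε
        close ε 0<ε k n big p q = *-cancelʳ-≤ (<-≤-trans 0<1 (1≤2^ k)) (begin
          d * 2# ^ k                                   ≈⟨ *-comm _ _ ⟩
          2# ^ k * d
            ≤⟨ Markov.exit-bound (0≤h n) p (U E k) (≤-trans 0≤1 (1≤2^ k)) (λ y ¬i → 2^-mono (level-outside k y ¬i)) W-nonNeg ΔW≤DW (suc n) 0≤f f≤M 0≤M x ⟩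
          M * (1# + D * h n) ^ suc n * W x             ≤⟨ *-monoʳ-≤ (W-nonNeg x) (*-monoˡ-≤ 0≤M (upper q)) ⟩
          M * C * W x                                  ≈⟨ trans (sym (*-identityʳ _)) (*-congˡ (sym (⁻¹-inverseˡ 0<ε))) ⟩
          M * C * W x * (ε ⁻¹ * ε)                     ≈⟨ *-assoc _ _ _ ⟨
          M * C * W x * ε ⁻¹ * ε                       ≤⟨ *-monoʳ-≤ (<⇒≤ 0<ε) (≤-trans big (ι≤2^ k)) ⟩
          2# ^ k * ε                                   ≈⟨ *-comm _ _ ⟩
          ε * 2# ^ k                                   ∎)
          where
          d : Carrier
          d = Qⁿ (suc n) (h n) f x - Kⁿ (U E k) (suc n) (h n) f x

      P-euler : (λ n → Qⁿ (suc n) (h n) f x) ⟶ P t f x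
      P-euler = if-elim ((λ n → Qⁿ (suc n) (h n) f x) ⟶_) (lem {t ≈ 0#})
        -- At time zero `P` returns `f`, and all step sizes vanish, so the scheme does not move.
        (λ t≈0 → ⟶-cong (λ n → sym (frozen t≈0 (suc n) n)) refl (⟶-const (f x)))
        (λ _ → ⟶-cong (λ _ → refl) (sym (∑-≈ hasSum)) euler-⟶-s)
        where
        frozen : t ≈ 0# → ∀ m n {x} → Qⁿ m (h n) f x ≈ f x
        frozen t≈0 zero    n = refl
        frozen t≈0 (suc m) n {x} = trans (+-cong (frozen t≈0 m n) (trans (*-congʳ (trans (*-congʳ t≈0) (zeroˡ _))) (zeroˡ _))) (+-identityʳ _)

-- Square roots, properties of the semigroup, and the curvature condition

module GradientBound (lem : ExcludedMiddle 0ℓ) (ℛ : Reals) (G : Analysis.WeightedGraph lem ℛ)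
  (E : Analysis.Heat.Exhaustion lem ℛ G) (B : ∀ k → Analysis.Heat.Eigenbasis lem ℛ G (Analysis.Heat.U E k)) where

  open EulerFormula lem ℛ G E B public

  √-mono : ∀ {x y} → 0# ≤ x → x ≤ y → √ x ≤ √ y
  √-mono p q = square-mono⁻¹ (√-nonNeg p) (√-nonNeg 0≤y) (≤-resp (sym (√-square p)) (sym (√-square 0≤y)) q)
    where
    0≤y = ≤-trans p q

  √-unique : ∀ {x y} → 0# ≤ y → y * y ≈ x → √ x ≈ y
  √-unique {x} {y} p q = antisym (square-mono⁻¹ (√-nonNeg 0≤x) p (≤-reflexive e)) (square-mono⁻¹ p (√-nonNeg 0≤x) (≤-reflexive (sym e)))
    where
    0≤x : 0# ≤ x
    0≤x = ≤-resp refl q (square-nonNeg y)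
    e : √ x * √ x ≈ y * y
    e = trans (√-square 0≤x) (sym q)

  √-pos : ∀ {x} → 0# < x → 0# < √ x
  √-pos {x} p = √-nonNeg (<⇒≤ p) , λ z → pos⇒≉0 p (trans (sym (√-square (<⇒≤ p))) (trans (*-congʳ (sym z)) (zeroˡ _)))

  -- The difference of the roots is (a - l)/(√a + √l), and the denominator is at least √l.
  √-⟶ : ∀ {a : ℕ → Carrier} {l} → 0# < l → (Eventually λ n → 0# ≤ a n) → a ⟶ l → (λ n → √ (a n)) ⟶ √ l
  √-⟶ {a} {l} 0<l p q = ⟶-intro λ ε 0<ε → eventually-zip (λ n → close ε 0<ε n) p (⟶-elim q (ε * √ l) (*-pos 0<ε (√-pos 0<l)))
    where
    close : ∀ ε → 0# < ε → ∀ n → 0# ≤ a n → ∣ a n - l ∣≤ ε * √ l → ∣ √ (a n) - √ l ∣≤ ε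
    close ε 0<ε n r s =
        *-cancelʳ-≤ 0<σ (≤-trans (≤-trans (≤-reflexive e) (upper s)) more)
      , *-cancelʳ-≤ 0<σ (≤-trans (≤-trans (≤-reflexive (trans (solve 3 (λ t₁ t₂ σ → :- (t₁ :- t₂) :* σ
            := :- ((t₁ :- t₂) :* σ)) refl (√ (a n)) (√ l) σ) (-‿cong e))) (lower s)) more)
      where
      σ : Carrier
      σ = √ l + √ (a n)
      0<σ : 0# < σ
      0<σ = +-pos (√-pos 0<l) (√-nonNeg r)
      e : (√ (a n) - √ l) * σ ≈ a n - l
      e = trans (solve 2 (λ t₁ t₂ → (t₁ :- t₂) :* (t₂ :+ t₁)
            := t₁ :* t₁ :- t₂ :* t₂) refl (√ (a n)) (√ l)) (+-cong (√-square r) (-‿cong (√-square (<⇒≤ 0<l))))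
      more : ε * √ l ≤ ε * σ
      more = *-monoˡ-≤ (<⇒≤ 0<ε) (≤-by (√-nonNeg r) (solve 2 (λ t₁ t₂ → t₁ :+ t₂ :- t₁ := t₂) refl (√ l) (√ (a n))))

  -- After expanding the squares the claim is √(ab) + c ≤ √((a+c)(b+c)), a case of Cauchy-Schwarz:
  -- the squares of its sides differ by c(√a - √b)².
  √-shift-contracts : ∀ {a b c} → 0# ≤ a → 0# ≤ b → 0# ≤ c →
    (√ (a + c) - √ (b + c)) * (√ (a + c) - √ (b + c)) ≤ (√ a - √ b) * (√ a - √ b)
  √-shift-contracts {a} {b} {c} 0≤a 0≤b 0≤c = ≤-by (*-nonNeg (<⇒≤ 0<2) (gap key)) (begin-equality
    (α - β) * (α - β) - (α′ - β′) * (α′ - β′)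
      ≈⟨ solve 4 (λ α β α′ β′ → (α :- β) :* (α :- β) :- (α′ :- β′) :* (α′ :- β′)
            := α :* α :+ β :* β :- α′ :* α′ :- β′ :* β′ :+ con (+ 2) :* (α′ :* β′ :- α :* β))
            refl α β α′ β′ ⟩
    α * α + β * β - α′ * α′ - β′ * β′ + 2# * (α′ * β′ - α * β)
      ≈⟨ +-congʳ (+-cong (+-cong (+-cong (√-square 0≤a) (√-square 0≤b)) (-‿cong (√-square 0≤a+c))) (-‿cong (√-square 0≤b+c))) ⟩
    a + b - (a + c) - (b + c) + 2# * (α′ * β′ - α * β)
      ≈⟨ solve 7 (λ a b c α′ β′ α β → a :+ b :- (a :+ c) :- (b :+ c) :+ con (+ 2) :* (α′ :* β′ :- α :* β)
            := con (+ 2) :* (α′ :* β′ :- (α :* β :+ c)))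
            refl a b c α′ β′ α β ⟩
    2# * (α′ * β′ - (α * β + c)) ∎)
    where
    0≤a+c = +-nonNeg 0≤a 0≤c
    0≤b+c = +-nonNeg 0≤b 0≤c
    α β α′ β′ : Carrier
    α  = √ a
    β  = √ b
    α′ = √ (a + c)
    β′ = √ (b + c)
    key : α * β + c ≤ α′ * β′
    key = square-mono⁻¹ (+-nonNeg (*-nonNeg (√-nonNeg 0≤a) (√-nonNeg 0≤b)) 0≤c) (*-nonNeg (√-nonNeg 0≤a+c) (√-nonNeg 0≤b+c))
      (≤-by (*-nonNeg 0≤c (square-nonNeg (α - β))) (begin-equality
        α′ * β′ * (α′ * β′) - (α * β + c) * (α * β + c)
          ≈⟨ +-congʳ (solve 2 (λ α′ β′ → α′ :* β′ :* (α′ :* β′) := α′ :* α′ :* (β′ :* β′)) refl α′ β′) ⟩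
        α′ * α′ * (β′ * β′) - (α * β + c) * (α * β + c)
          ≈⟨ +-congʳ (*-cong (trans (√-square 0≤a+c) (+-congʳ (sym (√-square 0≤a)))) (trans (√-square 0≤b+c) (+-congʳ (sym (√-square 0≤b))))) ⟩
        (α * α + c) * (β * β + c) - (α * β + c) * (α * β + c)
          ≈⟨ solve 3 (λ α c β → (α :* α :+ c) :* (β :* β :+ c) :- (α :* β :+ c) :* (α :* β :+ c)
                := c :* ((α :- β) :* (α :- β)))
                refl α c β ⟩
        c * ((α - β) * (α - β)) ∎))

  exp-nonNeg : ∀ x → 0# ≤ exp x
  exp-nonNeg x = const-≤-⟶ (eventually-map
    (λ n p → ^-nonNeg (suc n) (≤-by (gap (lower p)) (solve 2 (λ x t₁ → con (+ 1) :+ x :* t₁ :- con (+ 0)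
          := con (+ 1) :- :- (x :* t₁ :- con (+ 0))) refl x (step n))))
    (⟶-elim (*-null x step-null) 1# 0<1)) (euler x)

  record NonNegBounded (f : Fun) : Set where
    field
      nonNeg  : ∀ x → 0# ≤ f x
      bound   : Carrier
      0≤bound : 0# ≤ bound
      ≤bound  : ∀ x → f x ≤ bound

    ∣∣≤bound : ∀ x → ∣ f x ∣≤ bound
    ∣∣≤bound x = nonNeg⇒∣∣≤ (nonNeg x) (≤bound x)

  open NonNegBounded

  bounded⁺ : ∀ {f} → Positive f → Bounded f → NonNegBounded f
  bounded⁺ {f} pos (C , b) = record
    { nonNeg  = λ x → <⇒≤ (pos x)
    ; bound   = abs C
    ; 0≤bound = abs-nonNeg C
    ; ≤bound  = λ x → ≤-trans (proj₂ (b x)) (upper (∣x∣≤abs C))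
    }

  √-bounded : ∀ {f} → NonNegBounded f → NonNegBounded (√_ ∘ f)
  √-bounded nb = record
    { nonNeg  = λ x → √-nonNeg (nonNeg nb x)
    ; bound   = √ bound nb
    ; 0≤bound = √-nonNeg (0≤bound nb)
    ; ≤bound  = λ x → √-mono (nonNeg nb x) (≤bound nb x)
    }

  Γ₁-bounded : ∀ {f} → NonNegBounded f → NonNegBounded (Γ₁ f)
  Γ₁-bounded {f} nb = record
    { nonNeg  = Γ₁-nonNeg f
    ; bound   = _
    ; 0≤bound = *-nonNeg half-nonNeg (*-nonNeg D-nonNeg (square-nonNeg (bound nb + bound nb)))
    ; ≤bound  = λ x → upper (Γ-∣∣≤ x (∣∣≤bound nb) (∣∣≤bound nb))
    }

  +const-bounded : ∀ {f c} → 0# ≤ c → NonNegBounded f → NonNegBounded (λ x → f x + c)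
  +const-bounded {c = c} 0≤c nb = record
    { nonNeg  = λ x → +-nonNeg (nonNeg nb x) 0≤c
    ; bound   = bound nb + c
    ; 0≤bound = +-nonNeg (0≤bound nb) 0≤c
    ; ≤bound  = λ x → +-mono-≤ (≤bound nb x) ≤-refl
    }

  module _ {t : Carrier} (0≤t : 0# ≤ t) where

    private module A = AtTime t 0≤t

    P-limit : ∀ {f} → NonNegBounded f → ∀ x → (λ n → Qⁿ (suc n) (A.h n) f x) ⟶ P t f x
    P-limit nb = A.P-euler (nonNeg nb) (≤bound nb) (0≤bound nb)

    P-mono : ∀ {f g} → NonNegBounded f → NonNegBounded g → (∀ y → f y ≤ g y) → ∀ x → P t f x ≤ P t g x
    P-mono nf ng p x = ⟶-mono-≤ (eventually-map (λ n q → Markov.Qⁿ-mono (A.0≤h n) q (suc n) p x) A.small) (P-limit nf x) (P-limit ng x)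

    P-cong : ∀ {f g} → NonNegBounded f → NonNegBounded g → (∀ y → f y ≈ g y) → ∀ x → P t f x ≈ P t g x
    P-cong nf ng e x = antisym (P-mono nf ng (λ y → ≤-reflexive (e y)) x) (P-mono ng nf (λ y → ≤-reflexive (sym (e y))) x)

    P-≥ : ∀ {f} → NonNegBounded f → ∀ {c} → (∀ y → c ≤ f y) → ∀ x → c ≤ P t f x
    P-≥ nf p x = const-≤-⟶ (eventually-map (λ n q → Markov.Qⁿ-≥ (A.0≤h n) q (suc n) p x) A.small) (P-limit nf x)

    P-nonNeg : ∀ {f} → NonNegBounded f → ∀ x → 0# ≤ P t f x
    P-nonNeg nf = P-≥ nf (nonNeg nf)

    -- Stochastic completeness: every Euler iterate fixes constants, so no mass is lost in the
    -- limit.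
    P-+const : ∀ {f c} → NonNegBounded f → 0# ≤ c → ∀ x → P t (λ y → f y + c) x ≈ P t f x + c
    P-+const {f} {c} nf 0≤c x = ⟶-unique (P-limit (+const-bounded 0≤c nf) x)
      (⟶-cong (λ n → trans (+-congˡ (sym (Qⁿ-const (suc n) (A.h n) c x))) (sym (Qⁿ-+ (suc n) (A.h n) f _ x))) refl
        (⟶-+ (P-limit nf x) (⟶-const c)))

    -- The bound `Qⁿ-first` depends only on the elapsed time, which is `t` for every mesh, so it
    -- survives the limit.
    P-first : ∀ {f c} → NonNegBounded f → (∀ y → ∣ Δ (Δ f) y ∣≤ c) → ∀ x → ∣ P t f x - (f x + t * Δ f x) ∣≤ t * t * c
    P-first {f} {c} nf p x =
        ⟶-≤-const (eventually-map (λ n q → upper (first n q)) A.small) limit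
      , ⟶-≤-const (eventually-map (λ n q → lower (first n q)) A.small) (⟶-neg limit)
      where
      limit : (λ n → Qⁿ (suc n) (A.h n) f x - (f x + t * Δ f x)) ⟶ (P t f x - (f x + t * Δ f x))
      limit = ⟶-+ (P-limit nf x) (⟶-const _)
      elapsed : ∀ n → ι (suc n) * A.h n ≈ t
      elapsed n = trans (solve 3 (λ t₁ t t₂ → t₁ :* (t :* t₂)
            := t :* (t₁ :* t₂)) refl (ι (suc n)) t (step n)) (trans (*-congˡ (step-* n)) (*-identityʳ t))
      first : ∀ n → A.h n * D ≤ 1# → ∣ Qⁿ (suc n) (A.h n) f x - (f x + t * Δ f x) ∣≤ t * t * c
      first n q = ∣∣≤-trans (∣∣≤-resp (+-congˡ (-‿cong (+-congˡ (*-congʳ (elapsed n))))) (Markov.Qⁿ-first (A.0≤h n) q (suc n) p x))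
        (≤-reflexive (*-congʳ (*-cong (elapsed n) (elapsed n))))

  ratio : Fun → Fun
  ratio f y = Δ (λ z → f z ^ 2) y / (2# * f y)

  -- CDE′(∞,-K) at f and x, cleared of fractions.
  Curvature : Carrier → Fun → V → Set
  Curvature K f x = 2# * Γ f (ratio f) x ≤ Δ (Γ₁ f) x + 2# * K * Γ₁ f x

  2*half : ∀ x → 2# * (half * x) ≈ x
  2*half x = trans (solve 2 (λ half x → con (+ 2) :* (half :* x)
        := (half :+ half) :* x) refl half x) (trans (*-congʳ half+half) (*-identityˡ x))

  -- `L` stands for `Δ (log ∘ f) x`, whose square enters with the coefficient `1/ ∞`, that is `0#`.
  curvature-gap : ∀ K f x (L : Carrier) →
    Δ (Γ₁ f) x + 2# * K * Γ₁ f x - 2# * Γ f (ratio f) x ≈ 2# * (Γ̃₂ f x - (0# * f x ^ 2 * L ^ 2 + - K * Γ₁ f x))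
  curvature-gap K f x L = trans (+-congʳ (+-congʳ (sym (2*half _))))
    (solve 7 (λ half t₁ K t₂ t₃ t₄ L → con (+ 2) :* (half :* t₁) :+ con (+ 2) :* K :* t₂ :- con (+ 2) :* t₃
       := con (+ 2) :* (half :* t₁ :- t₃ :- (con (+ 0) :* t₄ :^ 2 :* L :^ 2 :+ :- K :* t₂)))
       refl half (Δ (Γ₁ f) x) K (Γ₁ f x) (Γ f (ratio f) x) (f x) L)

  CDE′⇒Curvature : ∀ {K} → CDE′ ∞ (- K) → ∀ f → Positive f → ∀ x → Curvature K f x
  CDE′⇒Curvature {K} cde f pos x = ≤-by (*-nonNeg (<⇒≤ 0<2) (gap (cde f pos x))) (curvature-gap K f x _)

  Curvature⇒CDE′ : ∀ {K} → (∀ f → Positive f → ∀ x → Curvature K f x) → CDE′ ∞ (- K)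
  Curvature⇒CDE′ {K} cur f pos x = *-cancelʳ-≤ 0<2 (≤-by (gap (cur f pos x))
    (trans (solve 5 (λ t₁ t₂ L K t₃ → t₁ :* con (+ 2) :- (con (+ 0) :* t₂ :^ 2 :* L :^ 2 :+ :- K :* t₃) :* con (+ 2)
          := con (+ 2) :* (t₁ :- (con (+ 0) :* t₂ :^ 2 :* L :^ 2 :+ :- K :* t₃)))
          refl (Γ̃₂ f x) (f x) L K (Γ₁ f x)) (sym (curvature-gap K f x L))))
    where
    L : Carrier
    L = Δ (log ∘ f) x

-- The two implications

module GradientEquivalence (lem : ExcludedMiddle 0ℓ) (ℛ : Reals) (G : Analysis.WeightedGraph lem ℛ)
  (E : Analysis.Heat.Exhaustion lem ℛ G) (B : ∀ k → Analysis.Heat.Eigenbasis lem ℛ G (Analysis.Heat.U E k)) (K : Analysis.Carrier lem ℛ) where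

  open GradientBound lem ℛ G E B
  open NonNegBounded

  module Forward (curvature : ∀ f → Positive f → ∀ x → Curvature K f x) where

    module OneStep {ε M : Carrier} (0<ε : 0# < ε) where

      -- The index type of the asymptotics: a single constant then serves for all admissible step
      -- sizes and all functions between ε and M, hence for every step of the iteration and every
      -- mesh.
      record Datum : Set where
        field
          h     : Carrier
          0≤h   : 0# ≤ h
          h≤1   : h ≤ 1#
          hD≤1  : h * D ≤ 1#
          f     : Fun
          ε≤f   : ∀ y → ε ≤ f y
          f≤M   : ∀ y → f y ≤ M

      open Datum
      open Asymptotics {Datum} h 0≤h

      g v : Datum → Fun
      g i y = √ f i y
      v i y = √ Q (h i) (f i) y

      0≤f : ∀ i y → 0# ≤ f i y
      0≤f i y = ≤-trans (<⇒≤ 0<ε) (ε≤f i y)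

      0≤Qf : ∀ i y → 0# ≤ Q (h i) (f i) y
      0≤Qf i = Markov.Q-nonNeg (0≤h i) (hD≤1 i) (0≤f i)

      g-bounded : O 0 g
      g-bounded = O-bounded (≤-trans 0≤1 (y≤max (√ M) 1#))
        λ i x → nonNeg⇒∣∣≤ (√-nonNeg (0≤f i x)) (≤-trans (√-mono (0≤f i x) (f≤M i x)) (x≤max _ _))

      -- Here v² is the Euler step itself, so the expansion starts with remainder zero.
      exact : ∀ i x → v i x * v i x - (g i x * g i x + h i * Δ (λ y → g i y ^ 2) x) ≈ 0#
      exact i x = trans (+-cong (√-square (0≤Qf i x)) (-‿cong (+-cong (√-square (0≤f i x))
        (*-congˡ (Δ-cong x λ y → trans (*-congˡ (*-identityʳ _)) (√-square (0≤f i y))))))) (-‿inverseʳ _)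

      open Expansion g v (√-pos 0<ε) (λ i x → √-mono (<⇒≤ 0<ε) (ε≤f i x)) g-bounded (λ i x → √-nonNeg (0≤Qf i x)) (O-0 2 exact)

      -- The last summand removes the cross term 2Kh²ΔΓ(g) that arises when (1 + 2Kh) Q Γ(g) is
      -- multiplied out.
      remainder : Datum → Fun
      remainder i x = Γ₁ (v i) x - (Γ₁ (g i) x + 2# * h i * Γ (g i) (w i) x) + h i * (h i * (- (2# * K) * Δ (Γ₁ (g i)) x))

      remainder-small : O 2 remainder
      remainder-small = O-+ (Γ₁-expansion h≤1) (O-* O-h (O-* O-h (O-*ˡ (- (2# * K)) (O-Δ (O-Γ g-bounded g-bounded)))))

      C : Carrier
      C = O.C remainder-small

      C-nonNeg : 0# ≤ C
      C-nonNeg = O.0≤C remainder-small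

      one-step : ∀ i x → Γ₁ (v i) x ≤ (1# + 2# * K * h i) * Q (h i) (Γ₁ (g i)) x + C * h i ^ 2
      one-step i x = ≤-by
        (+-nonNeg (gap (upper (O.∣F∣≤ remainder-small i x)))
          (*-nonNeg (0≤h i) (gap (curvature (g i) (λ y → √-pos (<-≤-trans 0<ε (ε≤f i y))) x))))
        (solve 7 (λ K t₁ t₂ t₃ C t₄ t₅ → (con (+ 1) :+ con (+ 2) :* K :* t₁) :* (t₂ :+ t₁ :* t₃) :+ C :* t₁ :^ 2 :- t₄
           := C :* t₁ :^ 2 :- (t₄ :- (t₂ :+ con (+ 2) :* t₁ :* t₅) :+ t₁ :* (t₁ :* (:- (con (+ 2) :* K) :* t₃))) :+ t₁ :* (t₃ :+ con (+ 2) :* K :* t₂ :- con (+ 2) :* t₅))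
           refl K (h i) (Γ₁ (g i) x) (Δ (Γ₁ (g i)) x) C (Γ₁ (v i) x) (Γ (g i) (w i) x))

      module Iterate {h : Carrier} (0≤h : 0# ≤ h) (h≤1 : h ≤ 1#) (hD≤1 : h * D ≤ 1#) (0≤λ : 0# ≤ 1# + 2# * K * h)
        {f : Fun} (ε≤f : ∀ y → ε ≤ f y) (f≤M : ∀ y → f y ≤ M) where

        module M = Markov 0≤h hD≤1

        -- For negative `K` the factor `λ′` may be less than one; errors are tracked with `Λ`, which
        -- dominates both `λ′` and one.
        λ′ Λ : Carrier
        λ′ = 1# + 2# * K * h
        Λ = 1# + 2# * abs K * h

        0≤∣K∣h : 0# ≤ 2# * abs K * h
        0≤∣K∣h = *-nonNeg (*-nonNeg (<⇒≤ 0<2) (abs-nonNeg K)) 0≤h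

        1≤Λ : 1# ≤ Λ
        1≤Λ = ≤-by 0≤∣K∣h (solve 2 (λ t₁ h → con (+ 1) :+ con (+ 2) :* t₁ :* h :- con (+ 1)
              := con (+ 2) :* t₁ :* h) refl (abs K) h)

        λ≤Λ : λ′ ≤ Λ
        λ≤Λ = ≤-by (*-nonNeg (*-nonNeg (<⇒≤ 0<2) (gap (upper (∣x∣≤abs K)))) 0≤h)
          (solve 3 (λ t₁ h K → con (+ 1) :+ con (+ 2) :* t₁ :* h :- (con (+ 1) :+ con (+ 2) :* K :* h)
             := con (+ 2) :* (t₁ :- K) :* h)
             refl (abs K) h K)

        datum : ℕ → Datum
        datum n = record
          { h = h ; 0≤h = 0≤h ; h≤1 = h≤1 ; hD≤1 = hD≤1
          ; f = Qⁿ n h f ; ε≤f = M.Qⁿ-≥ n ε≤f ; f≤M = M.Qⁿ-≤ n f≤M }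

        -- Each of the n steps contributes at most Ch², and later steps amplify it by at most Λ^n.
        c : ℕ → Carrier
        c n = ι n * (C * h ^ 2) * Λ ^ n

        0≤Ch² : 0# ≤ C * h ^ 2
        0≤Ch² = *-nonNeg C-nonNeg (^-nonNeg 2 0≤h)

        0≤c : ∀ n → 0# ≤ c n
        0≤c n = *-nonNeg (*-nonNeg (ι-nonNeg n) 0≤Ch²) (≤-trans 0≤1 (1≤^ n 1≤Λ))

        Γ₀ : Fun
        Γ₀ = Γ₁ (√_ ∘ f)

        iterate : ∀ n x → Γ₁ (√_ ∘ Qⁿ n h f) x ≤ λ′ ^ n * Qⁿ n h Γ₀ x + c n
        iterate zero    x = ≤-reflexive (solve 3 (λ t₁ C h → t₁
              := con (+ 1) :* t₁ :+ con (+ 0) :* (C :* h :^ 2) :* con (+ 1)) refl (Γ₀ x) C h)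
        iterate (suc n) x = begin
          Γ₁ (√_ ∘ Qⁿ (suc n) h f) x
            ≤⟨ one-step (datum n) x ⟩
          λ′ * Q h (Γ₁ (√_ ∘ Qⁿ n h f)) x + C * h ^ 2
            ≤⟨ +-mono-≤ (*-monoˡ-≤ 0≤λ (M.Q-mono (iterate n) x)) ≤-refl ⟩
          λ′ * Q h (λ y → λ′ ^ n * Qⁿ n h Γ₀ y + c n) x + C * h ^ 2
            ≈⟨ +-congʳ (*-congˡ (trans (Q-+ h _ _ x) (+-cong (Q-*ˡ h (λ′ ^ n) _ x) (Q-const h (c n) x)))) ⟩
          λ′ * (λ′ ^ n * Qⁿ (suc n) h Γ₀ x + c n) + C * h ^ 2
            ≤⟨ ≤-by (+-nonNeg (*-nonNeg (gap λ≤Λ) (0≤c n)) (*-nonNeg 0≤Ch² (gap (1≤^ (suc n) 1≤Λ))))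
                 (solve 8 (λ λ′ t₁ t₂ t₃ C h Λ t₄ → λ′ :* t₁ :* t₂ :+ (con (+ 1) :+ t₃) :* (C :* h :^ 2) :* (Λ :* t₄) :- (λ′ :* (t₁ :* t₂ :+ t₃ :* (C :* h :^ 2) :* t₄) :+ C :* h :^ 2)
                    := (Λ :- λ′) :* (t₃ :* (C :* h :^ 2) :* t₄) :+ C :* h :^ 2 :* (Λ :* t₄ :- con (+ 1)))
                    refl λ′ (λ′ ^ n) (Qⁿ (suc n) h Γ₀ x) (ι n) C h Λ (Λ ^ n)) ⟩
          λ′ ^ suc n * Qⁿ (suc n) h Γ₀ x + c (suc n) ∎

    module BoundedBelow {f : Fun} (nf : NonNegBounded f) {ε : Carrier} (0<ε : 0# < ε) (ε≤f : ∀ y → ε ≤ f y) {t : Carrier} (0≤t : 0# ≤ t) (x : V) where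

      module A = AtTime t 0≤t
      module S = OneStep {ε} {bound nf} 0<ε

      e : Carrier → ℕ → Carrier
      e s n = (1# + s * A.h n) ^ suc n

      e-limit : ∀ s → e s ⟶ exp (s * t)
      e-limit s = ⟶-cong (λ n → ^-cong (suc n) (solve 3 (λ s t t₁ → con (+ 1) :+ s :* t :* t₁
            := con (+ 1) :+ s :* (t :* t₁)) refl s t (step n))) refl (euler (s * t))

      h-null : A.h ⟶ 0#
      h-null = *-null t step-null

      error : ℕ → Carrier
      error n = ι (suc n) * (S.C * A.h n ^ 2) * e (2# * abs K) n

      -- The number of steps cancels one factor of the squared mesh, leaving C t²/(n+1) times a
      -- convergent power.
      error-null : error ⟶ 0#
      error-null = ⟶-cong regroup (zeroˡ _) (⟶-* (*-null (S.C * t * t) step-null) (e-limit (2# * abs K)))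
        where
        regroup : ∀ n → S.C * t * t * step n * e (2# * abs K) n ≈ error n
        regroup n = *-congʳ (begin-equality
          S.C * t * t * step n                               ≈⟨ *-identityʳ _ ⟨
          S.C * t * t * step n * 1#                          ≈⟨ *-congˡ (step-* n) ⟨
          S.C * t * t * step n * (ι (suc n) * step n)        ≈⟨ solve 4 (λ t₁ t t₂ t₃ → t₁ :* t :* t :* t₂ :* (t₃ :* t₂)
                := t₃ :* (t₁ :* (t :* t₂) :^ 2)) refl S.C t (step n) (ι (suc n)) ⟩
          ι (suc n) * (S.C * A.h n ^ 2)                      ∎)

      -- Once |2Kh| ≤ 1 the factor 1 + 2Kh is nonnegative whatever the sign of `K`, so the one-step
      -- inequality may be multiplied by it.
      scheme-bound : Eventually λ n → Γ₁ (√_ ∘ Qⁿ (suc n) (A.h n) f) x ≤ e (2# * K) n * Qⁿ (suc n) (A.h n) (Γ₁ (√_ ∘ f)) x + error n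
      scheme-bound = eventually-zip (λ n (p , q) r → S.Iterate.iterate (A.0≤h n) p r
          (≤-by (gap (lower q)) (solve 3 (λ K t t₁ → con (+ 1) :+ con (+ 2) :* K :* (t :* t₁) :- con (+ 0)
                := con (+ 1) :- :- (con (+ 2) :* K :* (t :* t₁) :- con (+ 0))) refl K t (step n)))
          ε≤f (≤bound nf) (suc n) x)
        (eventually-zip {λ n → A.h n ≤ 1#} {λ n → ∣ 2# * K * A.h n - 0# ∣≤ 1#} {λ n → A.h n ≤ 1# × ∣ 2# * K * A.h n - 0# ∣≤ 1#}
          (λ n p q → p , q) (eventually-small 1# h-null 0<1) (⟶-elim (*-null (2# * K) h-null) 1# 0<1))
        A.small

      bounded-below : Γ₁ (√_ ∘ P t f) x ≤ exp (2# * K * t) * P t (Γ₁ (√_ ∘ f)) x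
      bounded-below = ≤-resp refl (+-identityʳ _) (⟶-mono-≤ scheme-bound
        -- `P t f` inherits the lower bound ε, which supplies the positive limit that `√-⟶` asks
        -- for.
        (Γ₁-⟶ x λ y → √-⟶ (<-≤-trans 0<ε (P-≥ 0≤t nf ε≤f y))
          (eventually-map (λ n q → Markov.Qⁿ-≥ (A.0≤h n) q (suc n) (nonNeg nf) y) A.small) (P-limit 0≤t nf y))
        (⟶-+ (⟶-* (e-limit (2# * K)) (P-limit 0≤t (Γ₁-bounded (√-bounded nf)) x)) error-null))

    -- The lower bound on f is removed by adding η² to f, which does not increase Γ(√f).
    gradient-bound : ∀ f → Positive f → Bounded f → ∀ t → 0# ≤ t → ∀ x → Γ₁ (√_ ∘ P t f) x ≤ exp (2# * K * t) * P t (Γ₁ (√_ ∘ f)) x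
    gradient-bound f pos bd t 0≤t x = ⟶-≤-const (always perturbed) (Γ₁-⟶ x √-limit)
      where
      nf : NonNegBounded f
      nf = bounded⁺ pos bd
      -- A square, so that √(a + η²) ≤ √a + η: the roots converge without a positive lower bound on
      -- `P t f`.
      η² : ℕ → Carrier
      η² n = step n * step n
      0<η² : ∀ n → 0# < η² n
      0<η² n = *-pos (step-pos n) (step-pos n)
      nfη : ∀ n → NonNegBounded (λ y → f y + η² n)
      nfη n = +const-bounded (<⇒≤ (0<η² n)) nf
      Γ₁-decreases : ∀ n y → Γ₁ (λ z → √ (f z + η² n)) y ≤ Γ₁ (√_ ∘ f) y
      Γ₁-decreases n y = ≤-resp (sym (Γ-mean _ _ y)) (sym (Γ-mean _ _ y)) (*-monoˡ-≤ half-nonNeg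
        (mean-mono y λ z → √-shift-contracts (nonNeg nf z) (nonNeg nf y) (<⇒≤ (0<η² n))))
      perturbed : ∀ n → Γ₁ (λ y → √ (P t (λ z → f z + η² n) y)) x ≤ exp (2# * K * t) * P t (Γ₁ (√_ ∘ f)) x
      perturbed n = ≤-trans
        (BoundedBelow.bounded-below (nfη n) (0<η² n) (λ y → ≤-by (nonNeg nf y) (solve 2 (λ t₁ t₂ → t₁ :+ t₂ :- t₂
              := t₁) refl (f y) (η² n))) 0≤t x)
        (*-monoˡ-≤ (exp-nonNeg _) (P-mono 0≤t (Γ₁-bounded (√-bounded (nfη n))) (Γ₁-bounded (√-bounded nf)) (Γ₁-decreases n) x))
      √-limit : ∀ y → (λ n → √ (P t (λ z → f z + η² n) y)) ⟶ √ (P t f y)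
      √-limit y = ⟶-squeeze (always close) step-null
        where
        a : Carrier
        a = P t f y
        0≤a : 0# ≤ a
        0≤a = P-nonNeg 0≤t nf y
        close : ∀ n → ∣ √ (P t (λ z → f z + η² n) y) - √ a ∣≤ step n
        close n = nonNeg⇒∣∣≤ (gap (√-mono 0≤a (≤-by (<⇒≤ (0<η² n)) (trans (+-congʳ shifted) (solve 2 (λ a t₁ → a :+ t₁ :- a
              := t₁) refl a (η² n))))))
          (≤-by (gap root≤) (solve 3 (λ t₁ t₂ t₃ → t₁ :- (t₂ :- t₃)
                := t₃ :+ t₁ :- t₂) refl (step n) (√ (P t (λ z → f z + η² n) y)) (√ a)))
          where
          shifted : P t (λ z → f z + η² n) y ≈ a + η² n
          shifted = P-+const 0≤t nf (<⇒≤ (0<η² n)) y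
          0≤shifted : 0# ≤ P t (λ z → f z + η² n) y
          0≤shifted = P-nonNeg 0≤t (nfη n) y
          root≤ : √ (P t (λ z → f z + η² n) y) ≤ √ a + step n
          root≤ = square-mono⁻¹ (√-nonNeg 0≤shifted) (+-nonNeg (√-nonNeg 0≤a) (step-nonNeg n))
            (≤-trans (≤-reflexive (trans (√-square 0≤shifted) (trans shifted (+-congʳ (sym (√-square 0≤a))))))
              (≤-by (*-nonNeg (<⇒≤ 0<2) (*-nonNeg (√-nonNeg 0≤a) (step-nonNeg n)))
                (solve 2 (λ t₁ t₂ → (t₁ :+ t₂) :* (t₁ :+ t₂) :- (t₁ :* t₁ :+ t₂ :* t₂)
                   := con (+ 2) :* (t₁ :* t₂))
                   refl (√ a) (step n))))

  module Reverse (gradient-bound : ∀ f → Positive f → Bounded f → ∀ t → 0# ≤ t → ∀ x →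
    Γ₁ (√_ ∘ P t f) x ≤ exp (2# * K * t) * P t (Γ₁ (√_ ∘ f)) x) where

    module BoundedFunction {g : Fun} {δ M : Carrier} (0<δ : 0# < δ) (δ≤g : ∀ y → δ ≤ g y) (g≤M : ∀ y → g y ≤ M) (0≤M : 0# ≤ M) (x : V) where

      open Asymptotics {ℕ} step step-nonNeg

      0≤g : ∀ y → 0# ≤ g y
      0≤g y = ≤-trans (<⇒≤ 0<δ) (δ≤g y)

      ng : NonNegBounded g
      ng = record { nonNeg = 0≤g ; bound = M ; 0≤bound = 0≤M ; ≤bound = g≤M }

      f : Fun
      f y = g y ^ 2

      f-pos : Positive f
      f-pos y = *-pos 0<g (*-pos 0<g 0<1)
        where
        0<g : 0# < g y
        0<g = <-≤-trans 0<δ (δ≤g y)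

      nf : NonNegBounded f
      nf = record
        { nonNeg  = λ y → <⇒≤ (f-pos y)
        ; bound   = M * M
        ; 0≤bound = *-nonNeg 0≤M 0≤M
        ; ≤bound  = λ y → ≤-trans (≤-reflexive (*-congˡ (*-identityʳ _))) (*-mono-≤ (0≤g y) 0≤M (g≤M y) (g≤M y))
        }

      f-bounded : Bounded f
      f-bounded = M * M , λ y → ≤-by (+-nonNeg (0≤bound nf) (nonNeg nf y)) (solve 2 (λ t₁ M → t₁ :- :- (M :* M)
            := M :* M :+ t₁) refl (f y) M) , ≤bound nf y

      v : ℕ → Fun
      v n y = √ P (step n) f y

      0≤Pf : ∀ n y → 0# ≤ P (step n) f y
      0≤Pf n = P-nonNeg (step-nonNeg n) nf

      P-first-small : ∀ {k c} → NonNegBounded k → (∀ y → ∣ Δ (Δ k) y ∣≤ c) → 0# ≤ c → O 2 (λ n y → P (step n) k y - (k y + step n * Δ k y))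
      P-first-small {k} {c} nk p 0≤c = within c 0≤c λ n y →
        ∣∣≤-trans (P-first (step-nonNeg n) nk p y) (≤-reflexive (solve 2 (λ t₁ c → t₁ :* t₁ :* c
              := c :* t₁ :^ 2) refl (step n) c))

      second-order : ∀ {k} → NonNegBounded k → O 2 (λ n y → P (step n) k y - (k y + step n * Δ k y))
      second-order {k} nk = P-first-small nk (λ y → Δ-∣∣≤ y λ z → Δ-∣∣≤ z (∣∣≤bound nk))
        (*-nonNeg D-nonNeg (+-nonNeg 0≤c′ 0≤c′))
        where
        0≤c′ : 0# ≤ D * (bound nk + bound nk)
        0≤c′ = *-nonNeg D-nonNeg (+-nonNeg (0≤bound nk) (0≤bound nk))

      step≤1 : ∀ n → step n ≤ 1#
      step≤1 n = *-cancelʳ-≤ (0<ι-suc n) (≤-resp (sym (⁻¹-inverseˡ (0<ι-suc n))) refl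
        (≤-by (ι-nonNeg n) (solve 1 (λ t₁ → con (+ 1) :* (con (+ 1) :+ t₁) :- con (+ 1) := t₁) refl (ι n))))

      g-bounded : O 0 (λ _ → g)
      g-bounded = O-bounded 0≤M λ _ y → ∣∣≤bound ng y

      open Expansion (λ _ → g) v 0<δ (λ _ → δ≤g) g-bounded (λ n y → √-nonNeg (0≤Pf n y))
        (O-cong (λ n y → +-cong (sym (√-square (0≤Pf n y))) (-‿cong (+-congʳ (*-congˡ (*-identityʳ _))))) (second-order nf))

      Γg Γgw ΔΓg : Carrier
      Γg  = Γ₁ g x
      Γgw = Γ g (ratio g) x
      ΔΓg = Δ (Γ₁ g) x

      excess : Carrier
      excess = 2# * Γgw - (ΔΓg + 2# * K * Γg)

      R₁ R₂ : ℕ → Fun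
      R₁ n y = Γ₁ (v n) y - (Γ₁ g y + 2# * step n * Γ g (ratio g) y)
      R₂ n y = P (step n) (Γ₁ g) y - (Γ₁ g y + step n * Δ (Γ₁ g) y)

      -- What remains when both first-order expansions are inserted into `damped` and step ·
      -- `excess` is isolated; the last summand is the cross term 4K step² Γ(g,w).
      error : ℕ → Fun
      error n y = R₂ n y - (1# - step n * (2# * K)) * R₁ n y + step n * (step n * (2# * (2# * K) * Γ g (ratio g) y))

      error-small : O 2 error
      error-small = O-+ (O-- (second-order (Γ₁-bounded ng)) (O-* factor (Γ₁-expansion step≤1)))
        (O-* O-h (O-* O-h (O-*ˡ (2# * (2# * K)) (O-Γ g-bounded w-bounded))))
        where
        factor : O 0 (λ n y → 1# - step n * (2# * K))
        factor = O-bounded (+-nonNeg 0≤1 (*-nonNeg 0≤1 (abs-nonNeg (2# * K)))) λ n y →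
          ∣∸∣≤ (nonNeg⇒∣∣≤ 0≤1 ≤-refl) (∣*∣≤ (nonNeg⇒∣∣≤ (step-nonNeg n) (step≤1 n)) (∣x∣≤abs (2# * K)))

      √f≈g : ∀ y → √ f y ≈ g y
      √f≈g y = √-unique (0≤g y) (sym (*-congˡ (*-identityʳ _)))

      PΓ : ℕ → Carrier
      PΓ n = P (step n) (Γ₁ g) x

      -- Multiplying the gradient bound by the nonnegative number 1 - 2Kh absorbs the exponential
      -- through `exp*[1-x]≤1` and leaves an inequality polynomial in h.
      damped : ∀ n → step n * (2# * K) ≤ 1# → (1# - step n * (2# * K)) * Γ₁ (v n) x ≤ PΓ n
      damped n p = begin
        (1# - s) * Γ₁ (v n) x
          ≤⟨ *-monoˡ-≤ (gap p) (gradient-bound f f-pos f-bounded (step n) (step-nonNeg n) x) ⟩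
        (1# - s) * (exp (2# * K * step n) * P (step n) (Γ₁ (√_ ∘ f)) x)
          ≈⟨ *-congˡ (*-congˡ (P-cong (step-nonNeg n) (Γ₁-bounded (√-bounded nf)) (Γ₁-bounded ng) (λ y → Γ₁-cong y √f≈g) x)) ⟩
        (1# - s) * (exp (2# * K * step n) * PΓ n)
          ≈⟨ solve 4 (λ t₁ K t₂ t₃ → (con (+ 1) :- t₁ :* (con (+ 2) :* K)) :* (t₂ :* t₃)
                := t₂ :* (con (+ 1) :- con (+ 2) :* K :* t₁) :* t₃)
                refl (step n) K (exp (2# * K * step n)) (PΓ n) ⟩
        exp (2# * K * step n) * (1# - 2# * K * step n) * PΓ n
          ≤⟨ *-monoʳ-≤ (P-nonNeg (step-nonNeg n) (Γ₁-bounded ng) x) (exp*[1-x]≤1 (2# * K * step n)) ⟩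
        1# * PΓ n
          ≈⟨ *-identityˡ _ ⟩
        PΓ n ∎
        where
        s : Carrier
        s = step n * (2# * K)

      -- The zeroth-order terms cancel, and one factor of the step divides out; `excess` does not
      -- depend on `n`, so letting the step vanish forces it to be at most zero.
      excess-bound : ∀ n → step n * (2# * K) ≤ 1# → excess ≤ O.C error-small * step n
      excess-bound n p = *-cancelʳ-≤ (step-pos n) (≤-by (+-nonNeg (gap (upper (O.∣F∣≤ error-small n x))) (gap (damped n p)))
        (solve 8 (λ t₁ t₂ Γgw ΔΓg K Γg t₃ t₄ → t₁ :* t₂ :* t₂ :- (con (+ 2) :* Γgw :- (ΔΓg :+ con (+ 2) :* K :* Γg)) :* t₂
           := t₁ :* t₂ :^ 2 :- (t₃ :- (Γg :+ t₂ :* ΔΓg) :- (con (+ 1) :- t₂ :* (con (+ 2) :* K)) :* (t₄ :- (Γg :+ con (+ 2) :* t₂ :* Γgw)) :+ t₂ :* (t₂ :* (con (+ 2) :* (con (+ 2) :* K) :* Γgw))) :+ (t₃ :- (con (+ 1) :- t₂ :* (con (+ 2) :* K)) :* t₄))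
           refl (O.C error-small) (step n) Γgw ΔΓg K Γg (PΓ n) (Γ₁ (v n) x)))

      curvature : Curvature K g x
      curvature = ≤-by (gap (const-≤-⟶ (eventually-map excess-bound
          (eventually-small 1# (⟶-cong (λ n → *-comm _ _) refl (*-null (2# * K) step-null)) 0<1)) (*-null (O.C error-small) step-null)))
        (solve 4 (λ ΔΓg K Γg Γgw → ΔΓg :+ con (+ 2) :* K :* Γg :- con (+ 2) :* Γgw
           := con (+ 0) :- (con (+ 2) :* Γgw :- (ΔΓg :+ con (+ 2) :* K :* Γg)))
           refl ΔΓg K Γg Γgw)

    -- A bound of at least one also covers the value taken by the truncated function off the ball.
    -- Applied to reciprocals, it gives the positive lower bound.
    list-bound : ∀ (f : Fun) (ys : List V) → ∃[ M ] 1# ≤ M × (∀ y → y ∈ ys → f y ≤ M)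
    list-bound f []       = 1# , ≤-refl , λ _ ()
    list-bound f (z ∷ ys) = max (f z) M , ≤-trans 1≤M (y≤max _ _) , bounds
      where
      M : Carrier
      M = proj₁ (list-bound f ys)
      1≤M : 1# ≤ M
      1≤M = proj₁ (proj₂ (list-bound f ys))
      bounds : ∀ y → y ∈ z ∷ ys → f y ≤ max (f z) M
      bounds y (here ≡.refl) = x≤max _ _
      bounds y (there y∈)    = ≤-trans (proj₂ (proj₂ (list-bound f ys)) y y∈) (y≤max _ _)

    -- Γ̃₂ at x only sees the values on the ball of radius two about x, so f may be replaced by 1 outside it.
    module Truncation (f : Fun) (pos : Positive f) (x : V) where

      ball : List V
      ball = x ∷ nb x ++ concatMap nb (nb x)

      centre∈ : x ∈ ball
      centre∈ = here ≡.refl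

      nb∈ : ∀ y → y ∈ nb x → y ∈ ball
      nb∈ y y∈ = there (∈-++⁺ˡ y∈)

      nb²∈ : ∀ y → y ∈ nb x → ∀ z → z ∈ nb y → z ∈ ball
      nb²∈ y y∈ z z∈ = there (∈-++⁺ʳ (nb x) (∈-concatMap⁺ nb (lose y∈ z∈)))

      g : Fun
      g y = if does (lem {y ∈ ball}) then f y else 1#

      agree : ∀ y → y ∈ ball → f y ≈ g y
      agree y y∈ = if-elim (f y ≈_) (lem {y ∈ ball}) (λ _ → refl) (λ ¬y∈ → ⊥-elim (¬y∈ y∈))

      M N : Carrier
      M = proj₁ (list-bound f ball)
      N = proj₁ (list-bound (λ y → (f y) ⁻¹) ball)

      1≤M : 1# ≤ M
      1≤M = proj₁ (proj₂ (list-bound f ball))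

      1≤N : 1# ≤ N
      1≤N = proj₁ (proj₂ (list-bound (λ y → (f y) ⁻¹) ball))

      0<N : 0# < N
      0<N = <-≤-trans 0<1 1≤N

      g≤M : ∀ y → g y ≤ M
      g≤M y = if-elim (_≤ M) (lem {y ∈ ball}) (proj₂ (proj₂ (list-bound f ball)) y) (λ _ → 1≤M)

      N⁻¹≤g : ∀ y → N ⁻¹ ≤ g y
      N⁻¹≤g y = if-elim (N ⁻¹ ≤_) (lem {y ∈ ball}) inside (λ _ → below-one)
        where
        inside : y ∈ ball → N ⁻¹ ≤ f y
        inside y∈ = *-cancelʳ-≤ 0<N (≤-resp (sym (trans (⁻¹-inverseˡ 0<N) (sym (trans (*-comm _ _) (⁻¹-inverseˡ (pos y)))))) refl
          (*-monoˡ-≤ (<⇒≤ (pos y)) (proj₂ (proj₂ (list-bound (λ y → (f y) ⁻¹) ball)) y y∈)))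
        below-one : N ⁻¹ ≤ 1#
        below-one = *-cancelʳ-≤ 0<N (≤-resp (sym (⁻¹-inverseˡ 0<N)) (sym (*-identityˡ N)) 1≤N)

      g-pos : Positive g
      g-pos y = <-≤-trans (⁻¹-pos 0<N) (N⁻¹≤g y)

      -- The vertices at which `Γ₁` and `ratio` are determined by values on the ball. The outer
      -- operator at `x` evaluates them at `x` and its neighbours, whence radius two.
      Sees : V → Set
      Sees y = y ∈ ball × (∀ z → z ∈ nb y → z ∈ ball)

      sees-centre : Sees x
      sees-centre = centre∈ , nb∈

      sees-nb : ∀ y → y ∈ nb x → Sees y
      sees-nb y y∈ = nb∈ y y∈ , nb²∈ y y∈

      ratio-agree : ∀ y → Sees y → ratio f y ≈ ratio g y
      ratio-agree y (p , q) = *-cancelʳ (*-pos 0<2 (g-pos y)) (begin-equality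
        ratio f y * (2# * g y)       ≈⟨ *-congˡ (*-congˡ (agree y p)) ⟨
        ratio f y * (2# * f y)       ≈⟨ /-cancelʳ _ (pos⇒≉0 (*-pos 0<2 (pos y))) ⟩
        Δ (λ z → f z ^ 2) y          ≈⟨ Δ-cong-nb y (^-cong 2 (agree y p)) (λ z z∈ → ^-cong 2 (agree z (q z z∈))) ⟩
        Δ (λ z → g z ^ 2) y          ≈⟨ /-cancelʳ _ (pos⇒≉0 (*-pos 0<2 (g-pos y))) ⟨
        ratio g y * (2# * g y)       ∎)

      Γ₁-agree : ∀ y → Sees y → Γ₁ f y ≈ Γ₁ g y
      Γ₁-agree y (p , q) = Γ-cong-nb y (agree y p) (λ z z∈ → agree z (q z z∈)) (agree y p) (λ z z∈ → agree z (q z z∈))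

      curvature : Curvature K f x
      curvature = ≤-resp
        (sym (*-congˡ (Γ-cong-nb x (agree x centre∈) (λ y y∈ → agree y (nb∈ y y∈)) (ratio-agree x sees-centre) (λ y y∈ → ratio-agree y (sees-nb y y∈)))))
        (sym (+-cong (Δ-cong-nb x (Γ₁-agree x sees-centre) (λ y y∈ → Γ₁-agree y (sees-nb y y∈))) (*-congˡ (Γ₁-agree x sees-centre))))
        (BoundedFunction.curvature (⁻¹-pos 0<N) N⁻¹≤g g≤M (≤-trans 0≤1 1≤M) x)

theorem3p4 :
  (lem : ExcludedMiddle 0ℓ) (ℛ : Reals) →
  let open Analysis lem ℛ in
  (G : WeightedGraph) →
  let open Heat G in
  (E : Exhaustion) (B : ∀ k → Eigenbasis (U E k)) →
  let open Semigroup E B in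
  (K : Carrier) →
  CDE′ ∞ (- K) ⇔
  (∀ f → Positive f → Bounded f → ∀ t → 0# ≤ t → ∀ x →
    Γ₁ (√_ ∘ P t f) x ≤ exp (2# * K * t) * P t (Γ₁ (√_ ∘ f)) x)
theorem3p4 lem ℛ G E B K = mk⇔
  (λ cde f pos bd t 0≤t x → Forward.gradient-bound (CDE′⇒Curvature cde) f pos bd t 0≤t x)
  (λ bound f pos x → Curvature⇒CDE′ (Reverse.Truncation.curvature (λ f pos bd t 0≤t x → bound f pos bd t 0≤t x)) f pos x)
  where
  open GradientBound lem ℛ G E B using (CDE′⇒Curvature; Curvature⇒CDE′)
  open GradientEquivalence lem ℛ G E B K
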